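{- For each $a\in\{0,1\}$ there is a partial function $F^a=(F^a_0,F^a_1,F^a_2):\omega^\omega\to(\omega^\omega)^3$, recursive on its domain, such that: (a) For each $1\le\xi\le2$ and each $\gamma\in BC_\xi$, setting $B:=2^\omega\setminus\rho^{2^\omega}(\gamma)\in\mathbf{\Pi}^0_\xi$, $F^0(\gamma)$ is defined and (1) $F^0_0(\gamma)\in BC_1$; set $C:=\omega^\omega\setminus\rho^{\omega^\omega}(F^0_0(\gamma))\in\mathbf{\Pi}^0_1$; (2) $f:=\{F^0_1(\gamma)\}^{\omega^\omega,2^\omega}$ restricted to $C$ defines a continuous bijection from $C$ onto $B$; (3) $F^0_2(\gamma)\in BC_1$, and the open set $\rho^{2^\omega\times\omega}(F^0_2(\gamma))$ computes on $B$ a partial function $g:2^\omega\to\omega^\omega$, defined and continuous on $B$, which coincides with $f^{ -1}$ (on $B$). (b) For each $1\le\xi<\omega_1$ and each $\gamma\in BC_\xi$, setting $B:=2^\omega\setminus\rho^{2^\omega}(\gamma)\in\mathbf{\Pi}^0_\xi$, $F^1(\gamma)$ is defined and (1) $F^1_0(\gamma)\in BC_1$; set $C:=\omega^\omega\setminus\rho^{\omega^\omega}(F^1_0(\gamma))\in\mathbf{\Pi}^0_1$; (2) $f:=\{F^1_1(\gamma)\}^{\omega^\omega,2^\omega}$ restricted to $C$ defines a continuous bijection from $C$ onto $B$; (3) $F^1_2(\gamma)\in BC_{\xi^- }$, and the $\mathbf{\Sigma}^0_{\xi^- }$ set $\rho^{2^\omega\times\omega}(F^1_2(\gamma))$ computes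 on $B$ a partial function $g:2^\omega\to\omega^\omega$, defined and $\mathbf{\Sigma}^0_{\xi^- }$-measurable on $B$, which coincides with $f^{ -1}$ (on $B$).
   Context: For a countable ordinal $\xi$, $\xi-1$ is the predecessor of $\xi$ if it exists and $\xi$ otherwise; $\xi^-:=\xi-1$ if $\xi\ge3$, and $\xi^-:=\xi$ otherwise. Boldface classes are the usual Borel classes. Effective notions (recursively presented Polish spaces, recursive functions) are those of Moschovakis' book "Descriptive Set Theory". Each recursively presented Polish space $X$ has its standard effective enumeration $(N(X,k))_{k\in\omega}$ of a neighbourhood basis (possibly with empty sets; $N(X,0)=\emptyset$). $X$ is of type at most $1$ if it is a finite product of spaces equal to $\omega$, $\omega^\omega$ or $2^\omega$. $B\in\Sigma^0_1(X)$ iff $B=\bigcup_{i}N(X,\varepsilon(i))$ for some recursive $\varepsilon:\omega\to\omega$. Fix a good parametrization: sets $G^X\in\Sigma^0_1(\omega^\omega\times X)$, one for each recursively presented Polish $X$, such that $P\subseteq X$ is open iff $P=G^X_\gamma$ for some $\gamma\in\omega^\omega$, $P$ is $\Sigma^0_1$ iff $P=G^X_\gamma$ for some recursive $\gamma$, and for $X$ of type at most 1 and any $Y$ there is a recursive $S^{X,Y}:\omega^\omega\times X\to\omega^\omega$ with $(\gamma,x,y)\in G^{X\times Y}\Leftrightarrow(S^{X,Y}(\gamma,x),y)\in G^Y$. For $\gamma\in\omega^\omega$, $\{\gamma\}^{X,Y}$ is the partial function from $X$ to $Y$ with $\{\gamma\}^{X,Y}(x)$ defined and equal to $y$ iff $y$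 is the (unique) point with $\forall k\,[y\in N(Y,k)\Leftrightarrow(\gamma,x,k)\in G^{X\times\omega}]$; write $\{\gamma\}$ when $Y=\omega^\omega$. Borel codes: let $\gamma^*(i):=\gamma(i+1)$. $BC_1:=\{\gamma\in\omega^\omega\mid\gamma(0)=0\}$ and for $2\le\xi<\omega_1$, $BC_\xi:=\{\gamma\in\omega^\omega\mid\gamma(0)=1$ and $\forall i\in\omega$, $\{\gamma^*\}(i)$ is defined and in $\bigcup_{1\le\eta<\xi}BC_\eta\}$; $BC:=\bigcup_{1\le\xi<\omega_1}BC_\xi$. For $\gamma\in BC$, $\rho^X(\gamma):=\bigcup_iN(X,\gamma^*(i))$ if $\gamma\in BC_1$, and $\rho^X(\gamma):=\bigcup_iX\setminus\rho^X(\{\gamma^*\}(i))$ otherwise. For a partial function $f:X\to Y$ and $D\subseteq\mathrm{Domain}(f)$, a set $P\subseteq X\times\omega$ computes $f$ on $D$ if for all $x\in D$ and $k\in\omega$, $f(x)\in N(Y,k)\Leftrightarrow(x,k)\in P$; $f$ is recursive on $D$ if some $P\in\Sigma^0_1(X\times\omega)$ computes $f$ on $D$. -}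

module Defs where

open import Axiom.ExcludedMiddle using (ExcludedMiddle)
open import Data.Bool using (Bool; true; false)
open import Data.Fin using (Fin)
open import Data.Nat as ℕ using (ℕ; zero; suc; _*_)
import Data.Nat.Properties as ℕₚ
open ℕₚ using (+-identityʳ; +-suc)
open import Data.Product using (∃-syntax; Σ-syntax; _×_; _,_; proj₁; proj₂)
open import Data.Vec using (Vec; []; _∷_; lookup)
open import Data.Vec.Relation.Binary.Pointwise.Inductive using (Pointwise)
open import Function using (_∘_; _⇔_; mk⇔; Equivalence)
open import Level using (0ℓ)
open import Relation.Binary.PropositionalEquality using (_≡_; _≗_; refl; sym; trans; cong; subst)
open import Relation.Nullary using (¬_; yes; no)
open import Relation.Unary using (Pred; _∈_; _⊆_; _≐_; ∁; ⋃)

------------------------------------------------------------------------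
-- Recursive functions on ω (μ-recursive schemes, as partial functions)

data Scheme : ℕ → Set where
  zero : ∀ {n} → Scheme n
  succ : Scheme 1
  proj : ∀ {n} → Fin n → Scheme n
  comp : ∀ {m n} → Scheme m → Vec (Scheme n) m → Scheme n
  prec : ∀ {n} → Scheme n → Scheme (suc (suc n)) → Scheme (suc n)
  mu   : ∀ {n} → Scheme (suc n) → Scheme n

infix 4 _[_]⇓_

data _[_]⇓_ : ∀ {n} → Scheme n → Vec ℕ n → ℕ → Set where
  zero⇓ : ∀ {n} {xs : Vec ℕ n} → zero [ xs ]⇓ 0
  succ⇓ : ∀ {x} → succ [ x ∷ [] ]⇓ suc x
  proj⇓ : ∀ {n} {xs : Vec ℕ n} (i : Fin n) → proj i [ xs ]⇓ lookup xs i
  comp⇓ : ∀ {m n} {f : Scheme m} {gs : Vec (Scheme n) m} {xs : Vec ℕ n} {ys : Vec ℕ m} {z} →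
          Pointwise (λ g y → g [ xs ]⇓ y) gs ys → f [ ys ]⇓ z → comp f gs [ xs ]⇓ z
  prec-zero⇓ : ∀ {n} {f : Scheme n} {g} {xs : Vec ℕ n} {y} →
          f [ xs ]⇓ y → prec f g [ 0 ∷ xs ]⇓ y
  prec-suc⇓ : ∀ {n} {f : Scheme n} {g} {xs : Vec ℕ n} {k y z} →
          prec f g [ k ∷ xs ]⇓ y → g [ k ∷ y ∷ xs ]⇓ z → prec f g [ suc k ∷ xs ]⇓ z
  mu⇓ : ∀ {n} {f : Scheme (suc n)} {xs : Vec ℕ n} {k} →
          f [ k ∷ xs ]⇓ 0 → (∀ j → j ℕ.< k → ∃[ v ] f [ j ∷ xs ]⇓ suc v) → mu f [ xs ]⇓ k

Recursive : Pred (ℕ → ℕ) 0ℓ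
Recursive ε = ∃[ e ] ∀ n → e [ n ∷ [] ]⇓ ε n

------------------------------------------------------------------------
-- Coding of pairs: unpair runs through ℕ × ℕ along the antidiagonals
-- (0,0), (1,0), (0,1), (2,0), (1,1), (0,2), …

next : ℕ × ℕ → ℕ × ℕ
next (zero  , b) = suc b , zero
next (suc a , b) = a , suc b

unpair : ℕ → ℕ × ℕ
unpair zero    = zero , zero
unpair (suc n) = next (unpair n)

π₀ π₁ : ℕ → ℕ
π₀ s = proj₁ (unpair s)
π₁ s = proj₂ (unpair s)

-- The s-th eventually zero sequence of natural numbers.
seq : ℕ → ℕ → ℕ
seq s zero    = π₀ s
seq s (suc n) = seq (π₁ s) n

------------------------------------------------------------------------
-- Spaces of type at most 1.  Points are compared by _≈_ below, since
-- function extensionality is not available.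

infixr 5 _⊗_

data Space : Set where
  ω ωω 2ω : Space
  _⊗_     : Space → Space → Space

Pt : Space → Set
Pt ω       = ℕ
Pt ωω      = ℕ → ℕ
Pt 2ω      = ℕ → Bool
Pt (X ⊗ Y) = Pt X × Pt Y

Eq : ∀ X → Pt X → Pt X → Set
Eq ω       x y             = x ≡ y
Eq ωω      x y             = x ≗ y
Eq 2ω      x y             = x ≗ y
Eq (X ⊗ Y) (x , y) (z , w) = Eq X x z × Eq Y y w

bit : ℕ → Bool
bit zero    = false
bit (suc _) = true

-- The distance of two distinct points is 1/(n+1) in ωω and 2ω, n being the
-- first place at which they differ, and 1 in ω.  So d(x,r) < p/(q+1) holds
-- iff 0 < p and x, r agree at all places n with 1/(n+1) ≥ p/(q+1).

Ball : {A : Set} → ℕ → ℕ → (ℕ → A) → Pred (ℕ → A) 0ℓ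
Ball p q r x = 0 ℕ.< p × (∀ n → p * suc n ℕ.≤ suc q → x n ≡ r n)

-- N X s is the ball B(r_i , p/(q+1)), where s codes i and a code of (p , q)
-- and r_i is the i-th point of the canonical dense sequence of X.
-- In a product, s codes a pair of neighbourhoods.

N : ∀ X → ℕ → Pred (Pt X) 0ℓ
N ω       s x       = 0 ℕ.< π₀ (π₁ s) × (π₀ (π₁ s) ℕ.≤ suc (π₁ (π₁ s)) → x ≡ π₀ s)
N ωω      s x       = x ∈ Ball (π₀ (π₁ s)) (π₁ (π₁ s)) (seq (π₀ s))
N 2ω      s x       = x ∈ Ball (π₀ (π₁ s)) (π₁ (π₁ s)) (bit ∘ seq (π₀ s))
N (X ⊗ Y) s (x , y) = x ∈ N X (π₀ s) × y ∈ N Y (π₁ s)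

N-zero : ∀ X {x} → ¬ x ∈ N X 0
N-zero ω       (() , _)
N-zero ωω      (() , _)
N-zero 2ω      (() , _)
N-zero (X ⊗ Y) (p , _) = N-zero X p

Eq-sym : ∀ X {x y} → Eq X x y → Eq X y x
Eq-sym ω       e       = sym e
Eq-sym ωω      e n     = sym (e n)
Eq-sym 2ω      e n     = sym (e n)
Eq-sym (X ⊗ Y) (e , f) = Eq-sym X e , Eq-sym Y f

N-resp : ∀ X k {x y} → Eq X x y → x ∈ N X k → y ∈ N X k
N-resp ω       k e (p , h)       = p , λ l → trans (sym e) (h l)
N-resp ωω      k e (p , h)       = p , λ n l → trans (sym (e n)) (h n l)
N-resp 2ω      k e (p , h)       = p , λ n l → trans (sym (e n)) (h n l)
N-resp (X ⊗ Y) k (e , f) (p , q) = N-resp X (π₀ k) e p , N-resp Y (π₁ k) f q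

private
  line : ∀ d b a → a ℕ.+ b ≡ d → ∃[ s ] unpair s ≡ (a , b)
  line zero    zero    zero    eq = 0 , refl
  line zero    zero    (suc a) ()
  line (suc d) zero    zero    ()
  line (suc d) zero    (suc a) eq with line d d 0 refl
  ... | s , e = suc s , trans (cong next e)
                  (cong (_, 0) (trans (sym eq) (+-identityʳ (suc a))))
  line d       (suc b) a       eq with line d b (suc a) (trans (sym (+-suc a b)) eq)
  ... | s , e = suc s , cong next e

unpair-surjective : ∀ a b → ∃[ s ] unpair s ≡ (a , b)
unpair-surjective a b = line (a ℕ.+ b) b a refl

private
  seq-dense : ∀ (x : ℕ → ℕ) m → ∃[ i ] (∀ n → n ℕ.< m → x n ≡ seq i n)
  seq-dense x zero = 0 , λ _ ()
  seq-dense x (suc m) with seq-dense (x ∘ suc) m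
  ... | j , h with unpair-surjective (x 0) j
  ... | i , e = i , λ
    { zero    _           → sym (cong proj₁ e)
    ; (suc n) (ℕ.s≤s n<m) → trans (h n n<m) (cong (λ p → seq (proj₂ p) n) (sym e))
    }

  code : ∀ i p q → ∃[ s ] (π₀ s ≡ i × π₀ (π₁ s) ≡ p × π₁ (π₁ s) ≡ q)
  code i p q with unpair-surjective p q
  ... | t , e with unpair-surjective i t
  ... | s , f = s , cong proj₁ f
                  , cong proj₁ (trans (cong (unpair ∘ proj₂) f) e)
                  , cong proj₂ (trans (cong (unpair ∘ proj₂) f) e)

  ball : ∀ {A : Set} (r : ℕ → ℕ → A) (x : ℕ → A) q →
         (∃[ i ] (∀ n → n ℕ.< suc q → x n ≡ r i n)) →
         ∃[ s ] (x ∈ Ball (π₀ (π₁ s)) (π₁ (π₁ s)) (r (π₀ s)) ×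
                 (∀ y → y ∈ Ball (π₀ (π₁ s)) (π₁ (π₁ s)) (r (π₀ s)) → x q ≡ y q))
  ball r x q (i , h) with code i 1 q
  ... | s , ei , ep , eq = s , around ei ep eq
    where
    around : ∀ {i′ p′ q′} → i′ ≡ i → p′ ≡ 1 → q′ ≡ q →
             x ∈ Ball p′ q′ (r i′) × (∀ y → y ∈ Ball p′ q′ (r i′) → x q ≡ y q)
    around refl refl refl =
      (ℕ.s≤s ℕ.z≤n , λ n l → h n (subst (ℕ._≤ suc q) (ℕₚ.*-identityˡ (suc n)) l)) ,
      λ { y (_ , g) → trans (h q (ℕₚ.n<1+n q)) (sym (g q (ℕₚ.≤-reflexive (ℕₚ.*-identityˡ (suc q))))) }

  unbit : Bool → ℕ
  unbit false = 0
  unbit true  = 1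

  bit-unbit : ∀ b → bit (unbit b) ≡ b
  bit-unbit false = refl
  bit-unbit true  = refl

  sep-ωω : (x : ℕ → ℕ) → ∀ n → ∃[ s ] (x ∈ N ωω s × (∀ y → y ∈ N ωω s → x n ≡ y n))
  sep-ωω x n = ball seq x n (seq-dense x (suc n))

  sep-2ω : (x : ℕ → Bool) → ∀ n → ∃[ s ] (x ∈ N 2ω s × (∀ y → y ∈ N 2ω s → x n ≡ y n))
  sep-2ω x n with seq-dense (unbit ∘ x) (suc n)
  ... | i , h = ball (λ j → bit ∘ seq j) x n
                  (i , λ m l → trans (sym (bit-unbit (x m))) (cong bit (h m l)))

  sep-ω : (x : ℕ) → ∃[ s ] (x ∈ N ω s × (∀ y → y ∈ N ω s → x ≡ y))
  sep-ω x with code x 1 0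
  ... | s , ei , ep , eq = s , around ei ep eq
    where
    around : ∀ {i′ p′ q′} → i′ ≡ x → p′ ≡ 1 → q′ ≡ 0 →
             (0 ℕ.< p′ × (p′ ℕ.≤ suc q′ → x ≡ i′)) ×
             (∀ y → 0 ℕ.< p′ × (p′ ℕ.≤ suc q′ → y ≡ i′) → x ≡ y)
    around refl refl refl =
      (ℕ.s≤s ℕ.z≤n , λ _ → refl) , λ { y (_ , g) → sym (g (ℕ.s≤s ℕ.z≤n)) }

  covers : ∀ X x → ∃[ s ] x ∈ N X s
  covers ω  x = let s , p , _ = sep-ω x in s , p
  covers ωω x = let s , p , _ = sep-ωω x 0 in s , p
  covers 2ω x = let s , p , _ = sep-2ω x 0 in s , p
  covers (X ⊗ Y) (x , y) with covers X x | covers Y y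
  ... | i , p | j , q with unpair-surjective i j
  ... | s , e = s , subst (λ k → x ∈ N X k) (sym (cong proj₁ e)) p
                  , subst (λ k → y ∈ N Y k) (sym (cong proj₂ e)) q

N-separates : ∀ X x y → (∀ k → x ∈ N X k → y ∈ N X k) → Eq X x y
N-separates ω  x y h   = let s , p , g = sep-ω x in g y (h s p)
N-separates ωω x y h n = let s , p , g = sep-ωω x n in g y (h s p)
N-separates 2ω x y h n = let s , p , g = sep-2ω x n in g y (h s p)
N-separates (X ⊗ Y) (x , y) (x′ , y′) h =
  N-separates X x x′ left , N-separates Y y y′ right
  where
  left : ∀ k → x ∈ N X k → x′ ∈ N X k
  left k p with covers Y y
  ... | j , q with unpair-surjective k j
  ... | s , e = subst (λ i → x′ ∈ N X i) (cong proj₁ e) (proj₁ (h s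
                  ( subst (λ i → x ∈ N X i) (sym (cong proj₁ e)) p
                  , subst (λ i → y ∈ N Y i) (sym (cong proj₂ e)) q )))
  right : ∀ k → y ∈ N Y k → y′ ∈ N Y k
  right k p with covers X x
  ... | j , q with unpair-surjective j k
  ... | s , e = subst (λ i → y′ ∈ N Y i) (cong proj₂ e) (proj₂ (h s
                  ( subst (λ i → x ∈ N X i) (sym (cong proj₁ e)) q
                  , subst (λ i → y ∈ N Y i) (sym (cong proj₂ e)) p )))

------------------------------------------------------------------------
-- Open and semirecursive sets

Subset : Space → Set₁
Subset X = Pred (Pt X) 0ℓ

Open : ∀ X → Pred (Subset X) 0ℓ
Open X P = Σ[ ε ∈ (ℕ → ℕ) ] P ≐ ⋃[ i ∶ ℕ ] N X (ε i)

Σ⁰₁ : ∀ X → Pred (Subset X) 0ℓ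
Σ⁰₁ X P = ∃[ ε ] Recursive ε × P ≐ ⋃[ i ∶ ℕ ] N X (ε i)

Σ⁰₁-resp : ∀ X P → Σ⁰₁ X P → ∀ {x y} → Eq X x y → x ∈ P → y ∈ P
Σ⁰₁-resp X P (ε , _ , to , from) e p =
  let i , q = to p in from (i , N-resp X (ε i) e q)

------------------------------------------------------------------------
-- Partial functions, given by their graphs

infix 4 _⇀_

record _⇀_ (X Y : Space) : Set₁ where
  field
    graph      : Pt X → Pt Y → Set
    graph-resp : ∀ {x x′ y y′} → Eq X x x′ → Eq Y y y′ → graph x y → graph x′ y′
    functional : ∀ {x y y′} → graph x y → graph x y′ → Eq Y y y′

open _⇀_ public using (graph)

Domain : ∀ {X Y} → (X ⇀ Y) → Subset X
Domain f x = ∃[ y ] graph f x y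

-- x ∈ f ⁻¹[ U ] : f(x) is defined and in U.
_⁻¹[_] : ∀ {X Y} → (X ⇀ Y) → Subset Y → Subset X
f ⁻¹[ U ] = λ x → ∃[ y ] graph f x y × y ∈ U

-- P computes f on D.
Computes : ∀ {X Y} → Subset (X ⊗ ω) → (X ⇀ Y) → Subset X → Set
Computes {X} {Y} P f D =
  D ⊆ Domain f × (∀ x → x ∈ D → ∀ k → x ∈ f ⁻¹[ N Y k ] ⇔ (x , k) ∈ P)

RecursiveOn : ∀ {X Y} → (X ⇀ Y) → Subset X → Set₁
RecursiveOn {X} f D = ∃[ P ] Σ⁰₁ (X ⊗ ω) P × Computes P f D

-- The restriction of f to D is defined, and the preimages under it of open
-- sets are the traces on D of sets in Γ.
MeasurableOn : ∀ {ℓ X Y} → Pred (Subset X) ℓ → (X ⇀ Y) → Subset X → Set _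
MeasurableOn {X = X} {Y} Γ f D =
  D ⊆ Domain f ×
  (∀ U → U ∈ Open Y → ∃[ V ] V ∈ Γ × (∀ x → x ∈ D → x ∈ f ⁻¹[ U ] ⇔ x ∈ V))

ContinuousOn : ∀ {X Y} → (X ⇀ Y) → Subset X → Set₁
ContinuousOn {X} f D = MeasurableOn (Open X) f D

record ContinuousBijection {X Y} (f : X ⇀ Y) (C : Subset X) (B : Subset Y) : Set₁ where
  field
    continuous : ContinuousOn f C
    into       : ∀ {x y} → x ∈ C → graph f x y → y ∈ B
    injective  : ∀ {x x′ y} → x ∈ C → x′ ∈ C → graph f x y → graph f x′ y → Eq X x x′
    onto       : ∀ {y} → y ∈ B → ∃[ x ] x ∈ C × graph f x y

-- On B, g coincides with the inverse of the bijection f|C : C → B.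
InverseOn : ∀ {X Y} → (Y ⇀ X) → (X ⇀ Y) → Subset X → Subset Y → Set
InverseOn g f C B = ∀ x y → y ∈ B → graph g y x ⇔ (x ∈ C × graph f x y)

------------------------------------------------------------------------
-- Countable ordinals, as notations closed under suprema of arbitrary
-- (not necessarily increasing) sequences; ≈ is equality of ordinals.

data Ord : Set where
  zero : Ord
  suc  : Ord → Ord
  sup  : (ℕ → Ord) → Ord

infix 4 _≤_ _<_ _≈_

data _≤_ : Ord → Ord → Set where
  z≤    : ∀ {β} → zero ≤ β
  s≤s   : ∀ {α β} → α ≤ β → suc α ≤ suc β
  sup≤  : ∀ {f β} → (∀ i → f i ≤ β) → sup f ≤ β
  ≤sup  : ∀ {α f} i → α ≤ f i → α ≤ sup f

_<_ _≈_ : Ord → Ord → Set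
α < β = suc α ≤ β
α ≈ β = α ≤ β × β ≤ α

one two three : Ord
one   = suc zero
two   = suc one
three = suc two

-- ξ - 1 and ξ⁻.  Whether ξ is a successor is not decidable on notations.
module _ (em : ExcludedMiddle 0ℓ) where

  predecessor : Ord → Ord
  predecessor ξ with em {∃[ η ] ξ ≈ suc η}
  ... | yes (η , _) = η
  ... | no  _       = ξ

  minus : Ord → Ord
  minus ξ with em {three ≤ ξ}
  ... | yes _ = predecessor ξ
  ... | no  _ = ξ

------------------------------------------------------------------------
-- Boldface Borel classes

data 𝚺 (X : Space) (ξ : Ord) (P : Subset X) : Set₁ where
  𝚺-one : ξ ≈ one → P ∈ Open X → 𝚺 X ξ P
  𝚺-⋃   : two ≤ ξ → (Q : ℕ → Subset X) (η : ℕ → Ord) →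
          (∀ i → one ≤ η i) → (∀ i → η i < ξ) → (∀ i → 𝚺 X (η i) (Q i)) →
          P ≐ ⋃[ i ∶ ℕ ] ∁ (Q i) → 𝚺 X ξ P

𝚷 : ∀ X → Ord → Pred (Subset X) _
𝚷 X ξ P = 𝚺 X ξ (∁ P)

------------------------------------------------------------------------
-- Good parametrizations

-- A total f is recursive iff {(x,k) | f(x) ∈ N(Y,k)} is semirecursive.
RecursiveFunction : ∀ X Y → (Pt X → Pt Y) → Set
RecursiveFunction X Y f = Σ⁰₁ (X ⊗ ω) (λ (x , k) → f x ∈ N Y k)

record GoodParametrization : Set₁ where
  field
    G           : ∀ X → Subset (ωω ⊗ X)
    G-Σ⁰₁       : ∀ X → G X ∈ Σ⁰₁ (ωω ⊗ X)
    G-open      : ∀ X P → P ∈ Open X ⇔ (∃[ γ ] P ≐ (λ x → (γ , x) ∈ G X))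
    G-recursive : ∀ X P → P ∈ Σ⁰₁ X ⇔ (∃[ γ ] Recursive γ × P ≐ (λ x → (γ , x) ∈ G X))
    S           : ∀ X Y → Pt (ωω ⊗ X) → Pt ωω
    S-recursive : ∀ X Y → RecursiveFunction (ωω ⊗ X) ωω (S X Y)
    S-spec      : ∀ X Y γ x y → (γ , (x , y)) ∈ G (X ⊗ Y) ⇔ (S X Y (γ , x) , y) ∈ G Y

------------------------------------------------------------------------
-- Partial recursive evaluation and Borel codes

module Codes (𝒢 : GoodParametrization) where
  open GoodParametrization 𝒢

  -- {γ}^{X,Y}
  eval : ∀ X Y → Pt ωω → X ⇀ Y
  eval X Y γ = record
    { graph      = λ x y → ∀ k → y ∈ N Y k ⇔ (γ , (x , k)) ∈ G (X ⊗ ω)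
    ; graph-resp = λ e f h k → mk⇔
        (λ p → G-resp (Equivalence.to (h k) (N-resp Y k (Eq-sym Y f) p)) e)
        (λ p → N-resp Y k f (Equivalence.from (h k) (G-resp p (Eq-sym X e))))
    ; functional = λ {_} {y} {y′} h h′ → N-separates Y y y′
        (λ k → Equivalence.from (h′ k) ∘ Equivalence.to (h k))
    }
    where
    G-resp : ∀ {x x′ k} → (γ , (x , k)) ∈ G (X ⊗ ω) → Eq X x x′ → (γ , (x′ , k)) ∈ G (X ⊗ ω)
    G-resp p e = Σ⁰₁-resp (ωω ⊗ (X ⊗ ω)) (G (X ⊗ ω)) (G-Σ⁰₁ (X ⊗ ω)) ((λ _ → refl) , e , refl) p

  _* : Pt ωω → Pt ωω
  (γ *) i = γ (suc i)

  data BC (ξ : Ord) (γ : Pt ωω) : Set where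
    BC-one : ξ ≈ one → γ 0 ≡ 0 → BC ξ γ
    BC-⋃   : two ≤ ξ → γ 0 ≡ 1 → (δ : ℕ → Pt ωω) (η : ℕ → Ord) →
             (∀ i → graph (eval ω ωω (γ *)) i (δ i)) →
             (∀ i → one ≤ η i) → (∀ i → η i < ξ) → (∀ i → BC (η i) (δ i)) → BC ξ γ

  -- ρ^X(γ).  It depends only on γ: the δ i are determined up to Eq.
  ρ : ∀ X {ξ γ} → BC ξ γ → Subset X
  ρ X {γ = γ} (BC-one _ _)            = ⋃[ i ∶ ℕ ] N X ((γ *) i)
  ρ X         (BC-⋃ _ _ _ _ _ _ _ d) = ⋃[ i ∶ ℕ ] ∁ (ρ X (d i))

module Submission where

-- Unfold a Borel code γ into its tree of nodes s, with codes δ(s).  A point x has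
-- a unique witness function w: w(s) = 0 if x ∉ ρ(δ(s)), and otherwise w(s) = j + 1
-- for the least j whose disjunct of ρ(δ(s)) contains x.  Being a witness function
-- is a closed local condition, so C = {(x , w) : w correct, w(root) = 0} is closed,
-- and the projection (x , w) ↦ x is a continuous bijection from C onto B.
--
-- For x ∈ B the children of the root have nonzero witnesses, and w(s) = j + 1
-- follows from finitely many conditions of the form x ∉ ρ(δ(t)) with t below s
-- (x ∈ ρ(δ(t)) being witnessed by a child of t).  Hence w is determined by
-- nodes t of depth ≥ 2, whose ranks lie below ξ⁻, and the inverse is computed by a
-- union of finite intersections of complements ∁ ρ(δ(t)) and neighbourhoods: such
-- an intersection is a "certificate", and the Σ⁰ code lists the valid ones.  The
-- codes of their complements refer to each other and come from the recursion
-- theorem.  All maps F obtained in this way are total recursive functions of γ.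

open import Axiom.ExcludedMiddle using (ExcludedMiddle)
open import Data.Bool using (Bool; true; false)
open import Data.Empty using (⊥-elim)
open import Data.Fin using (Fin; zero; suc)
open import Data.List using (List; []; _∷_; _++_; length)
import Data.List.Membership.Propositional as List
open import Data.List.Membership.Propositional.Properties using (∈-++⁻; ∈-++⁺ˡ; ∈-++⁺ʳ)
open import Data.List.Relation.Unary.Any using (here; there)
open import Data.Nat as ℕ using (ℕ; zero; suc; _+_; _*_; _∸_)
open import Data.Nat.Properties as ℕₚ using (+-suc; +-identityʳ)
open import Data.Product using (Σ; ∃-syntax; _×_; _,_; proj₁; proj₂)
open import Data.Sum as Sum using (_⊎_; inj₁; inj₂)
open import Data.Vec using (Vec; []; _∷_; lookup; tabulate)
open import Data.Vec.Properties using (tabulate∘lookup)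
open import Data.Vec.Relation.Binary.Pointwise.Inductive using (Pointwise; []; _∷_)
open import Function using (_∘_; case_of_; _⇔_; mk⇔; Equivalence)
open import Level using (0ℓ)
open import Relation.Binary.Definitions using (tri<; tri≈; tri>)
open import Relation.Binary.PropositionalEquality
  using (_≡_; _≢_; _≗_; refl; sym; trans; cong; cong₂; subst; subst₂; module ≡-Reasoning)
open import Relation.Nullary using (¬_; Dec; yes; no; contradiction)
open import Relation.Unary using (_∈_; ∁)
open import Defs

-- The obstacle is uniformity. A code hands over its sub-codes only through partial evaluation, and
-- for arbitrary γ neither being a code nor the existence of a sub-code can be decided. So every
-- ingredient is a semirecursive condition on neighbourhoods of the sub-codes, which makes sense for
-- all γ; well-foundedness enters only when correctness is verified. A code must announce at place 0
-- whether it is a leaf or a union. Hence the shape of the code of a complement has to be readable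
-- off the number of the certificate, which is why leaves and unions have separate literals and why
-- certificates carry a flag. Part (a) asks for an open set although ξ⁻ = 2 when ξ = 2. If ξ ≤ 2 and
-- the root is a union, every other node is a leaf whose set contains all of B, so no literal about
-- a complement can be true at a point of B: certificates made of boxes alone suffice.

-- Combinators for recursive functions on ω

record Rec {n} (f : Vec ℕ n → ℕ) : Set where
  no-eta-equality
  pattern
  constructor rec
  field
    scheme   : Scheme n
    computes : ∀ xs → scheme [ xs ]⇓ f xs
open Rec

record Rec₁ (f : ℕ → ℕ) : Set where
  no-eta-equality
  pattern
  constructor rec₁
  field unary : Recursive f
open Rec₁

record Rec₂ (f : ℕ → ℕ → ℕ) : Set where
  no-eta-equality
  pattern
  constructor rec₂
  field binary : Rec {2} (λ xs → f (lookup xs zero) (lookup xs (suc zero)))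
open Rec₂

infixl 9 _$₁_
infixl 9 _$₂_,_

_$₁_ : ∀ {n φ} {f : Vec ℕ n → ℕ} → Rec₁ φ → Rec f → Rec (φ ∘ f)
rec₁ (e , c) $₁ rec e′ c′ =
  rec (comp e (e′ ∷ [])) λ xs → comp⇓ (c′ xs ∷ []) (c _)

_$₂_,_ : ∀ {n φ} {f g : Vec ℕ n → ℕ} → Rec₂ φ → Rec f → Rec g → Rec (λ xs → φ (f xs) (g xs))
rec₂ (rec e c) $₂ rec e₁ c₁ , rec e₂ c₂ =
  rec (comp e (e₁ ∷ e₂ ∷ [])) λ xs → comp⇓ (c₁ xs ∷ c₂ xs ∷ []) (c _)

cast : ∀ {n} {f g : Vec ℕ n → ℕ} → f ≗ g → Rec f → Rec g
cast p (rec e c) = rec e λ xs → subst (e [ xs ]⇓_) (p xs) (c xs)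

var : ∀ {n} (i : Fin n) → Rec (λ xs → lookup xs i)
var i = rec (proj i) λ xs → proj⇓ i

v₀ : ∀ {n} → Rec {suc n} (λ xs → lookup xs zero)
v₀ = var zero

v₁ : ∀ {n} → Rec {suc (suc n)} (λ xs → lookup xs (suc zero))
v₁ = var (suc zero)

v₂ : ∀ {n} → Rec {suc (suc (suc n))} (λ xs → lookup xs (suc (suc zero)))
v₂ = var (suc (suc zero))

v₃ : ∀ {n} → Rec {suc (suc (suc (suc n)))} (λ xs → lookup xs (suc (suc (suc zero))))
v₃ = var (suc (suc (suc zero)))

mk₁ : ∀ {φ} {f : Vec ℕ 1 → ℕ} → Rec f → (∀ a → f (a ∷ []) ≡ φ a) → Rec₁ φ
mk₁ (rec e c) p = rec₁ (e , λ a → subst (e [ _ ]⇓_) (p a) (c _))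

mk₂ : ∀ {φ} {f : Vec ℕ 2 → ℕ} → Rec f → (∀ a b → f (a ∷ b ∷ []) ≡ φ a b) → Rec₂ φ
mk₂ r p = rec₂ (cast (λ { (a ∷ b ∷ []) → p a b }) r)

sucR : Rec₁ suc
sucR = rec₁ (succ , λ _ → succ⇓)

constR : ∀ {n} k → Rec {n} (λ _ → k)
constR zero    = rec zero λ _ → zero⇓
constR (suc k) = sucR $₁ constR k

natrec : ℕ → (ℕ → ℕ → ℕ) → ℕ → ℕ
natrec z s zero    = z
natrec z s (suc k) = s k (natrec z s k)

projections : ∀ {m n} (r : Fin m → Fin n) (xs : Vec ℕ n) →
              Pointwise (λ g y → g [ xs ]⇓ y) (tabulate (proj ∘ r)) (tabulate (lookup xs ∘ r))
projections {zero}  r xs = []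
projections {suc m} r xs = proj⇓ (r zero) ∷ projections (r ∘ suc) xs

natrecR : ∀ {n} {f g : Vec ℕ n → ℕ} {s : Vec ℕ (suc (suc n)) → ℕ} → Rec f → Rec s → Rec g →
          Rec (λ xs → natrec (f xs) (λ k y → s (k ∷ y ∷ xs)) (g xs))
natrecR {f = f} {g} {s} (rec e c) (rec e′ c′) (rec e″ c″) =
  rec (comp (prec e e′) (e″ ∷ tabulate proj)) λ xs → comp⇓ (c″ xs ∷ same xs) (run xs (g xs))
  where
  same : ∀ xs → Pointwise (λ g y → g [ xs ]⇓ y) (tabulate proj) xs
  same xs = subst (Pointwise _ (tabulate proj)) (tabulate∘lookup xs) (projections (λ i → i) xs)
  run : ∀ xs k → prec e e′ [ k ∷ xs ]⇓ natrec (f xs) (λ k y → s (k ∷ y ∷ xs)) k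
  run xs zero    = prec-zero⇓ (c xs)
  run xs (suc k) = prec-suc⇓ (run xs k) (c′ _)

+R : Rec₂ _+_
+R = mk₂ (natrecR v₁ (sucR $₁ v₁) v₀) eq
  where
  eq : ∀ a b → natrec b (λ _ y → suc y) a ≡ a + b
  eq zero    b = refl
  eq (suc a) b = cong suc (eq a b)

*R : Rec₂ _*_
*R = mk₂ (natrecR (constR 0) (+R $₂ v₃ , v₁) v₀) eq
  where
  eq : ∀ a b → natrec 0 (λ _ y → b + y) a ≡ a * b
  eq zero    b = refl
  eq (suc a) b = cong (b +_) (eq a b)

predR : Rec₁ ℕ.pred
predR = mk₁ (natrecR (constR 0) v₀ v₀) λ { zero → refl ; (suc _) → refl }

∸R : Rec₂ _∸_
∸R = mk₂ (natrecR v₀ (predR $₁ v₁) v₁) eq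
  where
  eq : ∀ a b → natrec a (λ _ y → ℕ.pred y) b ≡ a ∸ b
  eq a zero    = refl
  eq a (suc b) = trans (cong ℕ.pred (eq a b)) (ℕₚ.pred[m∸n]≡m∸[1+n] a b)

choose : {A : Set} → ℕ → A → A → A
choose zero    a b = a
choose (suc _) a b = b

chooseR : ∀ {n} {f g h : Vec ℕ n → ℕ} → Rec f → Rec g → Rec h → Rec (λ xs → choose (f xs) (g xs) (h xs))
chooseR (rec e₁ c₁) (rec e₂ c₂) (rec e₃ c₃) =
  rec (comp (scheme select) (e₁ ∷ e₂ ∷ e₃ ∷ [])) λ xs →
    comp⇓ (c₁ xs ∷ c₂ xs ∷ c₃ xs ∷ []) (computes select _)
  where
  select : Rec {3} (λ xs → choose (lookup xs zero) (lookup xs (suc zero)) (lookup xs (suc (suc zero))))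
  select = cast (λ { (zero ∷ _) → refl ; (suc _ ∷ _) → refl })
             (natrecR v₁ (var (suc (suc (suc (suc zero))))) v₀)

-- The n-th triangular number is the code of (n , 0).
tri : ℕ → ℕ
tri zero    = 0
tri (suc n) = tri n + suc n

triR : Rec₁ tri
triR = mk₁ (natrecR (constR 0) (+R $₂ v₁ , (sucR $₁ v₀)) v₀) eq
  where
  eq : ∀ a → natrec 0 (λ k y → y + suc k) a ≡ tri a
  eq zero    = refl
  eq (suc a) = cong (_+ suc a) (eq a)

diag : ℕ → ℕ
diag n = π₀ n + π₁ n

-- This inverts the walk `unpair` in closed form: the diagonal d begins at the index `tri d`, and
-- `π₁ n` counts the steps taken along it.
unpair-tri : ∀ n → tri (diag n) + π₁ n ≡ n
unpair-tri zero = refl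
unpair-tri (suc n) with unpair n | unpair-tri n
... | zero  , b | eq = begin
  tri (suc b + 0) + 0  ≡⟨ +-identityʳ _ ⟩
  tri (suc b + 0)      ≡⟨ cong tri (+-identityʳ (suc b)) ⟩
  tri b + suc b        ≡⟨ +-suc (tri b) b ⟩
  suc (tri b + b)      ≡⟨ cong suc eq ⟩
  suc n                ∎
  where open ≡-Reasoning
... | suc a , b | eq = begin
  tri (a + suc b) + suc b    ≡⟨ cong (λ d → tri d + suc b) (+-suc a b) ⟩
  tri (suc a + b) + suc b    ≡⟨ +-suc _ b ⟩
  suc (tri (suc a + b) + b)  ≡⟨ cong suc eq ⟩
  suc n                      ∎
  where open ≡-Reasoning

-- Opaque, so that unification may invert pair.
opaque
  pair : ℕ → ℕ → ℕ
  pair a b = tri (a + b) + b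

  pairR : Rec₂ pair
  pairR = mk₂ (+R $₂ (triR $₁ (+R $₂ v₀ , v₁)) , v₁) λ _ _ → refl

  unpair-pair : ∀ a b → unpair (pair a b) ≡ (a , b)
  unpair-pair a b with unpair-surjective a b
  ... | s , eq = subst (λ t → unpair t ≡ (a , b)) code eq
    where
    code : s ≡ pair a b
    code = trans (sym (unpair-tri s)) (cong (λ p → tri (proj₁ p + proj₂ p) + proj₂ p) eq)

  pair-unpair : ∀ n → pair (π₀ n) (π₁ n) ≡ n
  pair-unpair = unpair-tri

π₀-pair : ∀ a b → π₀ (pair a b) ≡ a
π₀-pair a b = cong proj₁ (unpair-pair a b)

π₁-pair : ∀ a b → π₁ (pair a b) ≡ b
π₁-pair a b = cong proj₂ (unpair-pair a b)

n≤tri : ∀ n → n ℕ.≤ tri n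
n≤tri zero    = ℕ.z≤n
n≤tri (suc n) = ℕₚ.m≤n+m (suc n) (tri n)

diag≤ : ∀ n → diag n ℕ.≤ n
diag≤ n = ℕₚ.≤-trans (n≤tri (diag n))
  (ℕₚ.≤-trans (ℕₚ.m≤m+n _ (π₁ n)) (ℕₚ.≤-reflexive (unpair-tri n)))

π₀≤ : ∀ n → π₀ n ℕ.≤ n
π₀≤ n = ℕₚ.≤-trans (ℕₚ.m≤m+n _ _) (diag≤ n)

π₁≤ : ∀ n → π₁ n ℕ.≤ n
π₁≤ n = ℕₚ.≤-trans (ℕₚ.m≤n+m _ (π₀ n)) (diag≤ n)

-- The walk can be followed with one number as its state: `n ∸ tri (diag n)` recovers `π₁ n`, and a
-- new diagonal begins exactly when this has reached `diag n`. So `diag`, and with it both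
-- projections, are recursive.
diag-suc : ∀ n → diag (suc n) ≡ choose (diag n ∸ (n ∸ tri (diag n))) (suc (diag n)) (diag n)
diag-suc n = trans (by-cases n) (cong (λ d → choose (diag n ∸ d) (suc (diag n)) (diag n)) (sym offset))
  where
  offset : n ∸ tri (diag n) ≡ π₁ n
  offset = trans (cong (_∸ tri (diag n)) (sym (unpair-tri n))) (ℕₚ.m+n∸m≡n (tri (diag n)) (π₁ n))
  by-cases : ∀ n → diag (suc n) ≡ choose (diag n ∸ π₁ n) (suc (diag n)) (diag n)
  by-cases n with unpair n
  ... | zero  , b = trans (+-identityʳ (suc b))
                          (cong (λ c → choose c (suc b) b) (sym (ℕₚ.n∸n≡0 b)))
  ... | suc a , b = trans (+-suc a b)
                          (cong (λ c → choose c (suc (suc a + b)) (suc a + b))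
                                (sym (ℕₚ.m+n∸n≡m (suc a) b)))

diagR : Rec₁ diag
diagR = mk₁ (natrecR (constR 0)
               (chooseR (∸R $₂ v₁ , (∸R $₂ v₀ , (triR $₁ v₁))) (sucR $₁ v₁) v₁) v₀) eq
  where
  eq : ∀ a → natrec 0 (λ k y → choose (y ∸ (k ∸ tri y)) (suc y) y) a ≡ diag a
  eq zero    = refl
  eq (suc a) rewrite eq a = sym (diag-suc a)

π₁R : Rec₁ π₁
π₁R = mk₁ (∸R $₂ v₀ , (triR $₁ (diagR $₁ v₀)))
  λ n → trans (cong (_∸ tri (diag n)) (sym (unpair-tri n))) (ℕₚ.m+n∸m≡n (tri (diag n)) (π₁ n))

π₀R : Rec₁ π₀
π₀R = mk₁ (∸R $₂ (diagR $₁ v₀) , (π₁R $₁ v₀)) λ n → ℕₚ.m+n∸n≡m (π₀ n) (π₁ n)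

seqR : Rec₂ seq
seqR = mk₂ (π₀R $₁ natrecR v₀ (π₁R $₁ v₁) v₁) eq
  where
  tails : ℕ → ℕ → ℕ
  tails s = natrec s (λ _ y → π₁ y)
  tails-suc : ∀ s n → tails (π₁ s) n ≡ π₁ (tails s n)
  tails-suc s zero    = refl
  tails-suc s (suc n) = cong π₁ (tails-suc s n)
  eq : ∀ s n → π₀ (tails s n) ≡ seq s n
  eq s zero    = refl
  eq s (suc n) = trans (cong π₀ (sym (tails-suc s n))) (eq (π₁ s) n)

seq≤ : ∀ s n → seq s n ℕ.≤ s
seq≤ s zero    = π₀≤ s
seq≤ s (suc n) = ℕₚ.≤-trans (seq≤ (π₁ s) n) (π₁≤ s)

seq-dense : ∀ (x : ℕ → ℕ) m → ∃[ i ] (∀ n → n ℕ.≤ m → seq i n ≡ x n)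
seq-dense x zero = pair (x 0) 0 , λ { zero _ → π₀-pair (x 0) 0 }
seq-dense x (suc m) with seq-dense (x ∘ suc) m
... | i , h = pair (x 0) i , λ
  { zero    _           → π₀-pair (x 0) i
  ; (suc n) (ℕ.s≤s n≤m) → trans (cong (λ j → seq j n) (π₁-pair (x 0) i)) (h n n≤m) }

-- Decidable tests for basic neighbourhoods

dist : ℕ → ℕ → ℕ
dist a b = (a ∸ b) + (b ∸ a)

distR : Rec₂ dist
distR = mk₂ (+R $₂ (∸R $₂ v₀ , v₁) , (∸R $₂ v₁ , v₀)) λ _ _ → refl

dist-≡ : ∀ a b → dist a b ≡ 0 ⇔ a ≡ b
dist-≡ a b = mk⇔
  (λ e → ℕₚ.≤-antisym (ℕₚ.m∸n≡0⇒m≤n (ℕₚ.m+n≡0⇒m≡0 (a ∸ b) e))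
                      (ℕₚ.m∸n≡0⇒m≤n (ℕₚ.m+n≡0⇒n≡0 (a ∸ b) e)))
  (λ { refl → cong₂ _+_ (ℕₚ.n∸n≡0 a) (ℕₚ.n∸n≡0 a) })

sgn : ℕ → ℕ
sgn n = choose n 0 1

sgnR : Rec₁ sgn
sgnR = mk₁ (chooseR v₀ (constR 0) (constR 1)) λ _ → refl

sgn-bit : ∀ a b → sgn a ≡ sgn b ⇔ bit a ≡ bit b
sgn-bit zero    zero    = mk⇔ (λ _ → refl) (λ _ → refl)
sgn-bit zero    (suc b) = mk⇔ (λ ()) (λ ())
sgn-bit (suc a) zero    = mk⇔ (λ ()) (λ ())
sgn-bit (suc a) (suc b) = mk⇔ (λ _ → refl) (λ _ → refl)

sumTo : (ℕ → ℕ) → ℕ → ℕ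
sumTo F = natrec (F 0) (λ k y → y + F (suc k))

sumTo≡0 : ∀ F q → sumTo F q ≡ 0 ⇔ (∀ n → n ℕ.≤ q → F n ≡ 0)
sumTo≡0 F q = mk⇔ (to q) (from q)
  where
  to : ∀ q → sumTo F q ≡ 0 → ∀ n → n ℕ.≤ q → F n ≡ 0
  to zero    e zero ℕ.z≤n = e
  to (suc q) e n n≤q with ℕₚ.m≤n⇒m<n∨m≡n n≤q
  ... | Sum.inj₁ (ℕ.s≤s n≤q′) = to q (ℕₚ.m+n≡0⇒m≡0 _ e) n n≤q′
  ... | Sum.inj₂ refl         = ℕₚ.m+n≡0⇒n≡0 (sumTo F q) e
  from : ∀ q → (∀ n → n ℕ.≤ q → F n ≡ 0) → sumTo F q ≡ 0
  from zero    h = h 0 ℕ.z≤n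
  from (suc q) h = cong₂ _+_ (from q (λ n l → h n (ℕₚ.m≤n⇒m≤1+n l))) (h (suc q) ℕₚ.≤-refl)

-- The value 0 means success. For p ≥ 1 the condition p(n+1) ≤ q+1 forces n ≤ q, so a sum up to q
-- sees all the places that matter; for p = 0 the ball is empty.
ballTest : ℕ → ℕ → (ℕ → ℕ) → (ℕ → ℕ) → ℕ
ballTest p q r x =
  choose p 1 (sumTo (λ n → choose (p * suc n ∸ suc q) (dist (x n) (r n)) 0) q)

ballTest-Ball : ∀ p q r x → ballTest p q r x ≡ 0 ⇔ x ∈ Ball p q r
ballTest-Ball zero    q r x = mk⇔ (λ ()) (λ ())
ballTest-Ball (suc p) q r x = mk⇔ to from
  where
  F : ℕ → ℕ
  F n = choose (suc p * suc n ∸ suc q) (dist (x n) (r n)) 0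
  to : sumTo F q ≡ 0 → x ∈ Ball (suc p) q r
  to e = ℕ.s≤s ℕ.z≤n , λ n l → Equivalence.to (dist-≡ (x n) (r n))
    (subst (λ t → choose t (dist (x n) (r n)) 0 ≡ 0) (ℕₚ.m≤n⇒m∸n≡0 l)
      (Equivalence.to (sumTo≡0 F q) e n
        (ℕ.s≤s⁻¹ (ℕₚ.≤-trans (ℕₚ.m≤n*m (suc n) (suc p)) l))))
  from : x ∈ Ball (suc p) q r → sumTo F q ≡ 0
  from (_ , h) = Equivalence.from (sumTo≡0 F q) λ n _ → term n
    where
    term : ∀ n → F n ≡ 0
    term n with suc p * suc n ∸ suc q in eq
    ... | zero  = Equivalence.from (dist-≡ (x n) (r n)) (h n (ℕₚ.m∸n≡0⇒m≤n eq))
    ... | suc _ = refl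

ballTestR : ∀ {r x} → Rec₂ r → Rec₂ x →
            Rec₂ (λ i k → ballTest (π₀ (π₁ k)) (π₁ (π₁ k)) (r k) (x i))
ballTestR {r} {x} rR xR = mk₂
  (chooseR (p v₁) (constR 1) (natrecR (term (constR 0) v₀ v₁) (+R $₂ v₁ , term (sucR $₁ v₀) v₂ v₃) (q v₁)))
  λ _ _ → refl
  where
  p : ∀ {n} {f : Vec ℕ n → ℕ} → Rec f → Rec (λ xs → π₀ (π₁ (f xs)))
  p k = π₀R $₁ (π₁R $₁ k)
  q : ∀ {n} {f : Vec ℕ n → ℕ} → Rec f → Rec (λ xs → π₁ (π₁ (f xs)))
  q k = π₁R $₁ (π₁R $₁ k)
  term : ∀ {m} {n i k : Vec ℕ m → ℕ} → Rec n → Rec i → Rec k → Rec (λ xs →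
    choose (π₀ (π₁ (k xs)) * suc (n xs) ∸ suc (π₁ (π₁ (k xs)))) (dist (x (i xs) (n xs)) (r (k xs) (n xs))) 0)
  term n i k = chooseR (∸R $₂ (*R $₂ p k , (sucR $₁ n)) , (sucR $₁ q k))
                    (distR $₂ (xR $₂ i , n) , (rR $₂ k , n)) (constR 0)

-- Codes the points that agree with the i-th dense point at all places up to q.
ct : Space → ℕ → ℕ → ℕ
ct ω       q i = pair i (pair 1 0)
ct ωω      q i = pair i (pair 1 q)
ct 2ω      q i = pair i (pair 1 q)
ct (X ⊗ Y) q i = pair (ct X q (π₀ i)) (ct Y q (π₁ i))

ctR : ∀ X → Rec₂ (ct X)
ctR ω       = mk₂ (pairR $₂ v₁ , constR _) λ _ _ → refl
ctR ωω      = mk₂ (pairR $₂ v₁ , (pairR $₂ constR 1 , v₀)) λ _ _ → refl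
ctR 2ω      = mk₂ (pairR $₂ v₁ , (pairR $₂ constR 1 , v₀)) λ _ _ → refl
ctR (X ⊗ Y) = mk₂ (pairR $₂ (ctR X $₂ v₀ , (π₀R $₁ v₁)) , (ctR Y $₂ v₀ , (π₁R $₁ v₁))) λ _ _ → refl

-- mem X i k vanishes iff the i-th dense point of X lies in N X k.
mem : Space → ℕ → ℕ → ℕ
mem ω       i k = ballTest (π₀ (π₁ k)) (π₁ (π₁ k)) (λ _ → π₀ k) (λ _ → i)
mem ωω      i k = ballTest (π₀ (π₁ k)) (π₁ (π₁ k)) (seq (π₀ k)) (seq i)
mem 2ω      i k = ballTest (π₀ (π₁ k)) (π₁ (π₁ k)) (sgn ∘ seq (π₀ k)) (sgn ∘ seq i)
mem (X ⊗ Y) i k = mem X (π₀ i) (π₀ k) + mem Y (π₁ i) (π₁ k)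

memR : ∀ X → Rec₂ (mem X)
memR ω       = ballTestR (mk₂ (π₀R $₁ v₀) λ _ _ → refl) (mk₂ v₀ λ _ _ → refl)
memR ωω      = ballTestR (mk₂ (seqR $₂ (π₀R $₁ v₀) , v₁) λ _ _ → refl) seqR
memR 2ω      = ballTestR (mk₂ (sgnR $₁ (seqR $₂ (π₀R $₁ v₀) , v₁)) λ _ _ → refl)
                         (mk₂ (sgnR $₁ (seqR $₂ v₀ , v₁)) λ _ _ → refl)
memR (X ⊗ Y) = mk₂ (+R $₂ (memR X $₂ (π₀R $₁ v₀) , (π₀R $₁ v₁)) , (memR Y $₂ (π₁R $₁ v₀) , (π₁R $₁ v₁)))
                   λ _ _ → refl

-- The radius 2/1 exceeds all distances in ω, while the radius 1/1 of `sing` leaves only the centre.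
whole : ℕ
whole = pair 0 (pair 2 0)

whole-all : ∀ x → x ∈ N ω whole
whole-all x rewrite unpair-pair 0 (pair 2 0) | unpair-pair 2 0 = ℕ.s≤s ℕ.z≤n , λ { (ℕ.s≤s ()) }

sing : ℕ → ℕ
sing i = pair i (pair 1 0)

sing-intro : ∀ i → i ∈ N ω (sing i)
sing-intro i rewrite unpair-pair i (pair 1 0) | unpair-pair 1 0 = ℕ.s≤s ℕ.z≤n , λ _ → refl

sing-elim : ∀ {i x} → x ∈ N ω (sing i) → x ≡ i
sing-elim {i} p rewrite unpair-pair i (pair 1 0) | unpair-pair 1 0 = proj₂ p (ℕ.s≤s ℕ.z≤n)

singR : Rec₁ sing
singR = mk₁ (pairR $₂ v₀ , constR _) λ _ → refl

module _ {A : Set} (r : ℕ → ℕ → A) (q i : ℕ) where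

  private
    Centred : (ℕ → A) → ℕ → Set
    Centred x k = x ∈ Ball (π₀ (π₁ k)) (π₁ (π₁ k)) (r (π₀ k))

  ball-intro : ∀ {x} → (∀ n → n ℕ.≤ q → x n ≡ r i n) → Centred x (pair i (pair 1 q))
  ball-intro h rewrite unpair-pair i (pair 1 q) | unpair-pair 1 q =
    ℕ.s≤s ℕ.z≤n , λ n l → h n (ℕ.s≤s⁻¹ (subst (ℕ._≤ suc q) (+-identityʳ (suc n)) l))

  ball-elim : ∀ {x} → Centred x (pair i (pair 1 q)) → ∀ n → n ℕ.≤ q → x n ≡ r i n
  ball-elim p n l rewrite unpair-pair i (pair 1 q) | unpair-pair 1 q =
    proj₂ p n (subst (ℕ._≤ suc q) (sym (+-identityʳ (suc n))) (ℕ.s≤s l))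

Ball-resp : ∀ {A : Set} p q {r x y : ℕ → A} → (∀ n → n ℕ.≤ q → x n ≡ y n) → x ∈ Ball p q r → y ∈ Ball p q r
Ball-resp p q {r} {x} {y} e (0<p , h) = 0<p , λ n l → trans (sym (e n (small 0<p n l))) (h n l)
  where
  small : ∀ {p} → 0 ℕ.< p → ∀ n → p * suc n ℕ.≤ suc q → n ℕ.≤ q
  small {suc p} _ n l = ℕ.s≤s⁻¹ (ℕₚ.≤-trans (ℕₚ.m≤n*m (suc n) (suc p)) l)

open Equivalence using (to; from)

_⟫_ : ∀ {A B C : Set} → A ⇔ B → B ⇔ C → A ⇔ C
p ⟫ q = mk⇔ (to q ∘ to p) (from p ∘ from q)

⇔-sym : ∀ {A B : Set} → A ⇔ B → B ⇔ A
⇔-sym p = mk⇔ (from p) (to p)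

mem-ωω : ∀ i k → mem ωω i k ≡ 0 ⇔ seq i ∈ N ωω k
mem-ωω i k = ballTest-Ball _ _ _ _

-- Membership in `N X k` looks only at places up to `π₁ (π₁ k)`, which is at most k. A point that
-- agrees with the i-th dense point up to q ≥ k therefore gets the same answer. Thus small boxes
-- decide membership in all sets of smaller index, which is the source of intersections and
-- complements below.
mem-correct : ∀ X q i k {x} → x ∈ N X (ct X q i) → k ℕ.≤ q → x ∈ N X k ⇔ mem X i k ≡ 0
mem-correct ω q i k p k≤q with sing-elim {i} p
... | refl = ω-case ⟫ ⇔-sym (ballTest-Ball (π₀ (π₁ k)) (π₁ (π₁ k)) (λ _ → π₀ k) (λ _ → i))
  where
  ω-case : i ∈ N ω k ⇔ ((λ _ → i) ∈ Ball (π₀ (π₁ k)) (π₁ (π₁ k)) (λ _ → π₀ k))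
  ω-case = mk⇔
    (λ (a , h) → a , λ n l → h (ℕₚ.≤-trans (ℕₚ.m≤m*n (π₀ (π₁ k)) (suc n)) l))
    (λ (a , h) → a , λ l → h 0 (subst (ℕ._≤ suc (π₁ (π₁ k))) (sym (ℕₚ.*-identityʳ (π₀ (π₁ k)))) l))
mem-correct ωω q i k {x} p k≤q = mk⇔ (Ball-resp _ _ agree) (Ball-resp _ _ (λ n l → sym (agree n l)))
                                 ⟫ ⇔-sym (mem-ωω i k)
  where
  agree : ∀ n → n ℕ.≤ π₁ (π₁ k) → x n ≡ seq i n
  agree n l = ball-elim seq q i p n
    (ℕₚ.≤-trans l (ℕₚ.≤-trans (π₁≤ (π₁ k)) (ℕₚ.≤-trans (π₁≤ k) k≤q)))
mem-correct 2ω q i k {x} p k≤q =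
  mk⇔ (Ball-resp _ _ agree) (Ball-resp _ _ (λ n l → sym (agree n l)))
  ⟫ (mk⇔ (λ (a , h) → a , λ n l → from (sgn-bit _ _) (h n l))
         (λ (a , h) → a , λ n l → to (sgn-bit _ _) (h n l))
  ⟫ ⇔-sym (ballTest-Ball _ _ _ _))
  where
  agree : ∀ n → n ℕ.≤ π₁ (π₁ k) → x n ≡ bit (seq i n)
  agree n l = ball-elim (λ j → bit ∘ seq j) q i p n
    (ℕₚ.≤-trans l (ℕₚ.≤-trans (π₁≤ (π₁ k)) (ℕₚ.≤-trans (π₁≤ k) k≤q)))
mem-correct (X ⊗ Y) q i k p k≤q
  rewrite unpair-pair (ct X q (π₀ i)) (ct Y q (π₁ i)) = mk⇔
    (λ (a , b) → cong₂ _+_ (to l a) (to r b))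
    (λ e → from l (ℕₚ.m+n≡0⇒m≡0 _ e) , from r (ℕₚ.m+n≡0⇒n≡0 (mem X (π₀ i) (π₀ k)) e))
  where
  l = mem-correct X q (π₀ i) (π₀ k) (proj₁ p) (ℕₚ.≤-trans (π₀≤ k) k≤q)
  r = mem-correct Y q (π₁ i) (π₁ k) (proj₂ p) (ℕₚ.≤-trans (π₁≤ k) k≤q)

unbit : Bool → ℕ
unbit false = 0
unbit true  = 1

bit-unbit : ∀ b → bit (unbit b) ≡ b
bit-unbit false = refl
bit-unbit true  = refl

ct-covers : ∀ X q x → ∃[ i ] x ∈ N X (ct X q i)
ct-covers ω q x = x , sing-intro x
ct-covers ωω q x =
  let i , h = seq-dense x q in i , ball-intro seq q i (λ n l → sym (h n l))
ct-covers 2ω q x =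
  let i , h = seq-dense (unbit ∘ x) q in
  i , ball-intro (λ j → bit ∘ seq j) q i (λ n l → trans (sym (bit-unbit (x n))) (cong bit (sym (h n l))))
ct-covers (X ⊗ Y) q (x , y) with ct-covers X q x | ct-covers Y q y
... | i , p | j , p′ = pair i j , inProduct
  where
  inProduct : (x , y) ∈ N (X ⊗ Y) (ct (X ⊗ Y) q (pair i j))
  inProduct rewrite unpair-pair i j | unpair-pair (ct X q i) (ct Y q j) = p , p′

-- Basic sets are decidable without excluded middle, which lets `enumerate` branch on membership by
-- a recursive function.
N? : ∀ X k x → Dec (x ∈ N X k)
N? X k x with ct-covers X k x
... | i , p with mem X i k in eq
... | zero  = yes (from (mem-correct X k i k p ℕₚ.≤-refl) eq)
... | suc _ = no λ m → case trans (sym eq) (to (mem-correct X k i k p ℕₚ.≤-refl) m) of λ ()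

-- Semirecursive sets and recursive functions

private variable
  X Y Z : Space

-- A record around `Σ⁰₁`, so that unification can read `P` off the type when sets are built by
-- combinators.
record SR (X : Space) (P : Subset X) : Set where
  no-eta-equality
  pattern
  constructor sr
  field semirecursive : Σ⁰₁ X P
open SR

record RF (X Y : Space) (f : Pt X → Pt Y) : Set where
  no-eta-equality
  pattern
  constructor rf
  field nbhds : SR (X ⊗ ω) (λ (x , k) → f x ∈ N Y k)
open RF

SR-⇔ : {P Q : Subset X} → (∀ x → P x ⇔ Q x) → SR X P → SR X Q
SR-⇔ e (sr (ε , r , ⊆ , ⊇)) = sr (ε , r , (λ {x} q → ⊆ (from (e x) q)) , λ {x} u → to (e x) (⊇ u))

decode : ℕ → Vec ℕ 3
decode n = π₀ n ∷ π₀ (π₁ n) ∷ π₁ (π₁ n) ∷ []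

encode : ∀ a b c → decode (pair a (pair b c)) ≡ a ∷ b ∷ c ∷ []
encode a b c rewrite unpair-pair a (pair b c) | unpair-pair b c = refl

-- A copy of N that does not unfold, so that unification may invert it.
record In (X : Space) (k : ℕ) (x : Pt X) : Set where
  constructor inn
  field out : x ∈ N X k
open In

opaque
  -- The empty neighbourhood N X 0 fills the places that fail the test.
  SR-enum : {P : Subset X} {test nbhd : Vec ℕ 3 → ℕ} → Rec test → Rec nbhd →
            (∀ x → P x ⇔ (∃[ a ] ∃[ b ] ∃[ c ]
               test (a ∷ b ∷ c ∷ []) ≡ 0 × In X (nbhd (a ∷ b ∷ c ∷ [])) x)) → SR X P
  SR-enum {X = X} {P = P} {test} {nbhd} t ν e = sr (ε , Rec₁.unary εR , ⊆ , ⊇)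
    where
    ε : ℕ → ℕ
    ε n = choose (test (decode n)) (nbhd (decode n)) 0
    compose : {f : Vec ℕ 3 → ℕ} → Rec f → Rec {1} (λ xs → f (decode (lookup xs zero)))
    compose (rec s c) = rec (Scheme.comp s (Rec.scheme (π₀R $₁ v₀) ∷ Rec.scheme (π₀R $₁ (π₁R $₁ v₀))
                                         ∷ Rec.scheme (π₁R $₁ (π₁R $₁ v₀)) ∷ [])) λ xs →
      comp⇓ (Rec.computes (π₀R $₁ v₀) xs ∷ Rec.computes (π₀R $₁ (π₁R $₁ v₀)) xs
           ∷ Rec.computes (π₁R $₁ (π₁R $₁ v₀)) xs ∷ []) (c _)
    εR : Rec₁ ε
    εR = mk₁ (chooseR (compose t) (compose ν) (constR 0)) λ _ → refl
    ⊆ : ∀ {x} → P x → ∃[ n ] x ∈ N X (ε n)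
    ⊆ {x} p with to (e x) p
    ... | a , b , c , eq , inn m = pair a (pair b c) , inside
      where
      inside : x ∈ N X (ε (pair a (pair b c)))
      inside rewrite encode a b c | eq = m
    ⊇ : ∀ {x} → (∃[ n ] x ∈ N X (ε n)) → P x
    ⊇ {x} (n , m) with test (decode n) in eq
    ... | zero  = from (e x) (_ , _ , _ , eq , inn m)
    ... | suc _ = contradiction m (N-zero X)

  infixr 6 _∧_
  infixr 5 _∨_

  -- An intersection of two basic sets is covered by boxes `ct X q i` whose q bounds both indices;
  -- by `mem-correct` each such box lies inside or outside either set, according to its dense point.
  _∧_ : {P Q : Subset X} → SR X P → SR X Q → SR X (λ x → P x × Q x)
  _∧_ {X = X} {P = P} {Q = Q} (sr (ε , εR , ⊆₁ , ⊇₁)) (sr (δ , δR , ⊆₂ , ⊇₂)) =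
    SR-enum
      (+R $₂ (+R $₂ (∸R $₂ (a $₁ v₀) , q) , (memR X $₂ i , (a $₁ v₀)))
           , (+R $₂ (∸R $₂ (b $₁ v₁) , q) , (memR X $₂ i , (b $₁ v₁))))
      (ctR X $₂ q , i)
      λ x → mk⇔ ⊆ ⊇
    where
    a : Rec₁ ε
    a = rec₁ εR
    b : Rec₁ δ
    b = rec₁ δR
    q : Rec {3} (λ xs → π₀ (lookup xs (suc (suc zero))))
    q = π₀R $₁ v₂
    i : Rec {3} (λ xs → π₁ (lookup xs (suc (suc zero))))
    i = π₁R $₁ v₂
    Parts : Pt X → Set
    Parts x = ∃[ a ] ∃[ b ] ∃[ c ]
      ((ε a ∸ π₀ c) + mem X (π₁ c) (ε a)) + ((δ b ∸ π₀ c) + mem X (π₁ c) (δ b)) ≡ 0 × In X (ct X (π₀ c) (π₁ c)) x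
    ⊆ : ∀ {x} → P x × Q x → Parts x
    ⊆ {x} (p , p′) with ⊆₁ p | ⊆₂ p′
    ... | j , m | k , m′ = j , k , c , test , inn near
      where
      q′ : ℕ
      q′ = ε j + δ k
      c : ℕ
      c = pair q′ (proj₁ (ct-covers X q′ x))
      qc : π₀ c ≡ q′
      qc = π₀-pair _ _
      near : x ∈ N X (ct X (π₀ c) (π₁ c))
      near rewrite unpair-pair q′ (proj₁ (ct-covers X q′ x)) = proj₂ (ct-covers X q′ x)
      l₁ : ε j ℕ.≤ π₀ c
      l₁ = subst (ε j ℕ.≤_) (sym qc) (ℕₚ.m≤m+n _ _)
      l₂ : δ k ℕ.≤ π₀ c
      l₂ = subst (δ k ℕ.≤_) (sym qc) (ℕₚ.m≤n+m _ (ε j))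
      test : ((ε j ∸ π₀ c) + mem X (π₁ c) (ε j)) + ((δ k ∸ π₀ c) + mem X (π₁ c) (δ k)) ≡ 0
      test = cong₂ _+_
        (cong₂ _+_ (ℕₚ.m≤n⇒m∸n≡0 l₁) (to (mem-correct X _ (π₁ c) (ε j) near l₁) m))
        (cong₂ _+_ (ℕₚ.m≤n⇒m∸n≡0 l₂) (to (mem-correct X _ (π₁ c) (δ k) near l₂) m′))
    ⊇ : ∀ {x} → Parts x → P x × Q x
    ⊇ {x} (j , k , c , test , inn near) = ⊇₁ (j , use (ε j) (ℕₚ.m+n≡0⇒m≡0 _ test))
                                   , ⊇₂ (k , use (δ k) (ℕₚ.m+n≡0⇒n≡0 ((ε j ∸ π₀ c) + mem X (π₁ c) (ε j)) test))
      where
      use : ∀ k → (k ∸ π₀ c) + mem X (π₁ c) k ≡ 0 → x ∈ N X k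
      use k e = from (mem-correct X _ (π₁ c) k near (ℕₚ.m∸n≡0⇒m≤n (ℕₚ.m+n≡0⇒m≡0 _ e)))
                     (ℕₚ.m+n≡0⇒n≡0 (k ∸ π₀ c) e)

  _∨_ : {P Q : Subset X} → SR X P → SR X Q → SR X (λ x → P x ⊎ Q x)
  _∨_ {X = X} {P = P} {Q = Q} (sr (ε , εR , ⊆₁ , ⊇₁)) (sr (δ , δR , ⊆₂ , ⊇₂)) =
    SR-enum (constR 0) (chooseR v₀ (rec₁ εR $₁ v₁) (rec₁ δR $₁ v₁)) λ x → mk⇔
      Sum.[ (λ p → let n , m = ⊆₁ p in 0 , n , 0 , refl , inn m)
          , (λ p → let n , m = ⊆₂ p in 1 , n , 0 , refl , inn m) ]
      λ { (zero , n , _ , _ , inn m) → inj₁ (⊇₁ (n , m)) ; (suc _ , n , _ , _ , inn m) → inj₂ (⊇₂ (n , m)) }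

  ∃ω : {P : Subset (X ⊗ ω)} → SR (X ⊗ ω) P → SR X (λ x → ∃[ n ] P (x , n))
  ∃ω {X = X} {P} (sr (ε , εR , ⊆₁ , ⊇₁)) =
    -- The test 1 ∸ p vanishes iff the ball of ω in the second factor has positive radius; its
    -- centre is then the witness n.
    SR-enum (∸R $₂ constR 1 , (π₀R $₁ (π₁R $₁ (π₁R $₁ (rec₁ εR $₁ v₀))))) (π₀R $₁ (rec₁ εR $₁ v₀))
      λ x → mk⇔
        (λ (n , p) → let j , m , m′ = ⊆₁ p in j , 0 , 0 , ℕₚ.m≤n⇒m∸n≡0 (proj₁ m′) , inn m)
        (λ (j , _ , _ , e , inn m) → π₀ (π₁ (ε j)) , ⊇₁ (j , m , ℕₚ.m∸n≡0⇒m≤n e , λ _ → refl))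

  box : ∀ {a b x y} → In X a x → In Y b y → In (X ⊗ Y) (pair a b) (x , y)
  box {X} {Y} {a} {b} {x} {y} (inn p) (inn q) = inn both
    where
    both : (x , y) ∈ N (X ⊗ Y) (pair a b)
    both rewrite unpair-pair a b = p , q

  unbox : ∀ {a b x y} → In (X ⊗ Y) (pair a b) (x , y) → In X a x × In Y b y
  unbox {X} {Y} {a} {b} {x} {y} (inn m) = split m
    where
    split : (x , y) ∈ N (X ⊗ Y) (pair a b) → In X a x × In Y b y
    split m rewrite unpair-pair a b = inn (proj₁ m) , inn (proj₂ m)

  In-sing : ∀ n → In ω (sing n) n
  In-sing n = inn (sing-intro n)

  from-sing : ∀ {n k} → In ω (sing n) k → k ≡ n
  from-sing {n} (inn m) = sing-elim {n} m

  In-covers : ∀ X x → ∃[ s ] In X s x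
  In-covers X x = let i , p = ct-covers X 0 x in ct X 0 i , inn p

  idRF : RF X X (λ x → x)
  idRF {X} = rf (SR-enum (constR 0) (pairR $₂ v₀ , (singR $₁ v₀)) λ (x , k) → mk⇔
    (λ m → k , 0 , 0 , refl , box (inn m) (In-sing k))
    (λ (a , _ , _ , _ , m) → let m₁ , m₂ = unbox m in subst (λ j → x ∈ N X j) (sym (from-sing m₂)) (out m₁)))

  fstRF : RF (X ⊗ Y) X proj₁
  fstRF {X} {Y} = rf (SR-enum (constR 0) (pairR $₂ (pairR $₂ v₀ , v₁) , (singR $₁ v₀)) λ ((x , y) , k) → mk⇔
    (λ m → let j , m′ = In-covers Y y in k , j , 0 , refl , box (box (inn m) m′) (In-sing k))
    (λ (a , _ , _ , _ , m) → let m₁ , m₂ = unbox m in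
       subst (λ j → x ∈ N X j) (sym (from-sing m₂)) (out (proj₁ (unbox m₁)))))

  sndRF : RF (X ⊗ Y) Y proj₂
  sndRF {X} {Y} = rf (SR-enum (constR 0) (pairR $₂ (pairR $₂ v₁ , v₀) , (singR $₁ v₀)) λ ((x , y) , k) → mk⇔
    (λ m → let j , m′ = In-covers X x in k , j , 0 , refl , box (box m′ (inn m)) (In-sing k))
    (λ (a , _ , _ , _ , m) → let m₁ , m₂ = unbox m in
       subst (λ j → y ∈ N Y j) (sym (from-sing m₂)) (out (proj₂ (unbox m₁)))))

  sub : ∀ {f} {P : Subset Y} → SR Y P → RF X Y f → SR X (λ x → P (f x))
  sub {Y} {X} {f} {P} (sr (ε , εR , ⊆ , ⊇)) F =
    SR-⇔ (λ x → mk⇔ (λ (k , (m , n , e)) → ⊇ (n , subst (λ j → f x ∈ N Y j) e m))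
                    (λ p → let n , m = ⊆ p in ε n , m , n , refl))
         (∃ω (nbhds F ∧ range))
    where
    range : SR (X ⊗ ω) (λ (x , k) → ∃[ n ] k ≡ ε n)
    range = SR-enum (constR 0) (pairR $₂ v₀ , (singR $₁ (rec₁ εR $₁ v₁))) λ (x , k) → mk⇔
      (λ { (n , refl) → let s , m = In-covers X x in s , n , 0 , refl , box m (In-sing k) })
      (λ (_ , n , _ , _ , m) → n , from-sing (proj₂ (unbox m)))

  infix 4 ⟨_,_⟩
  ⟨_,_⟩ : ∀ {f g} → RF X Y f → RF X Z g → RF X (Y ⊗ Z) (λ x → f x , g x)

  memω : ∀ i k → i ∈ N ω k ⇔ mem ω i k ≡ 0
  memω i k = mem-correct ω k i k (sing-intro i) ℕₚ.≤-refl

  private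
    reindex : ∀ {φ} {P : Subset (X ⊗ ω)} → Rec₁ φ → SR (X ⊗ ω) P → SR (X ⊗ ω) (λ (x , k) → P (x , φ k))
    reindex {X} {φ} {P} φR (sr (ε , εR , ⊆ , ⊇)) =
      SR-enum (memR ω $₂ (φR $₁ v₁) , (π₁R $₁ (rec₁ εR $₁ v₀)))
              (pairR $₂ (π₀R $₁ (rec₁ εR $₁ v₀)) , (singR $₁ v₁)) λ (x , k) → mk⇔
        (λ p → let j , m , m′ = ⊆ p in j , k , 0 , to (memω (φ k) (π₁ (ε j))) m′ , box (inn m) (In-sing k))
        λ (j , k′ , _ , e , m) → let m₁ , m₂ = unbox m in
          ⊇ (j , out m₁ , subst (λ i → φ i ∈ N ω (π₁ (ε j))) (sym (from-sing m₂))
                        (from (memω (φ k′) (π₁ (ε j))) e))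

  ⟨_,_⟩ F G = rf (reindex π₀R (nbhds F) ∧ reindex π₁R (nbhds G))

  private
    fst₂RF : RF ((X ⊗ Y) ⊗ Z) X (λ p → proj₁ (proj₁ p))
    fst₂RF {X} {Y} {Z} = rf (SR-enum (constR 0) (pairR $₂ (pairR $₂ (pairR $₂ v₀ , v₁) , v₂) , (singR $₁ v₀))
      λ (((x , y) , z) , k) → mk⇔
      (λ m → let j , m′ = In-covers Y y ; l , m″ = In-covers Z z in
         k , j , l , refl , box (box (box (inn m) m′) m″) (In-sing k))
      (λ (a , _ , _ , _ , m) → let m₁ , m₂ = unbox m in
         subst (λ j → x ∈ N X j) (sym (from-sing m₂)) (out (proj₁ (unbox (proj₁ (unbox m₁)))))))

  infixr 9 _∘RF_
  _∘RF_ : ∀ {f g} → RF Y Z g → RF X Y f → RF X Z (λ x → g (f x))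
  G ∘RF F = rf (sub (nbhds G) ⟨ rf (sub (nbhds F) ⟨ fst₂RF , sndRF ⟩) , sndRF ⟩)

  private
    fromRec₁ : ∀ {φ} → Rec₁ φ → RF ω ω φ
    fromRec₁ {φ} φR = rf (reindexed)
      where
      reindexed : SR (ω ⊗ ω) (λ (n , k) → φ n ∈ N ω k)
      reindexed = SR-enum (memR ω $₂ (φR $₁ v₀) , v₁) (pairR $₂ (singR $₁ v₀) , (singR $₁ v₁)) λ (n , k) → mk⇔
        (λ m → n , k , 0 , to (memω (φ n) k) m , box (In-sing n) (In-sing k))
        λ (n′ , k′ , _ , e , m) → let m₁ , m₂ = unbox m in
          subst (λ i → φ i ∈ N ω k) (sym (from-sing m₁))
            (subst (λ j → φ n′ ∈ N ω j) (sym (from-sing m₂)) (from (memω (φ n′) k′) e))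

    pairRF : RF (ω ⊗ ω) ω (λ (a , b) → pair a b)
    pairRF = rf (SR-enum (memR ω $₂ (pairR $₂ v₀ , v₁) , v₂)
                         (pairR $₂ (pairR $₂ (singR $₁ v₀) , (singR $₁ v₁)) , (singR $₁ v₂)) λ ((a , b) , k) → mk⇔
      (λ m → a , b , k , to (memω (pair a b) k) m , box (box (In-sing a) (In-sing b)) (In-sing k))
      λ (a′ , b′ , k′ , e , m) → let m₁ , m₂ = unbox m ; m₃ , m₄ = unbox m₁ in
        substs (from-sing m₃) (from-sing m₄) (from-sing m₂) (from (memω (pair a′ b′) k′) e))
      where
      substs : ∀ {a a′ b b′ k k′} → a ≡ a′ → b ≡ b′ → k ≡ k′ → pair a′ b′ ∈ N ω k′ → pair a b ∈ N ω k
      substs refl refl refl m = m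

  rf₁ : ∀ {φ f} → Rec₁ φ → RF X ω f → RF X ω (λ x → φ (f x))
  rf₁ φR F = fromRec₁ φR ∘RF F

  RF-≗ : ∀ {f g} → (∀ x → Eq Y (f x) (g x)) → RF X Y f → RF X Y g
  RF-≗ {Y} e F = rf (SR-⇔ (λ (x , k) → mk⇔ (N-resp Y k (e x)) (N-resp Y k (Eq-sym Y (e x)))) (nbhds F))

  rf₂ : ∀ {φ f g} → Rec₂ φ → RF X ω f → RF X ω g → RF X ω (λ x → φ (f x) (g x))
  rf₂ {φ = φ} {f} {g} φR F G =
    RF-≗ (λ x → cong₂ φ (π₀-pair (f x) (g x)) (π₁-pair (f x) (g x)))
         (fromRec₁ {λ n → φ (π₀ n) (π₁ n)} (mk₁ (φR $₂ (π₀R $₁ v₀) , (π₁R $₁ v₀)) λ _ → refl)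
           ∘RF pairRF ∘RF ⟨ F , G ⟩)

  constω : ∀ n → RF X ω (λ _ → n)
  constω {X} n = rf (SR-enum (memR ω $₂ constR n , v₁) (pairR $₂ v₀ , (singR $₁ v₁)) λ (x , k) → mk⇔
    (λ m → let j , m′ = In-covers X x in j , k , 0 , to (memω n k) m , box m′ (In-sing k))
    λ (_ , k′ , _ , e , m) →
      subst (λ j → n ∈ N ω j) (sym (from-sing (proj₂ (unbox m)))) (from (memω n k′) e))

  constωω : ∀ {a} → Recursive a → RF X ωω (λ _ → a)
  constωω {X} {a} aR = rf (SR-enum
    (ballTestR {λ k → seq (π₀ k)} {λ _ → a} (mk₂ (seqR $₂ (π₀R $₁ v₀) , v₁) λ _ _ → refl)
               (mk₂ (rec₁ aR $₁ v₁) λ _ _ → refl) $₂ constR 0 , v₁)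
    (pairR $₂ v₀ , (singR $₁ v₁)) λ (x , k) → mk⇔
    (λ m → let j , m′ = In-covers X x in j , k , 0 , from (ballTest-Ball _ _ _ _) m , box m′ (In-sing k))
    λ (_ , k′ , _ , e , m) →
      subst (λ j → a ∈ N ωω j) (sym (from-sing (proj₂ (unbox m)))) (to (ballTest-Ball _ _ _ _) e))

  zeroSR : ∀ {f} → RF X ω f → SR X (λ x → f x ≡ 0)
  zeroSR F = SR-⇔ (λ x → mk⇔ (sing-elim {0}) λ { e → subst (_∈ N ω (sing 0)) (sym e) (sing-intro 0) })
                  (sub (nbhds F) ⟨ idRF , constω (sing 0) ⟩)

  infix 7 _≐ω_ _≢ω_ _<ω_ _≤ω_

  _≐ω_ : ∀ {f g} → RF X ω f → RF X ω g → SR X (λ x → f x ≡ g x)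
  F ≐ω G = SR-⇔ (λ x → dist-≡ _ _) (zeroSR (rf₂ distR F G))

  _≤ω_ : ∀ {f g} → RF X ω f → RF X ω g → SR X (λ x → f x ℕ.≤ g x)
  F ≤ω G = SR-⇔ (λ x → mk⇔ ℕₚ.m∸n≡0⇒m≤n ℕₚ.m≤n⇒m∸n≡0) (zeroSR (rf₂ ∸R F G))

  _<ω_ : ∀ {f g} → RF X ω f → RF X ω g → SR X (λ x → f x ℕ.< g x)
  F <ω G = rf₁ sucR F ≤ω G

  ≢⇒<⊎> : ∀ m n → m ≢ n → m ℕ.< n ⊎ n ℕ.< m
  ≢⇒<⊎> m n ne with ℕₚ.<-cmp m n
  ... | tri< l _ _ = inj₁ l
  ... | tri≈ _ e _ = contradiction e ne
  ... | tri> _ _ l = inj₂ l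

  _≢ω_ : ∀ {f g} → RF X ω f → RF X ω g → SR X (λ x → f x ≢ g x)
  F ≢ω G = SR-⇔ (λ x → mk⇔ Sum.[ ℕₚ.<⇒≢ , (λ l e → ℕₚ.<⇒≢ l (sym e)) ] (≢⇒<⊎> _ _)) (F <ω G ∨ G <ω F)

  nbSR : ∀ {f g} → RF X Y f → RF X ω g → SR X (λ x → f x ∈ N Y (g x))
  nbSR {Y = Y} F G = sub (nbhds F) ⟨ idRF , G ⟩

  -- Basic sets are clopen, effectively: non-membership is seen in a box around `f x`, fine enough
  -- to decide the question, whose dense point fails the test.
  ¬nbSR : ∀ {f g} → RF X Y f → RF X ω g → SR X (λ x → ¬ f x ∈ N Y (g x))
  ¬nbSR {X} {Y} {f} {g} F G = SR-⇔ correct (∃ω (∃ω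
      (nbSR (F ∘RF fst₂RF) (rf₂ (ctR Y) (sndRF ∘RF fstRF) sndRF)
     ∧ G ∘RF fst₂RF ≤ω sndRF ∘RF fstRF
     ∧ rf₂ (memR Y) sndRF (G ∘RF fst₂RF) ≢ω constω 0)))
    where
    correct : ∀ x → (∃[ q ] ∃[ i ] f x ∈ N Y (ct Y q i) × g x ℕ.≤ q × mem Y i (g x) ≢ 0) ⇔ (¬ f x ∈ N Y (g x))
    correct x = mk⇔
      (λ (q , i , m , l , e) m′ → e (to (mem-correct Y q i (g x) m l) m′))
      λ m → let i , m′ = ct-covers Y (g x) (f x) in
        g x , i , m′ , ℕₚ.≤-refl , λ e → m (from (mem-correct Y _ i (g x) m′ ℕₚ.≤-refl) e)

  valSR : ∀ {f g h} → RF X ωω f → RF X ω g → RF X ω h → SR X (λ x → f x (g x) ≡ h x)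
  valSR {X} {f} {g} {h} F G H = SR-⇔ correct (∃ω
      (nbSR (F ∘RF fstRF) (rf₂ (ctR ωω) (G ∘RF fstRF) sndRF) ∧ rf₂ seqR sndRF (G ∘RF fstRF) ≐ω H ∘RF fstRF))
    where
    correct : ∀ x → (∃[ i ] f x ∈ N ωω (ct ωω (g x) i) × seq i (g x) ≡ h x) ⇔ f x (g x) ≡ h x
    correct x = mk⇔
      (λ (i , m , e) → trans (ball-elim seq (g x) i m (g x) ℕₚ.≤-refl) e)
      λ e → let i , s = seq-dense (f x) (g x) in
        i , ball-intro seq (g x) i (λ n l → sym (s n l)) , trans (s (g x) ℕₚ.≤-refl) e

  graphRF : ∀ {f} → SR (X ⊗ ω) (λ (x , n) → f x ≡ n) → RF X ω f
  graphRF {X} {f} g = rf (SR-⇔ (λ (x , k) → mk⇔ (λ { (_ , refl , m) → m }) (λ m → f x , refl , m))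
    (∃ω (sub g ⟨ fst₂RF , sndRF ⟩ ∧ nbSR sndRF (sndRF ∘RF fstRF))))

  appRF : ∀ {f g} → RF X ωω f → RF X ω g → RF X ω (λ x → f x (g x))
  appRF F G = graphRF (valSR (F ∘RF fstRF) (G ∘RF fstRF) sndRF)

  RF-resp : ∀ {f} → RF X Y f → ∀ {x x′} → Eq X x x′ → Eq Y (f x) (f x′)
  RF-resp {X} {Y} {f} F {x} {x′} e = N-separates Y (f x) (f x′) λ k →
    Σ⁰₁-resp (X ⊗ ω) _ (semirecursive (nbhds F)) (e , refl)

-- The recursion theorem and uniform enumerations

module Recursion (𝒢 : GoodParametrization) where
  open GoodParametrization 𝒢
  open Codes 𝒢

  infixr 5 _◂_
  _◂_ : ℕ → (ℕ → ℕ) → ℕ → ℕ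
  (a ◂ γ) zero    = a
  (a ◂ γ) (suc n) = γ n

  opaque
    infixl 10 ↑_
    ↑_ : ∀ {f} → RF X Z f → RF (X ⊗ Y) Z (λ x → f (proj₁ x))
    ↑ F = F ∘RF fstRF

    #0 : RF (X ⊗ Y) Y proj₂
    #0 = sndRF

    #1 : RF ((Z ⊗ X) ⊗ Y) X (λ x → proj₂ (proj₁ x))
    #1 = ↑ #0

    GSR : ∀ {f g} → RF X ωω f → RF X Y g → SR X (λ x → (f x , g x) ∈ G Y)
    GSR {Y = Y} F H = sub (sr (G-Σ⁰₁ Y)) ⟨ F , H ⟩

    SRF : ∀ Y Z {f g} → RF X ωω f → RF X Y g → RF X ωω (λ x → S Y Z (f x , g x))
    SRF Y Z F H = rf (sr (S-recursive Y Z)) ∘RF ⟨ F , H ⟩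

    indexOf : ∀ {P} → SR X P → ∃[ a ] Recursive a × (∀ x → P x ⇔ (a , x) ∈ G X)
    indexOf {X} {P} (sr s) =
      let a , aR , ⊆ , ⊇ = to (G-recursive X P) s in a , aR , λ x → mk⇔ (λ p → ⊆ p) (λ p → ⊇ p)

    -- Kleene's second recursion theorem.
    fixpoint : ∀ {Q} → SR (ωω ⊗ X) Q →
               ∃[ e ] (∀ {Y} → RF Y ωω (λ _ → e)) × (∀ x → (e , x) ∈ G X ⇔ Q (e , x))
    fixpoint {X} {Q} q = selfApply (indexOf (sub q ⟨ SRF ωω X fstRF fstRF , sndRF ⟩))
      where
      selfApply : (∃[ a ] Recursive a × (∀ p → Q (S ωω X (proj₁ p , proj₁ p) , proj₂ p) ⇔ (a , p) ∈ G (ωω ⊗ X))) →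
                  ∃[ e ] (∀ {Y} → RF Y ωω (λ _ → e)) × (∀ x → (e , x) ∈ G X ⇔ Q (e , x))
      selfApply (a , aR , e) = S ωω X (a , a) , SRF ωω X (constωω aR) (constωω aR) ,
        λ x → ⇔-sym (S-spec ωω X a a x) ⟫ ⇔-sym (e (a , x))

    -- The recursion theorem supplies an index of the set of all (x , n) such that P holds below n,
    -- defined by recursion on n; no finite sequences of witnesses have to be coded.
    all< : ∀ {P : Subset (X ⊗ ω)} {f} → SR (X ⊗ ω) P → RF X ω f → SR X (λ x → ∀ j → j ℕ.< f x → P (x , j))
    all< {X} {P} {f} p F = SR-⇔ (λ x → correct x (f x)) (GSR eR ⟨ idRF , F ⟩)
      where
      step : SR (ωω ⊗ (X ⊗ ω)) (λ (α , (x , n)) → n ≡ 0 ⊎ ∃[ m ] n ≡ suc m × (α , (x , m)) ∈ G (X ⊗ ω) × P (x , m))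
      step = n ≐ω constω 0 ∨ ∃ω (↑ n ≐ω rf₁ sucR #0 ∧ GSR (↑ fstRF) ⟨ ↑ x , #0 ⟩ ∧ sub p ⟨ ↑ x , #0 ⟩)
        where
        n : RF (ωω ⊗ (X ⊗ ω)) ω (λ (_ , (_ , n)) → n)
        n = sndRF ∘RF sndRF
        x : RF (ωω ⊗ (X ⊗ ω)) X (λ (_ , (x , _)) → x)
        x = fstRF ∘RF sndRF
      e : Pt ωω
      e = proj₁ (fixpoint step)
      eR : ∀ {Y} → RF Y ωω (λ _ → e)
      eR = proj₁ (proj₂ (fixpoint step))
      unfold : ∀ ((x , n) : Pt (X ⊗ ω)) → (e , (x , n)) ∈ G (X ⊗ ω) ⇔
               (n ≡ 0 ⊎ ∃[ m ] n ≡ suc m × (e , (x , m)) ∈ G (X ⊗ ω) × P (x , m))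
      unfold = proj₂ (proj₂ (fixpoint step))
      correct : ∀ x n → (e , (x , n)) ∈ G (X ⊗ ω) ⇔ (∀ j → j ℕ.< n → P (x , j))
      correct x n = mk⇔ (sound n) (complete n)
        where
        sound : ∀ n → (e , (x , n)) ∈ G (X ⊗ ω) → ∀ j → j ℕ.< n → P (x , j)
        sound (suc n) g j j<n with to (unfold (x , suc n)) g
        ... | inj₂ (_ , refl , g′ , p′) with ℕₚ.m≤n⇒m<n∨m≡n j<n
        ...   | inj₁ (ℕ.s≤s l) = sound n g′ j l
        ...   | inj₂ refl      = p′
        complete : ∀ n → (∀ j → j ℕ.< n → P (x , j)) → (e , (x , n)) ∈ G (X ⊗ ω)
        complete zero    h = from (unfold (x , 0)) (inj₁ refl)
        complete (suc n) h = from (unfold (x , suc n))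
          (inj₂ (n , refl , complete n (λ j l → h j (ℕₚ.m≤n⇒m≤1+n l)) , h n ℕₚ.≤-refl))

    -- Whether f(x , ·) lies in `N ωω k` depends only on its values up to k, so it suffices to guess
    -- a dense point u with these values and to test u.
    curryRF : ∀ {f} → RF (X ⊗ ω) ω f → RF X ωω (λ x n → f (x , n))
    curryRF {X} {f} F = rf (SR-⇔ correct (∃ω (zeroSR (rf₂ (memR ωω) #0 #1)
        ∧ all< (F ∘RF ⟨ ↑ ↑ fstRF , #0 ⟩ ≐ω rf₂ seqR #1 #0) (rf₁ sucR #1))))
      where
      correct : ∀ ((x , k) : Pt (X ⊗ ω)) →
        (∃[ u ] mem ωω u k ≡ 0 × (∀ n → n ℕ.< suc k → f (x , n) ≡ seq u n)) ⇔ ((λ n → f (x , n)) ∈ N ωω k)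
      correct (x , k) = mk⇔
        (λ (u , m , h) → from (mem-correct ωω k u k (ball-intro seq k u (λ n l → h n (ℕ.s≤s l))) ℕₚ.≤-refl) m)
        λ m → let u , h = seq-dense (λ n → f (x , n)) k in
          u , to (mem-correct ωω k u k (ball-intro seq k u (λ n l → sym (h n l))) ℕₚ.≤-refl) m
            , λ { n (ℕ.s≤s l) → sym (h n l) }

    curryRF₂ : ∀ {f} → RF (X ⊗ ω) ω f → RF X 2ω (λ x n → bit (f (x , n)))
    curryRF₂ {X} {f} F = rf (SR-⇔ correct (∃ω (zeroSR (rf₂ (memR 2ω) #0 #1)
        ∧ all< (F ∘RF ⟨ ↑ ↑ fstRF , #0 ⟩ ≐ω rf₂ seqR #1 #0) (rf₁ sucR #1))))
      where
      correct : ∀ ((x , k) : Pt (X ⊗ ω)) →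
        (∃[ u ] mem 2ω u k ≡ 0 × (∀ n → n ℕ.< suc k → f (x , n) ≡ seq u n)) ⇔ ((λ n → bit (f (x , n))) ∈ N 2ω k)
      correct (x , k) = mk⇔
        (λ (u , m , h) → from (mem-correct 2ω k u k
          (ball-intro (λ j → bit ∘ seq j) k u (λ n l → cong bit (h n (ℕ.s≤s l)))) ℕₚ.≤-refl) m)
        λ m → let u , h = seq-dense (λ n → f (x , n)) k in
          u , to (mem-correct 2ω k u k
                (ball-intro (λ j → bit ∘ seq j) k u (λ n l → cong bit (sym (h n l)))) ℕₚ.≤-refl) m
            , λ { n (ℕ.s≤s l) → sym (h n l) }

    chooseRF : ∀ {c f g} → RF X ω c → RF X Y f → RF X Y g → RF X Y (λ x → choose (c x) (f x) (g x))
    chooseRF {X} {Y} {c} {f} {g} C F H = rf (SR-⇔ (λ (x , k) → correct (c x) (f x) (g x) k)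
      (↑ C ≐ω constω 0 ∧ nbhds F ∨ ↑ C ≢ω constω 0 ∧ nbhds H))
      where
      correct : ∀ c (y y′ : Pt Y) k → (c ≡ 0 × y ∈ N Y k ⊎ c ≢ 0 × y′ ∈ N Y k) ⇔ choose c y y′ ∈ N Y k
      correct zero    y y′ k = mk⇔ Sum.[ proj₂ , (λ (ne , _) → contradiction refl ne) ] (λ m → inj₁ (refl , m))
      correct (suc c) y y′ k = mk⇔ Sum.[ (λ ()) , proj₂ ] (λ m → inj₂ ((λ ()) , m))

    consRF : ∀ {a g} → RF X ω a → RF X ωω g → RF X ωω (λ x → a x ◂ g x)
    consRF {a = a} {g} A F =
      RF-≗ (λ { x zero → refl ; x (suc n) → refl })
           (curryRF (chooseRF #0 (↑ A) (appRF (↑ F) (rf₁ predR #0))))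

    tailRF : ∀ {g} → RF X ωω g → RF X ωω (λ x n → g x (suc n))
    tailRF F = curryRF (appRF (↑ F) (rf₁ sucR #0))

    -- The i-th box of V is a product; whether z lies in its first factor is decidable, and the
    -- second factor is listed if it does. Otherwise the value is 0, the empty neighbourhood, so h
    -- is total.
    enumerate : ∀ {V : Subset (Z ⊗ X)} → SR (Z ⊗ X) V →
                ∃[ h ] RF Z ωω h × (∀ z x → V (z , x) ⇔ (∃[ i ] x ∈ N X (h z i)))
    enumerate {Z} {X} {V} (sr (ε , εR , ⊆ , ⊇)) = h , curryRF (graphRF (SR-⇔ graph-h
        (nbSR z (rf₁ π₀R index) ∧ rf₁ π₁R index ≐ω #0 ∨ ¬nbSR z (rf₁ π₀R index) ∧ constω 0 ≐ω #0)))
      , λ z x → mk⇔ (λ v → let i , m , m′ = ⊆ v in i , inside z x i m m′) λ (i , m) → outside z x i m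
      where
      z : RF ((Z ⊗ ω) ⊗ ω) Z (λ ((z , _) , _) → z)
      z = ↑ fstRF
      index : RF ((Z ⊗ ω) ⊗ ω) ω (λ ((_ , i) , _) → ε i)
      index = rf₁ (rec₁ εR) #1
      h : Pt Z → ℕ → ℕ
      h z i with N? Z (π₀ (ε i)) z
      ... | yes _ = π₁ (ε i)
      ... | no  _ = 0
      graph-h : ∀ (((z , i) , n) : Pt ((Z ⊗ ω) ⊗ ω)) →
        (z ∈ N Z (π₀ (ε i)) × π₁ (ε i) ≡ n ⊎ ¬ z ∈ N Z (π₀ (ε i)) × 0 ≡ n) ⇔ h z i ≡ n
      graph-h ((z , i) , n) with N? Z (π₀ (ε i)) z
      ... | yes m = mk⇔ Sum.[ proj₂ , (λ (¬m , _) → contradiction m ¬m) ] (λ e → inj₁ (m , e))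
      ... | no ¬m = mk⇔ Sum.[ (λ (m , _) → contradiction m ¬m) , proj₂ ] (λ e → inj₂ (¬m , e))
      inside : ∀ z x i → z ∈ N Z (π₀ (ε i)) → x ∈ N X (π₁ (ε i)) → x ∈ N X (h z i)
      inside z x i m m′ with N? Z (π₀ (ε i)) z
      ... | yes _ = m′
      ... | no ¬m = contradiction m ¬m
      outside : ∀ z x i → x ∈ N X (h z i) → V (z , x)
      outside z x i m′ with N? Z (π₀ (ε i)) z
      ... | yes m = ⊇ (i , m , m′)
      ... | no  _ = contradiction m′ (N-zero X)

    -- A box may contain infinitely many c, so the place is a pair of a box and a candidate. Values
    -- are shifted by one and 0 lists nothing, which covers empty sections.
    enumerateω : ∀ {Q : Subset (Z ⊗ ω)} → SR (Z ⊗ ω) Q →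
                 ∃[ h ] RF Z ωω h × (∀ z c → Q (z , c) ⇔ (∃[ i ] h z i ≡ suc c))
    enumerateω {Z} {Q} (sr (ε , εR , ⊆ , ⊇)) = h , curryRF (graphRF (SR-⇔ graph-h
        (nbSR point index ∧ rf₁ sucR (rf₁ π₁R #1) ≐ω #0 ∨ ¬nbSR point index ∧ constω 0 ≐ω #0)))
      , λ z c → mk⇔ (λ q → let i , m = ⊆ q in pair i c , inside z c i m) λ (i , m) → outside z c i m
      where
      point : RF ((Z ⊗ ω) ⊗ ω) (Z ⊗ ω) (λ ((z , i) , _) → z , π₁ i)
      point = ⟨ ↑ fstRF , rf₁ π₁R #1 ⟩
      index : RF ((Z ⊗ ω) ⊗ ω) ω (λ ((_ , i) , _) → ε (π₀ i))
      index = rf₁ (rec₁ εR) (rf₁ π₀R #1)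
      h : Pt Z → ℕ → ℕ
      h z i with N? (Z ⊗ ω) (ε (π₀ i)) (z , π₁ i)
      ... | yes _ = suc (π₁ i)
      ... | no  _ = 0
      graph-h : ∀ (((z , i) , n) : Pt ((Z ⊗ ω) ⊗ ω)) →
        ((z , π₁ i) ∈ N (Z ⊗ ω) (ε (π₀ i)) × suc (π₁ i) ≡ n ⊎ ¬ (z , π₁ i) ∈ N (Z ⊗ ω) (ε (π₀ i)) × 0 ≡ n) ⇔ h z i ≡ n
      graph-h ((z , i) , n) with N? (Z ⊗ ω) (ε (π₀ i)) (z , π₁ i)
      ... | yes m = mk⇔ Sum.[ proj₂ , (λ (¬m , _) → contradiction m ¬m) ] (λ e → inj₁ (m , e))
      ... | no ¬m = mk⇔ Sum.[ (λ (m , _) → contradiction m ¬m) , proj₂ ] (λ e → inj₂ (¬m , e))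
      hit : ∀ z j {i c} → π₀ j ≡ i → π₁ j ≡ c → (z , c) ∈ N (Z ⊗ ω) (ε i) → h z j ≡ suc c
      hit z j refl refl m with N? (Z ⊗ ω) (ε (π₀ j)) (z , π₁ j)
      ... | yes _ = refl
      ... | no ¬m = contradiction m ¬m
      inside : ∀ z c i → (z , c) ∈ N (Z ⊗ ω) (ε i) → h z (pair i c) ≡ suc c
      inside z c i = hit z (pair i c) (π₀-pair i c) (π₁-pair i c)
      outside : ∀ z c i → h z i ≡ suc c → Q (z , c)
      outside z c i e with N? (Z ⊗ ω) (ε (π₀ i)) (z , π₁ i)
      outside z c i refl | yes m = ⊇ (π₀ i , m)

  -- The tree of a Borel code, approximated by neighbourhoods

  -- The root is the node 0.
  child : ℕ → ℕ → ℕ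
  child s j = suc (pair s j)

  -- A leaf counts as its own child, so that every node has a code.
  Child : Subset (ωω ⊗ (ω ⊗ ω))
  Child (δ , (j , k)) = δ 0 ≡ 0 × δ ∈ N ωω k ⊎ δ 0 ≡ 1 × (δ * , (j , k)) ∈ G (ω ⊗ ω)

  opaque
    ChildSR : SR (ωω ⊗ (ω ⊗ ω)) Child
    ChildSR = valSR fstRF (constω 0) (constω 0) ∧ nbSR fstRF (sndRF ∘RF sndRF)
            ∨ valSR fstRF (constω 0) (constω 1) ∧ GSR (tailRF fstRF) sndRF

    -- The parent of a node is known only through its neighbourhoods, so `Child` cannot be applied
    -- to it as a point. A single box of `Child`, however, asks only that the parent lie in one
    -- basic set.
    childBox : ℕ → ℕ
    childBox = proj₁ (semirecursive ChildSR)

    childBoxR : Rec₁ childBox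
    childBoxR = rec₁ (proj₁ (proj₂ (semirecursive ChildSR)))

    Child-boxes : ∀ δ j k → Child (δ , (j , k)) ⇔
              (∃[ i ] δ ∈ N ωω (π₀ (childBox i)) × (j , k) ∈ N (ω ⊗ ω) (π₁ (childBox i)))
    Child-boxes δ j k = let ⊆ , ⊇ = proj₂ (proj₂ (semirecursive ChildSR)) in mk⇔ (λ c → ⊆ c) (λ m → ⊇ m)

    NodeStep : Subset (ωω ⊗ ((ωω ⊗ ω) ⊗ ω))
    NodeStep (α , ((γ , s) , k)) = s ≡ 0 × γ ∈ N ωω k ⊎
      ∃[ n ] ∃[ i ] s ≡ suc n × (α , ((γ , π₀ n) , π₀ (childBox i))) ∈ G ((ωω ⊗ ω) ⊗ ω) × (π₁ n , k) ∈ N (ω ⊗ ω) (π₁ (childBox i))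

    NodeStepSR : SR (ωω ⊗ ((ωω ⊗ ω) ⊗ ω)) NodeStep
    NodeStepSR = s ≐ω constω 0 ∧ nbSR γ k ∨
      ∃ω (∃ω (↑ ↑ s ≐ω rf₁ sucR #1
            ∧ GSR (↑ ↑ fstRF) ⟨ ⟨ ↑ ↑ γ , rf₁ π₀R #1 ⟩ , rf₁ π₀R (rf₁ childBoxR #0) ⟩
            ∧ nbSR ⟨ rf₁ π₁R #1 , ↑ ↑ k ⟩ (rf₁ π₁R (rf₁ childBoxR #0))))
      where
      γ : RF (ωω ⊗ ((ωω ⊗ ω) ⊗ ω)) ωω (λ (_ , ((γ , _) , _)) → γ)
      γ = fstRF ∘RF fstRF ∘RF sndRF
      s : RF (ωω ⊗ ((ωω ⊗ ω) ⊗ ω)) ω (λ (_ , ((_ , s) , _)) → s)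
      s = sndRF ∘RF fstRF ∘RF sndRF
      k : RF (ωω ⊗ ((ωω ⊗ ω) ⊗ ω)) ω (λ (_ , (_ , k)) → k)
      k = sndRF ∘RF sndRF

    -- Near γ s k : the code at node s of γ lies in N ωω k.
    Near : Pt ωω → ℕ → ℕ → Set
    Near γ s k = (proj₁ (fixpoint NodeStepSR) , ((γ , s) , k)) ∈ G ((ωω ⊗ ω) ⊗ ω)

    NearSR : ∀ {γ s k} → RF X ωω γ → RF X ω s → RF X ω k → SR X (λ x → Near (γ x) (s x) (k x))
    NearSR Γ S K = GSR (proj₁ (proj₂ (fixpoint NodeStepSR))) ⟨ ⟨ Γ , S ⟩ , K ⟩

    Near-root : ∀ γ k → Near γ 0 k ⇔ γ ∈ N ωω k
    Near-root γ k = proj₂ (proj₂ (fixpoint NodeStepSR)) ((γ , 0) , k) ⟫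
      mk⇔ (λ { (inj₁ (_ , m)) → m ; (inj₂ (_ , _ , () , _)) }) λ m → inj₁ (refl , m)

    Near-child : ∀ γ n k → Near γ (suc n) k ⇔
                 (∃[ i ] Near γ (π₀ n) (π₀ (childBox i)) × (π₁ n , k) ∈ N (ω ⊗ ω) (π₁ (childBox i)))
    Near-child γ n k = proj₂ (proj₂ (fixpoint NodeStepSR)) ((γ , suc n) , k) ⟫
      mk⇔ (λ { (inj₁ (() , _)) ; (inj₂ (_ , i , refl , a , b)) → i , a , b }) λ (i , a , b) → inj₂ (n , i , refl , a , b)

  -- A relation, since for arbitrary γ there may be no δ at node s; `Near` and all that is built on
  -- it stay semirecursive nevertheless.
  Names : Pt ωω → ℕ → Pt ωω → Set
  Names γ s δ = ∀ k → δ ∈ N ωω k ⇔ Near γ s k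

  Names-root : ∀ γ → Names γ 0 γ
  Names-root γ k = ⇔-sym (Near-root γ k)

  private
    Near-Child : ∀ {γ n δ} → Names γ (π₀ n) δ → ∀ k → Child (δ , (π₁ n , k)) ⇔ Near γ (suc n) k
    Near-Child {γ} {n} {δ} names k = Child-boxes δ (π₁ n) k ⟫
      (mk⇔ (λ (i , a , b) → i , to (names _) a , b) (λ (i , a , b) → i , from (names _) a , b)
      ⟫ ⇔-sym (Near-child γ n k))

  Names-leaf : ∀ {γ n δ} → Names γ (π₀ n) δ → δ 0 ≡ 0 → Names γ (suc n) δ
  Names-leaf {γ} {n} {δ} names e k = mk⇔ (λ m → inj₁ (e , m)) back ⟫ Near-Child names k
    where
    back : Child (δ , (π₁ n , k)) → δ ∈ N ωω k
    back (inj₁ (_ , m)) = m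
    back (inj₂ (e′ , _)) = case trans (sym e) e′ of λ ()

  Names-union : ∀ {γ n δ δ′} → Names γ (π₀ n) δ → δ 0 ≡ 1 → graph (eval ω ωω (δ *)) (π₁ n) δ′ →
                Names γ (suc n) δ′
  Names-union {γ} {n} {δ} {δ′} names e g k = mk⇔ (λ m → inj₂ (e , to (g k) m)) back ⟫ Near-Child names k
    where
    back : Child (δ , (π₁ n , k)) → δ′ ∈ N ωω k
    back (inj₁ (e′ , _)) = case trans (sym e) e′ of λ ()
    back (inj₂ (_ , m)) = from (g k) m

  Val : Pt ωω → ℕ → ℕ → ℕ → Set
  Val γ s n v = ∃[ i ] Near γ s (ct ωω n i) × seq i n ≡ v

  opaque
    ValSR : ∀ {γ s n v} → RF X ωω γ → RF X ω s → RF X ω n → RF X ω v → SR X (λ x → Val (γ x) (s x) (n x) (v x))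
    ValSR Γ S N V = ∃ω (NearSR (↑ Γ) (↑ S) (rf₂ (ctR ωω) (↑ N) #0) ∧ rf₂ seqR #0 (↑ N) ≐ω ↑ V)

  Val-Names : ∀ {γ s δ} → Names γ s δ → ∀ {n v} → Val γ s n v ⇔ δ n ≡ v
  Val-Names {δ = δ} names {n} {v} = mk⇔
    (λ (i , near , e) → trans (ball-elim seq n i (from (names _) near) n ℕₚ.≤-refl) e)
    λ e → let i , h = seq-dense δ n in
      i , to (names _) (ball-intro seq n i (λ m l → sym (h m l))) , trans (h n ℕₚ.≤-refl) e

  -- Literals and certificates

  BX : Space
  BX = 2ω ⊗ ω

  -- Literals: pair 0 K stands for N BX K; pair 1 s and pair 2 s stand for the
  -- set of all (x , m) with x ∉ ρ(δ), where δ is the code at node s, a leaf or a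
  -- union respectively.  Disj γ n j ℓ says that ℓ is the j-th set of the union
  -- that defines ρ of the code at node n.
  Disj : Pt ωω → ℕ → ℕ → ℕ → Set
  Disj γ n j ℓ =
    Val γ n 0 0 × (∃[ v ] Val γ n (suc j) v × ℓ ≡ pair 0 (pair v whole)) ⊎
    Val γ n 0 1 × (Val γ (child n j) 0 0 × ℓ ≡ pair 1 (child n j) ⊎
                   Val γ (child n j) 0 1 × ℓ ≡ pair 2 (child n j))

  -- The sets of the refuters ℓ′ make up the complement of the set of ℓ. A box is refuted by boxes
  -- fine enough (q bounds its index) for `mem` to exclude them; a literal x ∉ ρ is refuted by the
  -- disjuncts of that ρ.
  Refutes : Pt ωω → ℕ → ℕ → Set
  Refutes γ ℓ ℓ′ =
    π₀ ℓ ≡ 0 × π₀ ℓ′ ≡ 0 × (∃[ q ] ∃[ i ] π₁ ℓ′ ≡ ct BX q i × π₁ ℓ ℕ.≤ q × mem BX i (π₁ ℓ) ≢ 0) ⊎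
    π₀ ℓ ≢ 0 × (∃[ j ] Disj γ (π₁ ℓ) j ℓ′)

  Mem : ℕ → ℕ → Set
  Mem ℓ D = ∃[ i ] i ℕ.< π₀ D × seq (π₁ D) i ≡ ℓ

  -- The certificate with ℓ as its only literal. The predecessor of the tag is the right flag: 0 for
  -- tags 0 and 1, and 1 for unions.
  single : ℕ → ℕ
  single ℓ = pair (ℕ.pred (π₀ ℓ)) (pair 1 (pair ℓ 0))

  Refuted : Pt ((ωω ⊗ ω) ⊗ BX) → Set
  Refuted ((γ , c) , y) = ∃[ ℓ ] ∃[ K ] Mem ℓ (π₁ c) × Refutes γ ℓ (pair 0 K) × y ∈ N BX K

  Step : Pt ((ωω ⊗ ω) ⊗ ω) → Set
  Step ((γ , c) , c′) = ∃[ ℓ ] ∃[ ℓ′ ] Mem ℓ (π₁ c) × Refutes γ ℓ ℓ′ × c′ ≡ single ℓ′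

  Deep : ℕ → Set
  Deep s = ∃[ n ] s ≡ suc n × π₀ n ≢ 0

  Valid : Pt ωω → ℕ → Set
  Valid γ ℓ = π₀ ℓ ≡ 0 ⊎ π₀ ℓ ≡ 1 × Val γ (π₁ ℓ) 0 0 ⊎ π₀ ℓ ≡ 2 × Val γ (π₁ ℓ) 0 1 × Deep (π₁ ℓ)

  -- The literals of D force the inverse bijection to take the value v at place n.
  -- Being nonzero at a node is forced by a literal for one of its children; since
  -- union nodes of depth 1 are not needed (Deep), all ranks stay below ξ⁻.
  Fixes : Pt ωω → ℕ → ℕ → ℕ → Set
  Fixes γ D n v =
    (∃[ a ] ∃[ k ] Mem (pair 0 (pair (ct 2ω n a) k)) D × π₀ v ≡ sgn (seq a n)) ×
    (π₁ v ≡ 0 × (n ≡ 0 ⊎ γ 0 ≡ 0 ⊎ Mem (pair 1 n) D ⊎ Mem (pair 2 n) D) ⊎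
     ∃[ j ] π₁ v ≡ suc j × (∃[ ℓ ] Mem ℓ D × Disj γ n j ℓ) ×
       (∀ k → k ℕ.< j → ∃[ ℓ ] ∃[ ℓ′ ] Disj γ n k ℓ × Mem ℓ′ D × Refutes γ ℓ ℓ′))

  -- A certificate is pair h D; the flag h tells whether D has a union literal, and
  -- thereby the shape of the code of the complement of the certified set.
  Headed : ℕ → ℕ → Set
  Headed h D = h ≡ 0 × (∀ i → i ℕ.< π₀ D → π₀ (seq (π₁ D) i) ≢ 2) ⊎
               h ≡ 1 × (∃[ ℓ ] Mem ℓ D × π₀ ℓ ≡ 2)

  -- The literal with `sing m` pins the second coordinate of a point of BX to m. The dense point u
  -- records forced values at the places up to m, and these decide membership in `N ωω m`.
  Certifies : Pt ωω → ℕ → Set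
  Certifies γ D = (∀ i → i ℕ.< π₀ D → Valid γ (seq (π₁ D) i)) ×
    (∃[ m ] ∃[ u ] mem ωω u m ≡ 0 × (∃[ K ] Mem (pair 0 (pair K (sing m))) D) ×
      (∀ n → n ℕ.< suc m → Fixes γ D n (seq u n)))

  Cert : Pt (ωω ⊗ ω) → Set
  Cert (γ , c) = Headed (π₀ c) (π₁ c) × Certifies γ (π₁ c)

  -- Certificates made of boxes alone certify an open set; they serve the case ξ ≤ 2.
  OpenCert : Pt (ωω ⊗ BX) → Set
  OpenCert (γ , y) = ∃[ c ] Cert (γ , c) ×
    (∀ i → i ℕ.< π₀ (π₁ c) → ∃[ K ] seq (π₁ (π₁ c)) i ≡ pair 0 K × y ∈ N BX K)

  -- Witness functions and the closed set C

  -- A point z of C pairs at place s the value x(s) of its image x with a witness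
  -- at node s: 0 if x ∉ ρ of the code there, and otherwise 1 + the least j such
  -- that the j-th set of the union contains x.
  pr : Pt ωω → Pt 2ω
  pr z n = bit (π₀ (z n))

  wit : Pt ωω → ℕ → ℕ
  wit z s = π₁ (z s)

  -- The claims of z that its image lies in, respectively outside, the j-th set at s. The second is
  -- not the negation of the first, so that both are semirecursive for every γ. At a union z is
  -- taken at its word about the child.
  Wit⁺ Wit⁻ : Pt ωω → Pt ωω → ℕ → ℕ → Set
  Wit⁺ γ z s j = Val γ s 0 0 × (∃[ v ] Val γ s (suc j) v × pr z ∈ N 2ω v) ⊎
                 Val γ s 0 1 × wit z (child s j) ≡ 0
  Wit⁻ γ z s j = Val γ s 0 0 × (∃[ v ] Val γ s (suc j) v × ¬ pr z ∈ N 2ω v) ⊎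
                 Val γ s 0 1 × wit z (child s j) ≢ 0

  -- `bit` identifies all positive numbers, so injectivity of `pr` on C requires first components of
  -- at most 1. The last three clauses object to a zero witness with a true disjunct, to a named
  -- disjunct that is false, and to one that is not the least.
  Violation : Pt (ωω ⊗ ωω) → Set
  Violation (γ , z) = (∃[ s ] 1 ℕ.< π₀ (z s)) ⊎ wit z 0 ≢ 0 ⊎
    ∃[ s ] ∃[ j ] (wit z s ≡ 0 × Wit⁺ γ z s j ⊎ wit z s ≡ suc j × Wit⁻ γ z s j ⊎
                   ∃[ k ] k ℕ.< j × wit z s ≡ suc j × Wit⁺ γ z s k)

  -- Semirecursiveness of the notions above

  opaque
    childRF : ∀ {s j} → RF X ω s → RF X ω j → RF X ω (λ x → child (s x) (j x))
    childRF S J = rf₁ sucR (rf₂ pairR S J)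

    DisjSR : ∀ {γ n j ℓ} → RF X ωω γ → RF X ω n → RF X ω j → RF X ω ℓ →
             SR X (λ x → Disj (γ x) (n x) (j x) (ℓ x))
    DisjSR Γ N J L =
      ValSR Γ N (constω 0) (constω 0) ∧
        ∃ω (ValSR (↑ Γ) (↑ N) (rf₁ sucR (↑ J)) #0 ∧ ↑ L ≐ω rf₂ pairR (constω 0) (rf₂ pairR #0 (constω whole))) ∨
      ValSR Γ N (constω 0) (constω 1) ∧
        (ValSR Γ (childRF N J) (constω 0) (constω 0) ∧ L ≐ω rf₂ pairR (constω 1) (childRF N J) ∨
         ValSR Γ (childRF N J) (constω 0) (constω 1) ∧ L ≐ω rf₂ pairR (constω 2) (childRF N J))

    RefutesSR : ∀ {γ ℓ ℓ′} → RF X ωω γ → RF X ω ℓ → RF X ω ℓ′ → SR X (λ x → Refutes (γ x) (ℓ x) (ℓ′ x))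
    RefutesSR Γ L L′ =
      rf₁ π₀R L ≐ω constω 0 ∧ rf₁ π₀R L′ ≐ω constω 0 ∧
        ∃ω (∃ω (rf₁ π₁R (↑ ↑ L′) ≐ω rf₂ (ctR BX) #1 #0 ∧ rf₁ π₁R (↑ ↑ L) ≤ω #1 ∧
                rf₂ (memR BX) #0 (rf₁ π₁R (↑ ↑ L)) ≢ω constω 0)) ∨
      rf₁ π₀R L ≢ω constω 0 ∧ ∃ω (DisjSR (↑ Γ) (rf₁ π₁R (↑ L)) #0 (↑ L′))

    MemSR : ∀ {ℓ D} → RF X ω ℓ → RF X ω D → SR X (λ x → Mem (ℓ x) (D x))
    MemSR L D = ∃ω (#0 <ω rf₁ π₀R (↑ D) ∧ rf₂ seqR (rf₁ π₁R (↑ D)) #0 ≐ω ↑ L)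

    RefutedSR : SR ((ωω ⊗ ω) ⊗ BX) Refuted
    RefutedSR = ∃ω (∃ω (MemSR #1 (rf₁ π₁R (↑ ↑ ↑ sndRF))
      ∧ RefutesSR (↑ ↑ ↑ fstRF) #1 (rf₂ pairR (constω 0) #0) ∧ nbSR (↑ ↑ sndRF) #0))

    StepSR : SR ((ωω ⊗ ω) ⊗ ω) Step
    StepSR = ∃ω (∃ω (MemSR #1 (rf₁ π₁R (↑ ↑ ↑ sndRF)) ∧ RefutesSR (↑ ↑ ↑ fstRF) #1 #0
      ∧ (↑ ↑ sndRF) ≐ω rf₂ pairR (rf₁ predR (rf₁ π₀R #0)) (rf₂ pairR (constω 1) (rf₂ pairR #0 (constω 0)))))

    ValidSR : ∀ {γ ℓ} → RF X ωω γ → RF X ω ℓ → SR X (λ x → Valid (γ x) (ℓ x))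
    ValidSR Γ L = rf₁ π₀R L ≐ω constω 0 ∨
      rf₁ π₀R L ≐ω constω 1 ∧ ValSR Γ (rf₁ π₁R L) (constω 0) (constω 0) ∨
      rf₁ π₀R L ≐ω constω 2 ∧ ValSR Γ (rf₁ π₁R L) (constω 0) (constω 1) ∧
        ∃ω (rf₁ π₁R (↑ L) ≐ω rf₁ sucR #0 ∧ rf₁ π₀R #0 ≢ω constω 0)

    FixesSR : ∀ {γ D n v} → RF X ωω γ → RF X ω D → RF X ω n → RF X ω v →
              SR X (λ x → Fixes (γ x) (D x) (n x) (v x))
    FixesSR Γ D N V =
      ∃ω (∃ω (MemSR (rf₂ pairR (constω 0) (rf₂ pairR (rf₂ (ctR 2ω) (↑ ↑ N) #1) #0)) (↑ ↑ D)
            ∧ rf₁ π₀R (↑ ↑ V) ≐ω rf₁ sgnR (rf₂ seqR #1 (↑ ↑ N)))) ∧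
      (rf₁ π₁R V ≐ω constω 0 ∧ (N ≐ω constω 0 ∨ valSR Γ (constω 0) (constω 0) ∨
         MemSR (rf₂ pairR (constω 1) N) D ∨ MemSR (rf₂ pairR (constω 2) N) D) ∨
       ∃ω (rf₁ π₁R (↑ V) ≐ω rf₁ sucR #0 ∧ ∃ω (MemSR #0 (↑ ↑ D) ∧ DisjSR (↑ ↑ Γ) (↑ ↑ N) #1 #0) ∧
           all< (∃ω (∃ω (DisjSR (↑ ↑ ↑ ↑ Γ) (↑ ↑ ↑ ↑ N) (↑ ↑ #0) #1 ∧ MemSR #0 (↑ ↑ ↑ ↑ D)
                       ∧ RefutesSR (↑ ↑ ↑ ↑ Γ) #1 #0))) #0))

    CertSR : SR (ωω ⊗ ω) Cert
    CertSR = headed ∧ all< (ValidSR (↑ fstRF) (rf₂ seqR (rf₁ π₁R (↑ D)) #0)) (rf₁ π₀R D) ∧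
      ∃ω (∃ω (zeroSR (rf₂ (memR ωω) #0 #1)
            ∧ ∃ω (MemSR (rf₂ pairR (constω 0) (rf₂ pairR #0 (rf₁ singR (↑ #1)))) (↑ ↑ ↑ D))
            ∧ all< (FixesSR (↑ ↑ ↑ fstRF) (↑ ↑ ↑ D) #0 (rf₂ seqR #1 #0)) (rf₁ sucR #1)))
      where
      D : RF (ωω ⊗ ω) ω (λ (_ , c) → π₁ c)
      D = rf₁ π₁R sndRF
      headed : SR (ωω ⊗ ω) (λ (_ , c) → Headed (π₀ c) (π₁ c))
      headed =
        rf₁ π₀R sndRF ≐ω constω 0 ∧
          all< (rf₁ π₀R (rf₂ seqR (rf₁ π₁R (↑ D)) #0) ≢ω constω 2) (rf₁ π₀R D) ∨
        rf₁ π₀R sndRF ≐ω constω 1 ∧ ∃ω (MemSR #0 (↑ D) ∧ rf₁ π₀R #0 ≐ω constω 2)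

    OpenCertSR : SR (ωω ⊗ BX) OpenCert
    OpenCertSR = ∃ω (sub CertSR ⟨ ↑ fstRF , #0 ⟩
      ∧ all< (∃ω (rf₂ seqR (rf₁ π₁R (rf₁ π₁R (↑ #1))) #1 ≐ω rf₂ pairR (constω 0) #0 ∧ nbSR (↑ ↑ ↑ sndRF) #0))
             (rf₁ π₀R (rf₁ π₁R #0)))

    prRF : ∀ {z} → RF X ωω z → RF X 2ω (λ x → pr (z x))
    prRF F = curryRF₂ (rf₁ π₀R (appRF (↑ F) #0))

    witRF : ∀ {z s} → RF X ωω z → RF X ω s → RF X ω (λ x → wit (z x) (s x))
    witRF F S = rf₁ π₁R (appRF F S)

    Wit⁺SR : ∀ {γ z s j} → RF X ωω γ → RF X ωω z → RF X ω s → RF X ω j →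
             SR X (λ x → Wit⁺ (γ x) (z x) (s x) (j x))
    Wit⁺SR Γ F S J =
      ValSR Γ S (constω 0) (constω 0) ∧ ∃ω (ValSR (↑ Γ) (↑ S) (rf₁ sucR (↑ J)) #0 ∧ nbSR (prRF (↑ F)) #0) ∨
      ValSR Γ S (constω 0) (constω 1) ∧ witRF F (childRF S J) ≐ω constω 0

    Wit⁻SR : ∀ {γ z s j} → RF X ωω γ → RF X ωω z → RF X ω s → RF X ω j →
             SR X (λ x → Wit⁻ (γ x) (z x) (s x) (j x))
    Wit⁻SR Γ F S J =
      ValSR Γ S (constω 0) (constω 0) ∧ ∃ω (ValSR (↑ Γ) (↑ S) (rf₁ sucR (↑ J)) #0 ∧ ¬nbSR (prRF (↑ F)) #0) ∨
      ValSR Γ S (constω 0) (constω 1) ∧ witRF F (childRF S J) ≢ω constω 0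

    ViolationSR : SR (ωω ⊗ ωω) Violation
    ViolationSR = ∃ω (constω 1 <ω rf₁ π₀R (appRF (↑ sndRF) #0)) ∨ witRF sndRF (constω 0) ≢ω constω 0 ∨
      ∃ω (∃ω (witRF z #1 ≐ω constω 0 ∧ Wit⁺SR γ z #1 #0 ∨
              witRF z #1 ≐ω rf₁ sucR #0 ∧ Wit⁻SR γ z #1 #0 ∨
              ∃ω (#0 <ω #1 ∧ witRF (↑ z) (↑ #1) ≐ω rf₁ sucR #1 ∧ Wit⁺SR (↑ γ) (↑ z) (↑ #1) #0)))
      where
      γ : RF (((ωω ⊗ ωω) ⊗ ω) ⊗ ω) ωω (λ (((γ , _) , _) , _) → γ)
      γ = ↑ ↑ fstRF
      z : RF (((ωω ⊗ ωω) ⊗ ω) ⊗ ω) ωω (λ (((_ , z) , _) , _) → z)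
      z = ↑ ↑ sndRF

  -- Enumerations, self-referential codes and the maps F

  -- Enumerations of sets of certificates are padded with a certificate whose
  -- literal denotes the empty neighbourhood.
  orDummy : ℕ → ℕ
  orDummy n = choose n (single (pair 0 0)) (ℕ.pred n)

  opaque
    orDummyR : Rec₁ orDummy
    orDummyR = mk₁ (chooseR v₀ (constR (single (pair 0 0))) (predR $₁ v₀)) λ _ → refl

    refuted : Pt (ωω ⊗ ω) → Pt ωω
    refuted = proj₁ (enumerate RefutedSR)

    refutedRF : RF (ωω ⊗ ω) ωω refuted
    refutedRF = proj₁ (proj₂ (enumerate RefutedSR))

    refuted-spec : ∀ z y → Refuted (z , y) ⇔ (∃[ i ] y ∈ N BX (refuted z i))
    refuted-spec = proj₂ (proj₂ (enumerate RefutedSR))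

    steps : Pt (ωω ⊗ ω) → Pt ωω
    steps = proj₁ (enumerateω StepSR)

    stepsRF : RF (ωω ⊗ ω) ωω steps
    stepsRF = proj₁ (proj₂ (enumerateω StepSR))

    steps-spec : ∀ z c → Step (z , c) ⇔ (∃[ i ] steps z i ≡ suc c)
    steps-spec = proj₂ (proj₂ (enumerateω StepSR))

    certs : Pt ωω → Pt ωω
    certs = proj₁ (enumerateω CertSR)

    certsRF : RF ωω ωω certs
    certsRF = proj₁ (proj₂ (enumerateω CertSR))

    certs-spec : ∀ γ c → Cert (γ , c) ⇔ (∃[ i ] certs γ i ≡ suc c)
    certs-spec = proj₂ (proj₂ (enumerateω CertSR))

    openCerts : Pt ωω → Pt ωω
    openCerts = proj₁ (enumerate OpenCertSR)

    openCertsRF : RF ωω ωω openCerts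
    openCertsRF = proj₁ (proj₂ (enumerate OpenCertSR))

    openCerts-spec : ∀ γ y → OpenCert (γ , y) ⇔ (∃[ i ] y ∈ N BX (openCerts γ i))
    openCerts-spec = proj₂ (proj₂ (enumerate OpenCertSR))

    violations : Pt ωω → Pt ωω
    violations = proj₁ (enumerate ViolationSR)

    violationsRF : RF ωω ωω violations
    violationsRF = proj₁ (proj₂ (enumerate ViolationSR))

    violations-spec : ∀ γ z → Violation (γ , z) ⇔ (∃[ i ] z ∈ N ωω (violations γ i))
    violations-spec = proj₂ (proj₂ (enumerate ViolationSR))

  -- A code of the complement of the certified set.  The codes it refers to are
  -- again of this form; α is later fixed by the recursion theorem.
  complementFrom : Pt ωω → Pt (ωω ⊗ ω) → Pt ωω
  complementFrom α z = choose (π₀ (proj₂ z)) (0 ◂ refuted z) (1 ◂ S (ωω ⊗ ω) (ω ⊗ ω) (α , z))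

  opaque
    complementFromRF : ∀ {α z} → RF X ωω α → RF X (ωω ⊗ ω) z → RF X ωω (λ x → complementFrom (α x) (z x))
    complementFromRF A F = chooseRF (rf₁ π₀R (sndRF ∘RF F)) (consRF (constω 0) (refutedRF ∘RF F))
                                    (consRF (constω 1) (SRF (ωω ⊗ ω) (ω ⊗ ω) A F))

    nextRF : ∀ {z i} → RF X (ωω ⊗ ω) z → RF X ω i → RF X (ωω ⊗ ω) (λ x → proj₁ (z x) , orDummy (steps (z x) (i x)))
    nextRF F I = ⟨ fstRF ∘RF F , rf₁ orDummyR (appRF (stepsRF ∘RF F) I) ⟩

    private
      -- The equation for α: the i-th sub-code of a complement of union shape is the complement code
      -- of the i-th one-literal certificate given by `Step`, built from the same α. A fixed point
      -- exists without any regard to well-foundedness.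
      SelfReference : Pt (ωω ⊗ ((ωω ⊗ ω) ⊗ (ω ⊗ ω))) → Set
      SelfReference (α , (z , (i , k))) = complementFrom α (proj₁ z , orDummy (steps z i)) ∈ N ωω k

      selfReference : SR (ωω ⊗ ((ωω ⊗ ω) ⊗ (ω ⊗ ω))) SelfReference
      selfReference = nbSR (complementFromRF fstRF (nextRF (fstRF ∘RF sndRF) (fstRF ∘RF sndRF ∘RF sndRF)))
                           (sndRF ∘RF sndRF ∘RF sndRF)

    self : Pt ωω
    self = proj₁ (fixpoint selfReference)

    selfRF : RF X ωω (λ _ → self)
    selfRF = proj₁ (proj₂ (fixpoint selfReference))

  complement : Pt (ωω ⊗ ω) → Pt ωω
  complement = complementFrom self

  opaque
    unfolding self SelfReference

    complementRF : ∀ {z} → RF X (ωω ⊗ ω) z → RF X ωω (λ x → complement (z x))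
    complementRF = complementFromRF selfRF

    complement-steps : ∀ z i → graph (eval ω ωω (S (ωω ⊗ ω) (ω ⊗ ω) (self , z))) i
                                     (complement (proj₁ z , orDummy (steps z i)))
    complement-steps z i k = ⇔-sym (proj₂ (proj₂ (fixpoint selfReference)) (z , (i , k)))
                           ⟫ S-spec (ωω ⊗ ω) (ω ⊗ ω) self z (i , k)

    private
      certified : SR (ωω ⊗ (ω ⊗ ω)) (λ (γ , (i , k)) → complement (γ , orDummy (certs γ i)) ∈ N ωω k)
      certified = nbSR (complementRF ⟨ fstRF , rf₁ orDummyR (appRF (certsRF ∘RF fstRF) (fstRF ∘RF sndRF)) ⟩)
                       (sndRF ∘RF sndRF)

    certificates : Pt ωω → Pt ωω
    certificates γ = S ωω (ω ⊗ ω) (proj₁ (indexOf certified) , γ)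

    certificatesRF : ∀ {γ} → RF X ωω γ → RF X ωω (λ x → certificates (γ x))
    certificatesRF = SRF ωω (ω ⊗ ω) (constωω (proj₁ (proj₂ (indexOf certified))))

    certificates-spec : ∀ γ i → graph (eval ω ωω (certificates γ)) i (complement (γ , orDummy (certs γ i)))
    certificates-spec γ i k = proj₂ (proj₂ (indexOf certified)) (γ , (i , k))
                            ⟫ S-spec ωω (ω ⊗ ω) (proj₁ (indexOf certified)) γ (i , k)

    projection : SR (ωω ⊗ ω) (λ (z , k) → pr z ∈ N 2ω k)
    projection = nbhds (prRF idRF)

    prCode : Pt ωω
    prCode = proj₁ (indexOf projection)

    prCodeRF : RF X ωω (λ _ → prCode)
    prCodeRF = constωω (proj₁ (proj₂ (indexOf projection)))

    prCode-spec : ∀ z k → pr z ∈ N 2ω k ⇔ (prCode , (z , k)) ∈ G (ωω ⊗ ω)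
    prCode-spec z k = proj₂ (proj₂ (indexOf projection)) (z , k)

    private
      projectionInto : SR (ω ⊗ ωω) (λ (k , z) → pr z ∈ N 2ω k)
      projectionInto = nbSR (prRF sndRF) fstRF

    preimages : ℕ → ℕ → ℕ
    preimages = proj₁ (enumerate projectionInto)

    preimages-spec : ∀ k z → pr z ∈ N 2ω k ⇔ (∃[ i ] z ∈ N ωω (preimages k i))
    preimages-spec = proj₂ (proj₂ (enumerate projectionInto))

  -- The function f is the projection `prCode` for every γ; only C and the inverse vary. For γ in
  -- BC, γ(0) = 0 means ξ = 1, where ξ⁻ = 1 demands an open code; otherwise ξ⁻ ≥ 2 and the
  -- certificates can be listed.
  F₀ F₂ F₂′ : Pt ωω → Pt ωω
  F₀ γ = 0 ◂ violations γ
  F₂ γ = 0 ◂ openCerts γ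
  F₂′ γ = choose (γ 0) (F₂ γ) (1 ◂ certificates γ)

  Triple : Space
  Triple = ωω ⊗ ωω ⊗ ωω

  FRF : RF ωω Triple (λ γ → F₀ γ , prCode , F₂ γ)
  FRF = ⟨ consRF (constω 0) violationsRF , ⟨ prCodeRF , consRF (constω 0) openCertsRF ⟩ ⟩

  FRF′ : RF ωω Triple (λ γ → F₀ γ , prCode , F₂′ γ)
  FRF′ = ⟨ consRF (constω 0) violationsRF , ⟨ prCodeRF ,
    chooseRF (appRF idRF (constω 0)) (consRF (constω 0) openCertsRF) (consRF (constω 1) (certificatesRF idRF)) ⟩ ⟩

  total : ∀ {f} → RF X Y f → X ⇀ Y
  total {X} {Y} {f} F = record
    { graph      = λ x y → Eq Y (f x) y
    ; graph-resp = λ {x} {x′} {y} {y′} e e′ h → Eq-trans Y (Eq-sym Y (RF-resp F e)) (Eq-trans Y h e′)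
    ; functional = λ h h′ → Eq-trans Y (Eq-sym Y h) h′
    }
    where
    Eq-trans : ∀ X {x y z} → Eq X x y → Eq X y z → Eq X x z
    Eq-trans ω       p q = trans p q
    Eq-trans ωω      p q n = trans (p n) (q n)
    Eq-trans 2ω      p q n = trans (p n) (q n)
    Eq-trans (X ⊗ Y) (p , p′) (q , q′) = Eq-trans X p q , Eq-trans Y p′ q′

  Eq-refl : ∀ X {x} → Eq X x x
  Eq-refl ω       = refl
  Eq-refl ωω      _ = refl
  Eq-refl 2ω      _ = refl
  Eq-refl (X ⊗ Y) = Eq-refl X , Eq-refl Y

  total-recursive : ∀ {f} (F : RF X Y f) → RecursiveOn (total F) (Domain (total F))
  total-recursive {X} {Y} {f} F = _ , semirecursive (nbhds F) , (λ d → d) , λ x _ k → mk⇔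
    (λ (y , e , m) → N-resp Y k (Eq-sym Y e) m)
    λ m → f x , Eq-refl Y , m

-- Classical logic and ordinals

module Classical (em : ExcludedMiddle 0ℓ) where

  dne : {P : Set} → ¬ ¬ P → P
  dne {P} ¬¬p with em {P}
  ... | yes p = p
  ... | no ¬p = contradiction ¬p ¬¬p

  ¬∀⇒∃¬ : {A : Set} {P : A → Set} → ¬ (∀ a → P a) → ∃[ a ] ¬ P a
  ¬∀⇒∃¬ ¬∀ = dne λ ¬∃ → ¬∀ λ a → dne λ ¬p → ¬∃ (a , ¬p)

  ¬→ : {A B : Set} → ¬ (A → B) → A × ¬ B
  ¬→ ¬f = dne (λ ¬a → ¬f λ a → contradiction a ¬a) , λ b → ¬f λ _ → b

  least : (P : ℕ → Set) → ∃[ n ] P n → ∃[ j ] P j × (∀ k → k ℕ.< j → ¬ P k)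
  least P (n , p) with search (suc n)
    where
    search : ∀ m → (∃[ j ] P j × (∀ k → k ℕ.< j → ¬ P k)) ⊎ (∀ k → k ℕ.< m → ¬ P k)
    search zero    = inj₂ λ _ ()
    search (suc m) with search m
    ... | inj₁ found = inj₁ found
    ... | inj₂ none with em {P m}
    ...   | yes p = inj₁ (m , p , none)
    ...   | no ¬p = inj₂ λ k k≤m → case ℕₚ.m≤n⇒m<n∨m≡n (ℕ.s≤s⁻¹ k≤m) of λ
      { (inj₁ k<m)  → none k k<m
      ; (inj₂ refl) → ¬p }
  ... | inj₁ found = found
  ... | inj₂ none  = contradiction p (none n ℕₚ.≤-refl)

  ≤-refl : ∀ {α} → α ≤ α
  ≤-refl {zero}  = z≤
  ≤-refl {suc α} = s≤s ≤-refl
  ≤-refl {sup f} = sup≤ λ i → ≤sup i ≤-refl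

  ≤-trans : ∀ {α β γ} → α ≤ β → β ≤ γ → α ≤ γ
  ≤-trans z≤         q          = z≤
  ≤-trans (sup≤ h)   q          = sup≤ λ i → ≤-trans (h i) q
  ≤-trans (s≤s p)    (s≤s q)    = s≤s (≤-trans p q)
  ≤-trans (s≤s p)    (≤sup j q) = ≤sup j (≤-trans (s≤s p) q)
  ≤-trans (≤sup i p) (sup≤ h)   = ≤-trans p (h i)
  ≤-trans (≤sup i p) (≤sup j q) = ≤sup j (≤-trans (≤sup i p) q)

  ≤-suc : ∀ {α} → α ≤ suc α
  ≤-suc {zero}  = z≤
  ≤-suc {suc α} = s≤s ≤-suc
  ≤-suc {sup f} = sup≤ λ i → ≤-trans ≤-suc (s≤s (≤sup i ≤-refl))

  <⇒≤ : ∀ {α β} → α < β → α ≤ β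
  <⇒≤ = ≤-trans ≤-suc

  s≤s⁻¹ : ∀ {α β} → suc α ≤ suc β → α ≤ β
  s≤s⁻¹ (s≤s p) = p

  ≤-or-> : ∀ α β → α ≤ β ⊎ β < α
  ≤-or-> zero    β = inj₁ z≤
  ≤-or-> (suc α) zero    = inj₂ (s≤s z≤)
  ≤-or-> (suc α) (suc β) = Sum.map s≤s s≤s (≤-or-> α β)
  ≤-or-> (suc α) (sup g) with em {∃[ i ] suc α ≤ g i}
  ... | yes (i , p) = inj₁ (≤sup i p)
  ... | no  ¬p      = inj₂ (s≤s (sup≤ λ i → below i (≤-or-> (suc α) (g i))))
    where
    below : ∀ i → suc α ≤ g i ⊎ g i < suc α → g i ≤ α
    below i (inj₁ p) = contradiction (i , p) ¬p
    below i (inj₂ p) = s≤s⁻¹ p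
  ≤-or-> (sup f) β with em {∃[ i ] β < f i}
  ... | yes (i , p) = inj₂ (≤sup i p)
  ... | no  ¬p      = inj₁ (sup≤ λ i → below i (≤-or-> (f i) β))
    where
    below : ∀ i → f i ≤ β ⊎ β < f i → f i ≤ β
    below i (inj₁ p) = p
    below i (inj₂ p) = contradiction (i , p) ¬p

  -- A finite list of ranks has a maximum, so a certificate stays strictly below μ even when μ is a
  -- limit.
  finite-bound : ∀ {μ} → one ≤ μ → (f : ℕ → Ord) → ∀ l → (∀ i → i ℕ.< l → f i < μ) →
                 ∃[ ζ ] ζ < μ × (∀ i → i ℕ.< l → f i ≤ ζ)
  finite-bound one≤μ f zero    h = zero , one≤μ , λ _ ()
  finite-bound one≤μ f (suc l) h with finite-bound one≤μ f l (λ i i<l → h i (ℕₚ.m≤n⇒m≤1+n i<l))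
  ... | ζ , ζ<μ , bound with ≤-or-> (f l) ζ
  ...   | inj₁ fl≤ζ = ζ , ζ<μ , λ i i≤l → case ℕₚ.m≤n⇒m<n∨m≡n (ℕ.s≤s⁻¹ i≤l) of λ
    { (inj₁ i<l) → bound i i<l ; (inj₂ refl) → fl≤ζ }
  ...   | inj₂ ζ<fl = f l , h l ℕₚ.≤-refl , λ i i≤l → case ℕₚ.m≤n⇒m<n∨m≡n (ℕ.s≤s⁻¹ i≤l) of λ
    { (inj₁ i<l) → ≤-trans (bound i i<l) (<⇒≤ ζ<fl) ; (inj₂ refl) → ≤-refl }

  two≰one : ¬ two ≤ one
  two≰one (s≤s ())

  -- Bounds the ranks at depth 1; a union at depth 2 then has rank strictly below ξ⁻.
  ≤minus : ∀ {η ξ} → η < ξ → η ≤ minus em ξ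
  ≤minus {η} {ξ} η<ξ with em {three ≤ ξ}
  ... | no  _ = <⇒≤ η<ξ
  ... | yes _ with em {∃[ ζ ] ξ ≈ suc ζ}
  ...   | yes (ζ , ξ≤ , _) = s≤s⁻¹ (≤-trans η<ξ ξ≤)
  ...   | no  _            = <⇒≤ η<ξ

  two≤minus : ∀ {ξ} → two ≤ ξ → two ≤ minus em ξ
  two≤minus {ξ} two≤ξ with em {three ≤ ξ}
  ... | no  _ = two≤ξ
  ... | yes three≤ξ with em {∃[ ζ ] ξ ≈ suc ζ}
  ...   | yes (ζ , ξ≤ , _) = s≤s⁻¹ (≤-trans three≤ξ ξ≤)
  ...   | no  _            = two≤ξ

  minus-one : ∀ {ξ} → ξ ≈ one → minus em ξ ≈ one
  minus-one {ξ} e with em {three ≤ ξ}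
  ... | no  _ = e
  ... | yes three≤ξ = contradiction (≤-trans (s≤s (s≤s z≤)) (≤-trans three≤ξ (proj₁ e))) two≰one

-- The tree of a genuine code and the meaning of literals

module Construction (em : ExcludedMiddle 0ℓ) (𝒢 : GoodParametrization) where
  open GoodParametrization 𝒢
  open Codes 𝒢
  open Recursion 𝒢
  open Classical em

  ρ-resp : ∀ X {ξ γ} (d : BC ξ γ) {x y} → Eq X x y → x ∈ ρ X d → y ∈ ρ X d
  ρ-resp X (BC-one _ _)            e (i , m) = i , N-resp X _ e m
  ρ-resp X (BC-⋃ _ _ _ _ _ _ _ d) e (i , m) = i , λ m′ → m (ρ-resp X (d i) (Eq-sym X e) m′)

  record Node : Set where
    constructor node
    field
      rank : Ord
      code : Pt ωω
      der  : BC rank code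
  open Node

  childNode : Node → ℕ → Node
  childNode (node ξ γ (BC-one e h))            j = node ξ γ (BC-one e h)
  childNode (node _ _ (BC-⋃ _ _ δ η _ _ _ d)) j = node (η j) (δ j) (d j)

  data Head (M : Node) : Set where
    leaf  : code M 0 ≡ 0 → Head M
    union : code M 0 ≡ 1 → Head M

  head : ∀ M → Head M
  head (node _ _ (BC-one _ h))            = leaf h
  head (node _ _ (BC-⋃ _ h _ _ _ _ _ _)) = union h

  childNode-leaf : ∀ M j → code M 0 ≡ 0 → childNode M j ≡ M
  childNode-leaf (node _ _ (BC-one _ _))            j e = refl
  childNode-leaf (node _ _ (BC-⋃ _ h _ _ _ _ _ _)) j e = case trans (sym h) e of λ ()

  childNode-rank : ∀ M j → code (childNode M j) 0 ≡ 1 → code M 0 ≡ 1 × rank (childNode M j) < rank M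
  childNode-rank (node _ _ (BC-one _ h))            j e = case trans (sym h) e of λ ()
  childNode-rank (node _ _ (BC-⋃ _ h _ _ _ _ l _)) j e = h , l j

  union-rank : ∀ M → code M 0 ≡ 1 → two ≤ rank M
  union-rank (node _ _ (BC-one _ h))            e = case trans (sym h) e of λ ()
  union-rank (node _ _ (BC-⋃ t _ _ _ _ _ _ _)) e = t

  Disjunct : Node → ℕ → Subset 2ω
  Disjunct (node _ γ (BC-one _ _))            j x = x ∈ N 2ω (γ (suc j))
  Disjunct (node _ _ (BC-⋃ _ _ _ _ _ _ _ d)) j x = ¬ x ∈ ρ 2ω (d j)

  Disjunct-ρ : ∀ M x → x ∈ ρ 2ω (der M) ⇔ (∃[ j ] Disjunct M j x)
  Disjunct-ρ (node _ _ (BC-one _ _))            x = mk⇔ (λ p → p) (λ p → p)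
  Disjunct-ρ (node _ _ (BC-⋃ _ _ _ _ _ _ _ _)) x = mk⇔ (λ p → p) (λ p → p)

  Disjunct-resp : ∀ M j {x y} → x ≗ y → Disjunct M j x → Disjunct M j y
  Disjunct-resp (node _ γ (BC-one _ _))            j e m  = N-resp 2ω (γ (suc j)) e m
  Disjunct-resp (node _ _ (BC-⋃ _ _ _ _ _ _ _ d)) j e ¬m = λ m → ¬m (ρ-resp 2ω (d j) (λ n → sym (e n)) m)

  module Tree {ξ γ} (d : BC ξ γ) where

    root : Node
    root = node ξ γ d

    private
      -- The first argument is fuel, since the parent `π₀ n` of `suc n` is smaller but not
      -- structurally so.
      nodeWithin : ℕ → ℕ → Node
      nodeWithin _       zero    = root
      nodeWithin zero    (suc n) = root
      nodeWithin (suc f) (suc n) = childNode (nodeWithin f (π₀ n)) (π₁ n)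

      nodeWithin-≡ : ∀ f g s → s ℕ.≤ f → s ℕ.≤ g → nodeWithin f s ≡ nodeWithin g s
      nodeWithin-≡ f       g       zero    p         q         = refl
      nodeWithin-≡ (suc f) (suc g) (suc n) (ℕ.s≤s p) (ℕ.s≤s q) = cong (λ M → childNode M (π₁ n))
        (nodeWithin-≡ f g (π₀ n) (ℕₚ.≤-trans (π₀≤ n) p) (ℕₚ.≤-trans (π₀≤ n) q))

    nodeAt : ℕ → Node
    nodeAt s = nodeWithin s s

    nodeAt-suc : ∀ n → nodeAt (suc n) ≡ childNode (nodeAt (π₀ n)) (π₁ n)
    nodeAt-suc n = cong (λ M → childNode M (π₁ n)) (nodeWithin-≡ n (π₀ n) (π₀ n) (π₀≤ n) ℕₚ.≤-refl)

    nodeAt-child : ∀ s j → nodeAt (child s j) ≡ childNode (nodeAt s) j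
    nodeAt-child s j = trans (nodeAt-suc (pair s j))
      (cong₂ (λ n i → childNode (nodeAt n) i) (π₀-pair s j) (π₁-pair s j))

    tree-induction : (P : ℕ → Set) → P 0 → (∀ n → P (π₀ n) → P (suc n)) → ∀ s → P s
    tree-induction P base step s = go s s ℕₚ.≤-refl
      where
      go : ∀ f s → s ℕ.≤ f → P s
      go f       zero    _         = base
      go (suc f) (suc n) (ℕ.s≤s l) = step n (go f (π₀ n) (ℕₚ.≤-trans (π₀≤ n) l))

    names : ∀ s → Names γ s (code (nodeAt s))
    names = tree-induction (λ s → Names γ s (code (nodeAt s))) (Names-root γ) λ n h →
      subst (λ M → Names γ (suc n) (code M)) (sym (nodeAt-suc n)) (step n (nodeAt (π₀ n)) h)
      where
      step : ∀ n M → Names γ (π₀ n) (code M) → Names γ (suc n) (code (childNode M (π₁ n)))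
      step n (node _ _ (BC-one _ h))            = λ p → Names-leaf p h
      step n (node _ _ (BC-⋃ _ h _ _ g _ _ _)) = λ p → Names-union p h (g (π₁ n))

    Val⇔ : ∀ s {n v} → Val γ s n v ⇔ code (nodeAt s) n ≡ v
    Val⇔ s = Val-Names (names s)

    Contains : ℕ → Subset 2ω
    Contains s x = x ∈ ρ 2ω (der (nodeAt s))

    -- Tags 1 and 2 have the same meaning; they differ only in the shape of code that they announce.
    Den : ℕ → ℕ → Subset BX
    Den zero    K y = y ∈ N BX K
    Den (suc _) s y = ¬ Contains s (proj₁ y)

    ⟦_⟧ : ℕ → Subset BX
    ⟦ ℓ ⟧ = Den (π₀ ℓ) (π₁ ℓ)

    ⟦pair⟧ : ∀ t a {y} → y ∈ Den t a ⇔ y ∈ ⟦ pair t a ⟧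
    ⟦pair⟧ t a {y} = mk⇔ (subst (λ p → y ∈ Den (proj₁ p) (proj₂ p)) (sym (unpair-pair t a)))
                         (subst (λ p → y ∈ Den (proj₁ p) (proj₂ p)) (unpair-pair t a))

    Disj-sem : ∀ {n j ℓ} → Disj γ n j ℓ → ∀ {y} → Disjunct (nodeAt n) j (proj₁ y) ⇔ y ∈ ⟦ ℓ ⟧
    Disj-sem {n} {j} {ℓ} D {y} = by-cases (nodeAt n) refl D
      where
      whole-box : ∀ {v} → proj₁ y ∈ N 2ω v ⇔ y ∈ N BX (pair v whole)
      whole-box {v} = mk⇔ (λ m → out (box {2ω} {ω} (inn m) (inn (whole-all (proj₂ y)))))
                          (λ m → out (proj₁ (unbox {2ω} {ω} {v} {whole} (inn m))))
      by-cases : ∀ M → nodeAt n ≡ M → Disj γ n j ℓ → Disjunct M j (proj₁ y) ⇔ y ∈ ⟦ ℓ ⟧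
      by-cases (node _ c (BC-one _ h)) e (inj₁ (_ , v , val , refl)) =
        subst (λ k → proj₁ y ∈ N 2ω k ⇔ y ∈ N BX (pair v whole)) v≡ whole-box ⟫ ⟦pair⟧ 0 (pair v whole)
        where
        v≡ : v ≡ c (suc j)
        v≡ = trans (sym (to (Val⇔ n) val)) (cong (λ M → code M (suc j)) e)
      by-cases (node _ _ (BC-one _ h)) e (inj₂ (val , _)) =
        case trans (sym h) (trans (cong (λ M → code M 0) (sym e)) (to (Val⇔ n) val)) of λ ()
      by-cases (node _ _ (BC-⋃ _ h _ _ _ _ _ _)) e (inj₁ (val , _)) =
        case trans (sym h) (trans (cong (λ M → code M 0) (sym e)) (to (Val⇔ n) val)) of λ ()
      by-cases (node _ _ (BC-⋃ two≤ h δ η g 1≤ <ξ ds)) e (inj₂ (_ , D)) = by-kind D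
        where
        same : (¬ proj₁ y ∈ ρ 2ω (ds j)) ⇔ (¬ Contains (child n j) (proj₁ y))
        same = subst (λ M → (¬ proj₁ y ∈ ρ 2ω (ds j)) ⇔ (¬ proj₁ y ∈ ρ 2ω (der M)))
                     (sym (trans (nodeAt-child n j) (cong (λ M → childNode M j) e))) (mk⇔ (λ p → p) (λ p → p))
        by-kind : Val γ (child n j) 0 0 × ℓ ≡ pair 1 (child n j) ⊎ Val γ (child n j) 0 1 × ℓ ≡ pair 2 (child n j) →
                  (¬ proj₁ y ∈ ρ 2ω (ds j)) ⇔ y ∈ ⟦ ℓ ⟧
        by-kind (inj₁ (_ , refl)) = same ⟫ ⟦pair⟧ 1 (child n j)
        by-kind (inj₂ (_ , refl)) = same ⟫ ⟦pair⟧ 2 (child n j)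

    Disj-total : ∀ n j → ∃[ ℓ ] Disj γ n j ℓ
    Disj-total n j with head (nodeAt n)
    ... | leaf h = _ , inj₁ (from (Val⇔ n) h , _ , from (Val⇔ n) refl , refl)
    ... | union h with head (nodeAt (child n j))
    ...   | leaf h′  = _ , inj₂ (from (Val⇔ n) h , inj₁ (from (Val⇔ (child n j)) h′ , refl))
    ...   | union h′ = _ , inj₂ (from (Val⇔ n) h , inj₂ (from (Val⇔ (child n j)) h′ , refl))

    Val-01 : ∀ {s} {A : Set} → Val γ s 0 0 → Val γ s 0 1 → A
    Val-01 {s} p q = case trans (sym (to (Val⇔ s) p)) (to (Val⇔ s) q) of λ ()

    Den-¬R : ∀ {t s y} → t ≢ 0 → y ∈ Den t s ⇔ (¬ Contains s (proj₁ y))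
    Den-¬R {zero}  t≢0 = contradiction refl t≢0
    Den-¬R {suc t} _   = mk⇔ (λ p → p) (λ p → p)

    Den-0 : ∀ {t K y} → t ≡ 0 → y ∈ Den t K ⇔ y ∈ N BX K
    Den-0 refl = mk⇔ (λ p → p) (λ p → p)

    refuter-excludes : ∀ ℓ ℓ′ {y} → Refutes γ ℓ ℓ′ → y ∈ ⟦ ℓ′ ⟧ → ¬ y ∈ ⟦ ℓ ⟧
    refuter-excludes ℓ ℓ′ {y} (inj₁ (t≡0 , t′≡0 , q , i , e , l , ne)) m′ m =
      ne (to (mem-correct BX q i (π₁ ℓ) (subst (λ k → y ∈ N BX k) e (to (Den-0 t′≡0) m′)) l) (to (Den-0 t≡0) m))
    refuter-excludes ℓ ℓ′ {y} (inj₂ (t≢0 , j , D)) m′ m =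
      to (Den-¬R t≢0) m (from (Disjunct-ρ (nodeAt (π₁ ℓ)) (proj₁ y)) (j , from (Disj-sem D {y}) m′))

    -- With `refuter-excludes` this writes the complement of a literal as a union of literals: small
    -- boxes separate y from a box, and a point of ρ lies in some disjunct.
    refuter-exists : ∀ ℓ {y} → ¬ y ∈ ⟦ ℓ ⟧ → ∃[ ℓ′ ] Refutes γ ℓ ℓ′ × y ∈ ⟦ ℓ′ ⟧
    refuter-exists ℓ {y} ¬m with π₀ ℓ ℕ.≟ 0
    ... | yes t≡0 = let i , m = ct-covers BX (π₁ ℓ) y in
      pair 0 (ct BX (π₁ ℓ) i) ,
      inj₁ (t≡0 , π₀-pair 0 _ , π₁ ℓ , i , π₁-pair 0 _ , ℕₚ.≤-refl ,
        λ e → ¬m (from (Den-0 t≡0) (from (mem-correct BX (π₁ ℓ) i (π₁ ℓ) m ℕₚ.≤-refl) e))) ,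
      to (⟦pair⟧ 0 _) m
    ... | no t≢0 =
      let j , Dj  = to (Disjunct-ρ (nodeAt (π₁ ℓ)) (proj₁ y)) (dne (λ ¬r → ¬m (from (Den-¬R t≢0) ¬r)))
          ℓ′ , D = Disj-total (π₁ ℓ) j
      in ℓ′ , inj₂ (t≢0 , j , D) , to (Disj-sem D {y}) Dj

    Closed : ℕ → Set
    Closed ℓ = π₀ ℓ ≡ 0 ⊎ π₀ ℓ ≡ 1 × Val γ (π₁ ℓ) 0 0

    -- Boxes are refuted by boxes, and the disjuncts of a leaf are boxes; so the complement of an
    -- intersection of such literals is open, as `¬All-Refuted` records.
    refuter-open : ∀ ℓ ℓ′ → Closed ℓ → Refutes γ ℓ ℓ′ → π₀ ℓ′ ≡ 0
    refuter-open ℓ ℓ′ c              (inj₁ (_ , e , _))                       = e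
    refuter-open ℓ ℓ′ (inj₁ e)       (inj₂ (ne , _))                          = contradiction e ne
    refuter-open ℓ ℓ′ (inj₂ (_ , p)) (inj₂ (_ , _ , inj₁ (_ , _ , _ , refl))) = π₀-pair 0 _
    refuter-open ℓ ℓ′ (inj₂ (_ , p)) (inj₂ (_ , _ , inj₂ (q , _)))            = Val-01 p q

    All : ℕ → Subset BX
    All c y = ∀ ℓ → Mem ℓ (π₁ c) → y ∈ ⟦ ℓ ⟧

    Mem-single : ∀ {ℓ ℓ′} → Mem ℓ (π₁ (single ℓ′)) ⇔ ℓ ≡ ℓ′
    Mem-single {ℓ} {ℓ′} = mk⇔ (λ (i , l , e) → trans (sym e) (entry i l))
                              λ e → 0 , subst (0 ℕ.<_) (sym length-1) (ℕ.s≤s ℕ.z≤n) , trans (first refl) (sym e)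
      where
      body : π₁ (single ℓ′) ≡ pair 1 (pair ℓ′ 0)
      body = π₁-pair _ _
      length-1 : π₀ (π₁ (single ℓ′)) ≡ 1
      length-1 = trans (cong π₀ body) (π₀-pair 1 _)
      first : ∀ {i} → i ≡ 0 → seq (π₁ (π₁ (single ℓ′))) i ≡ ℓ′
      first refl = trans (cong (π₀ ∘ π₁) body) (trans (cong π₀ (π₁-pair 1 _)) (π₀-pair ℓ′ 0))
      entry : ∀ i → i ℕ.< π₀ (π₁ (single ℓ′)) → seq (π₁ (π₁ (single ℓ′))) i ≡ ℓ′
      entry i l = first (ℕₚ.n<1⇒n≡0 (subst (i ℕ.<_) length-1 l))

    All-single : ∀ ℓ {y} → All (single ℓ) y ⇔ y ∈ ⟦ ℓ ⟧
    All-single ℓ {y} = mk⇔ (λ h → h ℓ (from Mem-single refl))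
                             (λ m ℓ′ p → subst (λ k → y ∈ ⟦ k ⟧) (sym (to Mem-single p)) m)

    record ComplementCode (η : Ord) (c : ℕ) : Set where
      constructor _,_
      field
        code : BC η (complement (γ , c))
        sem  : ∀ y → y ∈ ρ BX code ⇔ (¬ All c y)

    fromΣ : ∀ {η c} → (Σ (BC η (complement (γ , c))) λ d → ∀ y → y ∈ ρ BX d ⇔ (¬ All c y)) → ComplementCode η c
    fromΣ (d , h) = d , h

    ¬All-Refuted : ∀ c → (∀ ℓ → Mem ℓ (π₁ c) → Closed ℓ) → ∀ y → Refuted ((γ , c) , y) ⇔ (¬ All c y)
    ¬All-Refuted c closed y = mk⇔
      (λ (ℓ , K , mem , ref , m) all → refuter-excludes ℓ (pair 0 K) ref (to (⟦pair⟧ 0 K) m) (all ℓ mem))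
      λ ¬all → let ℓ , ¬h   = ¬∀⇒∃¬ ¬all
                   mem , ¬m = ¬→ ¬h
                   ℓ′ , ref , m = refuter-exists ℓ ¬m
                   t≡0      = refuter-open ℓ ℓ′ (closed ℓ mem) ref
                   ℓ′≡      = trans (sym (pair-unpair ℓ′)) (cong (λ t → pair t (π₁ ℓ′)) t≡0)
               in ℓ , π₁ ℓ′ , mem , subst (Refutes γ ℓ) ℓ′≡ ref , to (Den-0 t≡0) m

    open-complement : ∀ {c} → π₀ c ≡ 0 → (∀ ℓ → Mem ℓ (π₁ c) → Closed ℓ) → ComplementCode one c
    open-complement {c} h closed = fromΣ (subst (λ δ → Σ (BC one δ) λ d → ∀ y → y ∈ ρ BX d ⇔ (¬ All c y))
      (sym (cong (λ h → choose h (0 ◂ refuted (γ , c)) (1 ◂ S (ωω ⊗ ω) (ω ⊗ ω) (self , (γ , c)))) h))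
      (BC-one (≤-refl , ≤-refl) refl , λ y → ⇔-sym (refuted-spec (γ , c) y) ⟫ ¬All-Refuted c closed y))

    -- The padding certificate denotes the empty set, so its complement code is a leaf and adds
    -- nothing to a union of complements.
    dummy : ComplementCode one (single (pair 0 0))
    dummy = open-complement (trans (π₀-pair _ _) (cong ℕ.pred (π₀-pair 0 0)))
                            (λ ℓ p → inj₁ (trans (cong π₀ (to Mem-single p)) (π₀-pair 0 0)))

    ¬All-dummy : ∀ {y} → ¬ All (single (pair 0 0)) y
    ¬All-dummy all = N-zero BX (from (⟦pair⟧ 0 0) (to (All-single (pair 0 0)) all))

    closed-literal : ∀ ℓ → Closed ℓ → ComplementCode one (single ℓ)
    closed-literal ℓ c = open-complement (trans (π₀-pair _ _) (tag c))
                                           λ ℓ′ p → subst Closed (sym (to Mem-single p)) c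
      where
      tag : Closed ℓ → ℕ.pred (π₀ ℓ) ≡ 0
      tag (inj₁ e)       = cong ℕ.pred e
      tag (inj₂ (e , _)) = cong ℕ.pred e

    orDummy-cases : ∀ n → orDummy n ≡ single (pair 0 0) ⊎ n ≡ suc (orDummy n)
    orDummy-cases zero    = inj₁ refl
    orDummy-cases (suc n) = inj₂ refl

    BoundedCode : Ord → ℕ → Set
    BoundedCode ζ c = ∃[ η ] one ≤ η × η < ζ × ComplementCode η c

    -- A point fails the certificate iff it lies in a refuter of one of its literals, and each
    -- refuter ℓ′ is the complement of what the code for `single ℓ′` denotes. So only these codes
    -- have to lie below ζ.
    union-complement : ∀ {ζ c} → two ≤ ζ → π₀ c ≡ 1 →
      (∀ ℓ ℓ′ → Mem ℓ (π₁ c) → Refutes γ ℓ ℓ′ → BoundedCode ζ (single ℓ′)) → ComplementCode ζ c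
    union-complement {ζ} {c} two≤ζ h refuterCode =
      fromΣ (subst (λ δ → Σ (BC ζ δ) λ d → ∀ y → y ∈ ρ BX d ⇔ (¬ All c y))
        (sym (cong (λ h → choose h (0 ◂ refuted (γ , c)) (1 ◂ S (ωω ⊗ ω) (ω ⊗ ω) (self , (γ , c)))) h))
        ( BC-⋃ two≤ζ refl _ (λ i → proj₁ (kid i)) (complement-steps (γ , c))
            (λ i → proj₁ (proj₂ (kid i))) (λ i → proj₁ (proj₂ (proj₂ (kid i)))) (λ i → ComplementCode.code (kid-code i))
        , λ y → mk⇔ (λ (i , ¬m) → sound y i (dne λ ¬all → ¬m (from (kid-sem i y) ¬all)))
                    (λ ¬all → let i , all = complete y ¬all in i , λ m → to (kid-sem i y) m all) ))
      where
      stepTo : ℕ → ℕ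
      stepTo i = orDummy (steps (γ , c) i)
      step-cases : ∀ i → stepTo i ≡ single (pair 0 0) ⊎ Step ((γ , c) , stepTo i)
      step-cases i = Sum.map₂ (λ e → from (steps-spec (γ , c) (stepTo i)) (i , e)) (orDummy-cases (steps (γ , c) i))
      kid : ∀ i → BoundedCode ζ (stepTo i)
      kid i = by-cases (step-cases i)
        where
        by-cases : ∀ {c′} → c′ ≡ single (pair 0 0) ⊎ Step ((γ , c) , c′) → BoundedCode ζ c′
        by-cases (inj₁ refl) = one , ≤-refl , two≤ζ , dummy
        by-cases (inj₂ (ℓ , ℓ′ , mem , ref , refl)) = refuterCode ℓ ℓ′ mem ref
      kid-code : ∀ i → ComplementCode (proj₁ (kid i)) (stepTo i)
      kid-code i = proj₂ (proj₂ (proj₂ (kid i)))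
      kid-sem : ∀ i y → y ∈ ρ BX (ComplementCode.code (kid-code i)) ⇔ (¬ All (stepTo i) y)
      kid-sem i = ComplementCode.sem (kid-code i)
      sound : ∀ y i → All (stepTo i) y → ¬ All c y
      sound y i = by-cases (step-cases i)
        where
        by-cases : ∀ {c′} → c′ ≡ single (pair 0 0) ⊎ Step ((γ , c) , c′) → All c′ y → ¬ All c y
        by-cases (inj₁ refl) all = contradiction all ¬All-dummy
        by-cases (inj₂ (ℓ , ℓ′ , mem , ref , refl)) all all′ =
          refuter-excludes ℓ ℓ′ ref (to (All-single ℓ′) all) (all′ ℓ mem)
      complete : ∀ y → ¬ All c y → ∃[ i ] All (stepTo i) y
      complete y ¬all =
        let ℓ , ¬h       = ¬∀⇒∃¬ ¬all
            mem , ¬m     = ¬→ ¬h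
            ℓ′ , ref , m = refuter-exists ℓ ¬m
            i , e        = to (steps-spec (γ , c) (single ℓ′)) (ℓ , ℓ′ , mem , ref , refl)
        in i , subst (λ n → All (orDummy n) y) (sym e) (from (All-single ℓ′) m)

    UnionLiteral : Node → ℕ → Set
    UnionLiteral M ℓ = π₀ ℓ ≡ 2 × nodeAt (π₁ ℓ) ≡ M

    -- The complement of a union literal is ρ of the code at its node, and the self-referential code
    -- unfolds in step with that code: a disjunct for each child. Induction on the derivation
    -- therefore gives it the same rank η.
    union-literal : ∀ {η δ} (e : BC η δ) → δ 0 ≡ 1 → ∀ ℓ → UnionLiteral (node η δ e) ℓ → ComplementCode η (single ℓ)
    refuter-code : ∀ {η δ} (e : BC η δ) → δ 0 ≡ 1 → ∀ ℓ ℓ′ → UnionLiteral (node η δ e) ℓ → Refutes γ ℓ ℓ′ →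
                   BoundedCode η (single ℓ′)

    union-literal {η} {δ} e h ℓ lit = union-complement (union-rank (node η δ e) h)
      (trans (π₀-pair _ _) (cong ℕ.pred (proj₁ lit)))
      λ ℓ₁ ℓ′ mem ref → refuter-code e h ℓ ℓ′ lit (subst (λ k → Refutes γ k ℓ′) (to Mem-single mem) ref)

    refuter-code (BC-one _ h′) h ℓ ℓ′ lit ref = case trans (sym h′) h of λ ()
    refuter-code (BC-⋃ _ _ _ _ _ _ _ _) h ℓ ℓ′ (t , _) (inj₁ (t≡0 , _)) = case trans (sym t) t≡0 of λ ()
    refuter-code (BC-⋃ _ _ _ _ _ _ _ _) h ℓ ℓ′ (_ , e) (inj₂ (_ , _ , inj₁ (val , _))) =
      case trans (sym (to (Val⇔ (π₁ ℓ)) val)) (trans (cong (λ M → code M 0) e) h) of λ ()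
    refuter-code (BC-⋃ two≤ _ _ _ _ _ _ _) h ℓ ℓ′ (_ , e) (inj₂ (_ , j , inj₂ (_ , inj₁ (val , refl)))) =
      one , ≤-refl , two≤ , closed-literal _ (inj₂ (π₀-pair 1 _ , subst (λ s → Val γ s 0 0) (sym (π₁-pair 1 _)) val))
    refuter-code (BC-⋃ _ _ δ η _ 1≤ <ξ ds) h ℓ ℓ′ (_ , e) (inj₂ (_ , j , inj₂ (_ , inj₂ (val , refl)))) =
      η j , 1≤ j , <ξ j , union-literal (ds j) head-child _
        (π₀-pair 2 _ , trans (cong nodeAt (π₁-pair 2 _)) at-child)
      where
      at-child : nodeAt (child (π₁ ℓ) j) ≡ node (η j) (δ j) (ds j)
      at-child = trans (nodeAt-child (π₁ ℓ) j) (cong (λ M → childNode M j) e)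
      head-child : δ j 0 ≡ 1
      head-child = trans (cong (λ M → code M 0) (sym at-child)) (to (Val⇔ (child (π₁ ℓ) j)) val)

  -- Correct witness values

  Correct : Node → ℕ → Subset 2ω
  Correct M v x = v ≡ 0 × ¬ x ∈ ρ 2ω (der M) ⊎
    ∃[ j ] v ≡ suc j × Disjunct M j x × (∀ k → k ℕ.< j → ¬ Disjunct M k x)

  Correct-0 : ∀ M {v x} → Correct M v x → v ≡ 0 ⇔ (¬ x ∈ ρ 2ω (der M))
  Correct-0 M (inj₁ (e , ¬m))           = mk⇔ (λ _ → ¬m) (λ _ → e)
  Correct-0 M {x = x} (inj₂ (j , e , D , _)) = mk⇔ (λ e′ → case trans (sym e) e′ of λ ())
                                            (λ ¬m → contradiction (from (Disjunct-ρ M x) (j , D)) ¬m)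

  Correct-exists : ∀ M x → ∃[ v ] Correct M v x
  Correct-exists M x with em {x ∈ ρ 2ω (der M)}
  ... | no ¬m = 0 , inj₁ (refl , ¬m)
  ... | yes m = let j , D , h = least (λ j → Disjunct M j x) (to (Disjunct-ρ M x) m) in suc j , inj₂ (j , refl , D , h)

  Correct-unique : ∀ M {v v′ x} → Correct M v x → Correct M v′ x → v ≡ v′
  Correct-unique M p@(inj₁ (e , ¬m)) q = trans e (sym (from (Correct-0 M q) ¬m))
  Correct-unique M p@(inj₂ _) q@(inj₁ (e , ¬m)) = trans (from (Correct-0 M p) ¬m) (sym e)
  Correct-unique M (inj₂ (j , e , D , h)) (inj₂ (j′ , e′ , D′ , h′)) with ℕₚ.<-cmp j j′
  ... | tri< l _ _    = contradiction D (h′ j l)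
  ... | tri≈ _ refl _ = trans e (sym e′)
  ... | tri> _ _ l    = contradiction D′ (h j′ l)

  Correct-resp : ∀ M {v x y} → x ≗ y → Correct M v x → Correct M v y
  Correct-resp M e (inj₁ (v≡0 , ¬m)) = inj₁ (v≡0 , λ m → ¬m (ρ-resp 2ω (der M) (λ n → sym (e n)) m))
  Correct-resp M e (inj₂ (j , v≡ , D , h)) = inj₂ (j , v≡ , Disjunct-resp M j e D ,
    λ k l D′ → h k l (Disjunct-resp M k (λ n → sym (e n)) D′))

  unbit-bit : ∀ n → unbit (bit n) ≡ sgn n
  unbit-bit zero    = refl
  unbit-bit (suc _) = refl

  -- Finite lists of literals

  entries : List ℕ → ℕ
  entries []      = 0
  entries (a ∷ L) = pair a (entries L)

  listCode : List ℕ → ℕ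
  listCode L = pair (length L) (entries L)

  Mem-listCode : ∀ {ℓ} L → Mem ℓ (listCode L) ⇔ ℓ List.∈ L
  Mem-listCode {ℓ} L = mk⇔
    (λ (i , l , e) → to′ L i (subst (i ℕ.<_) (π₀-pair _ _) l) (trans (cong (λ v → seq v i) (sym (π₁-pair _ _))) e))
    (λ p → let i , l , e = from′ L p in
      i , subst (i ℕ.<_) (sym (π₀-pair _ _)) l , trans (cong (λ v → seq v i) (π₁-pair _ _)) e)
    where
    to′ : ∀ L i → i ℕ.< length L → seq (entries L) i ≡ ℓ → ℓ List.∈ L
    to′ (a ∷ L) zero    _         e = here (trans (sym e) (π₀-pair a _))
    to′ (a ∷ L) (suc i) (ℕ.s≤s l) e = there (to′ L i l (trans (cong (λ v → seq v i) (sym (π₁-pair a _))) e))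
    from′ : ∀ L → ℓ List.∈ L → ∃[ i ] i ℕ.< length L × seq (entries L) i ≡ ℓ
    from′ (a ∷ L) (here refl) = 0 , ℕ.s≤s ℕ.z≤n , π₀-pair a _
    from′ (a ∷ L) (there p) = let i , l , e = from′ L p in
      suc i , ℕ.s≤s l , trans (cong (λ v → seq v i) (π₁-pair a _)) e

  module _ (Good : ℕ → Set) where

    AllGood : List ℕ → Set
    AllGood L = ∀ {ℓ} → ℓ List.∈ L → Good ℓ

    good-++ : ∀ L {L′} → AllGood L → AllGood L′ → AllGood (L ++ L′)
    good-++ L g g′ p = Sum.[ g , g′ ] (∈-++⁻ L p)

    -- Requirements that survive enlarging the list are met simultaneously by concatenation.
    gather : (Φ : ℕ → List ℕ → Set) →
             (∀ n {L L′} → (∀ {ℓ} → ℓ List.∈ L → ℓ List.∈ L′) → Φ n L → Φ n L′) →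
             ∀ l → (∀ n → n ℕ.< l → ∃[ L ] AllGood L × Φ n L) →
             ∃[ L ] AllGood L × (∀ n → n ℕ.< l → Φ n L)
    gather Φ mono zero    h = [] , (λ ()) , λ _ ()
    gather Φ mono (suc l) h =
      let L  , g  , φ  = gather Φ mono l (λ n n<l → h n (ℕₚ.m≤n⇒m≤1+n n<l))
          L′ , g′ , φ′ = h l ℕₚ.≤-refl
      in L ++ L′ , good-++ L g g′ , λ n n≤l → case ℕₚ.m≤n⇒m<n∨m≡n (ℕ.s≤s⁻¹ n≤l) of λ
        { (inj₁ n<l)  → mono n ∈-++⁺ˡ (φ n n<l)
        ; (inj₂ refl) → mono n (∈-++⁺ʳ L) φ′ }

  Fixes-mono : ∀ {γ D D′ n v} → (∀ ℓ → Mem ℓ D → Mem ℓ D′) → Fixes γ D n v → Fixes γ D′ n v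
  Fixes-mono {n = n} h ((a , k , mem , e) , w) = (a , k , h _ mem , e) , Sum.map
    (λ (e , r) → e , Sum.map₂ (Sum.map₂ (Sum.map (h _) (h _))) r)
    (λ (j , e , (ℓ , mem , D) , r) → j , e , (ℓ , h ℓ mem , D) ,
      λ k l → let ℓ , ℓ′ , D , mem , ref = r k l in ℓ , ℓ′ , D , h ℓ′ mem , ref) w

  -- Ranks of certificates

  module Lifting {ξ γ} (d : BC ξ γ) where
    open Tree d

    -- All ancestors of a union node are unions, because leaves are their own children; so ranks
    -- drop at every step from the root.
    rank-bound : ∀ {μ} → (∀ {η} → η < ξ → η ≤ μ) → ∀ s → s ≢ 0 → code (nodeAt s) 0 ≡ 1 → rank (nodeAt s) ≤ μ
    rank-bound {μ} h = tree-induction _ (λ ne → contradiction refl ne) step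
      where
      step : ∀ n → (π₀ n ≢ 0 → code (nodeAt (π₀ n)) 0 ≡ 1 → rank (nodeAt (π₀ n)) ≤ μ) →
             suc n ≢ 0 → code (nodeAt (suc n)) 0 ≡ 1 → rank (nodeAt (suc n)) ≤ μ
      step n ih _ e rewrite nodeAt-suc n with childNode-rank (nodeAt (π₀ n)) (π₁ n) e | π₀ n ℕ.≟ 0
      ... | e′ , l | no ne   = <⇒≤ (≤-trans l (ih ne e′))
      ... | e′ , l | yes eq = h (subst (λ s → rank (childNode (nodeAt (π₀ n)) (π₁ n)) < rank (nodeAt s)) eq l)

    rank-bound-deep : ∀ {μ} → (∀ {η} → η < ξ → η ≤ μ) → ∀ s → Deep s → code (nodeAt s) 0 ≡ 1 → rank (nodeAt s) < μ
    rank-bound-deep h s (n , refl , ne) e rewrite nodeAt-suc n with childNode-rank (nodeAt (π₀ n)) (π₁ n) e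
    ... | e′ , l = ≤-trans l (rank-bound h (π₀ n) ne e′)

    -- With flag 0 all literals are closed and rank 1 will do. With flag 1 the rank is the bound ζ
    -- of the ranks of the union literals, counting 1 for the others: a union literal gives ζ ≥ 2,
    -- its refuters have codes below its own rank, and the refuters of boxes and leaves have rank 1.
    cert-code : ∀ {μ} → two ≤ μ → (∀ {η} → η < ξ → η ≤ μ) → ∀ c → Cert (γ , c) → BoundedCode μ c
    cert-code {μ} two≤μ h c (headed , valid , _) = by-head headed
      where
      memValid : ∀ ℓ → Mem ℓ (π₁ c) → Valid γ ℓ
      memValid ℓ (i , l , e) = subst (Valid γ) e (valid i l)
      rk : ℕ → ℕ → Ord
      rk 2 s = rank (nodeAt s)
      rk _ _ = one
      rk-2 : ∀ {t s} → t ≡ 2 → rk t s ≡ rank (nodeAt s)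
      rk-2 refl = refl
      rk<μ : ∀ t s → (t ≡ 0 ⊎ t ≡ 1 × Val γ s 0 0 ⊎ t ≡ 2 × Val γ s 0 1 × Deep s) → rk t s < μ
      rk<μ _ s (inj₁ refl)                         = two≤μ
      rk<μ _ s (inj₂ (inj₁ (refl , _)))            = two≤μ
      rk<μ _ s (inj₂ (inj₂ (refl , val , deep))) = rank-bound-deep h s deep (to (Val⇔ s) val)
      rkOf : ℕ → Ord
      rkOf ℓ = rk (π₀ ℓ) (π₁ ℓ)
      by-head : Headed (π₀ c) (π₁ c) → BoundedCode μ c
      by-head (inj₁ (e , no2)) = one , ≤-refl , two≤μ , open-complement e λ ℓ mem → closed ℓ mem (memValid ℓ mem)
        where
        closed : ∀ ℓ → Mem ℓ (π₁ c) → Valid γ ℓ → Closed ℓ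
        closed ℓ _            (inj₁ t)                 = inj₁ t
        closed ℓ _            (inj₂ (inj₁ p))          = inj₂ p
        closed ℓ (i , l , e) (inj₂ (inj₂ (t , _))) = contradiction (trans (cong π₀ e) t) (no2 i l)
      by-head (inj₂ (e , ℓ₀ , mem₀ , t₀)) = ζ , <⇒≤ two≤ζ , ζ<μ ,
        union-complement two≤ζ e λ ℓ ℓ′ mem ref → refuterCode ℓ ℓ′ mem ref (memValid ℓ mem)
        where
        bounded = finite-bound (<⇒≤ two≤μ) (λ i → rkOf (seq (π₁ (π₁ c)) i)) (π₀ (π₁ c))
                    (λ i l → rk<μ _ _ (valid i l))
        ζ = proj₁ bounded
        ζ<μ = proj₁ (proj₂ bounded)
        rk≤ζ : ∀ ℓ → Mem ℓ (π₁ c) → rkOf ℓ ≤ ζ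
        rk≤ζ ℓ (i , l , e) = subst (λ ℓ → rkOf ℓ ≤ ζ) e (proj₂ (proj₂ bounded) i l)
        union-head : ∀ ℓ → π₀ ℓ ≡ 2 → Valid γ ℓ → code (nodeAt (π₁ ℓ)) 0 ≡ 1
        union-head ℓ t (inj₁ t′)                   = case trans (sym t) t′ of λ ()
        union-head ℓ t (inj₂ (inj₁ (t′ , _)))      = case trans (sym t) t′ of λ ()
        union-head ℓ t (inj₂ (inj₂ (_ , val , _))) = to (Val⇔ (π₁ ℓ)) val
        two≤ζ : two ≤ ζ
        two≤ζ = ≤-trans (union-rank (nodeAt (π₁ ℓ₀)) (union-head ℓ₀ t₀ (memValid ℓ₀ mem₀)))
                        (subst (_≤ ζ) (rk-2 t₀) (rk≤ζ ℓ₀ mem₀))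
        refuterCode : ∀ ℓ ℓ′ → Mem ℓ (π₁ c) → Refutes γ ℓ ℓ′ → Valid γ ℓ → BoundedCode ζ (single ℓ′)
        refuterCode ℓ ℓ′ mem ref (inj₁ t) =
          one , ≤-refl , two≤ζ , closed-literal ℓ′ (inj₁ (refuter-open ℓ ℓ′ (inj₁ t) ref))
        refuterCode ℓ ℓ′ mem ref (inj₂ (inj₁ p)) =
          one , ≤-refl , two≤ζ , closed-literal ℓ′ (inj₁ (refuter-open ℓ ℓ′ (inj₂ p) ref))
        refuterCode ℓ ℓ′ mem ref v@(inj₂ (inj₂ (t , _))) =
          let η , 1≤η , η< , coded = refuter-code (der (nodeAt (π₁ ℓ))) (union-head ℓ t v) ℓ ℓ′ (t , refl) ref
          in η , 1≤η , ≤-trans η< (subst (_≤ ζ) (rk-2 t) (rk≤ζ ℓ mem)) , coded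

    -- Points of C as correct witness functions

    Lifts : Pt ωω → Pt 2ω → Set
    Lifts z x = (∀ s → π₀ (z s) ≡ unbit (x s)) × (∀ s → Correct (nodeAt s) (wit z s) x)

    lift : Pt 2ω → Pt ωω
    lift x s = pair (unbit (x s)) (proj₁ (Correct-exists (nodeAt s) x))

    lift-Lifts : ∀ x → Lifts (lift x) x
    lift-Lifts x = (λ s → π₀-pair _ _) , λ s →
      subst (λ v → Correct (nodeAt s) v x) (sym (π₁-pair _ _)) (proj₂ (Correct-exists (nodeAt s) x))

    Lifts-unique : ∀ {z z′ x} → Lifts z x → Lifts z′ x → z ≗ z′
    Lifts-unique {z} {z′} (b , w) (b′ , w′) s = trans (sym (pair-unpair (z s)))
      (trans (cong₂ pair (trans (b s) (sym (b′ s))) (Correct-unique (nodeAt s) (w s) (w′ s))) (pair-unpair (z′ s)))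

    Lifts-pr : ∀ {z x} → Lifts z x → pr z ≗ x
    Lifts-pr {z} {x} (b , _) n = trans (cong bit (b n)) (bit-unbit (x n))

    Lifts-resp : ∀ {z x y} → x ≗ y → Lifts z x → Lifts z y
    Lifts-resp e (b , w) = (λ s → trans (b s) (cong unbit (e s))) , λ s → Correct-resp (nodeAt s) e (w s)

    module _ {z : Pt ωω} where

      record WitSem (s j : ℕ) : Set where
        field
          wit⁺ : Disjunct (nodeAt s) j (pr z) → Wit⁺ γ z s j
          wit⁻ : ¬ Disjunct (nodeAt s) j (pr z) → Wit⁻ γ z s j
          ⁺wit : Wit⁺ γ z s j → Disjunct (nodeAt s) j (pr z)
          ⁻wit : Wit⁻ γ z s j → ¬ Disjunct (nodeAt s) j (pr z)
      open WitSem public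

      -- At a union the local conditions speak of the witness of the child, so they have their
      -- meaning only if that witness is correct; at a leaf they speak of `pr z` itself.
      witSem : ∀ s j → (code (nodeAt s) 0 ≡ 1 → Correct (nodeAt (child s j)) (wit z (child s j)) (pr z)) → WitSem s j
      witSem s j ih = by-cases (nodeAt s) refl
        where
        by-cases : ∀ M → nodeAt s ≡ M → WitSem s j
        by-cases (node η δ (BC-one e₁ h)) e = record
          { wit⁺ = λ D → inj₁ (is0 , δ (suc j) , val , subst (λ M → Disjunct M j (pr z)) e D)
          ; wit⁻ = λ ¬D → inj₁ (is0 , δ (suc j) , val , λ m → ¬D (subst (λ M → Disjunct M j (pr z)) (sym e) m))
          ; ⁺wit = λ { (inj₁ (_ , v , val′ , m)) → back v val′ m ; (inj₂ (is1 , _)) → Val-01 is0 is1 }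
          ; ⁻wit = λ { (inj₁ (_ , v , val′ , ¬m)) D → ¬m (forth v val′ D) ; (inj₂ (is1 , _)) → Val-01 is0 is1 } }
          where
          is0 : Val γ s 0 0
          is0 = from (Val⇔ s) (trans (cong (λ M → code M 0) e) h)
          val : Val γ s (suc j) (δ (suc j))
          val = from (Val⇔ s) (cong (λ M → code M (suc j)) e)
          same : ∀ v → Val γ s (suc j) v → v ≡ δ (suc j)
          same v val′ = trans (sym (to (Val⇔ s) val′)) (cong (λ M → code M (suc j)) e)
          back : ∀ v → Val γ s (suc j) v → pr z ∈ N 2ω v → Disjunct (nodeAt s) j (pr z)
          back v val′ m = subst (λ M → Disjunct M j (pr z)) (sym e) (subst (λ k → pr z ∈ N 2ω k) (same v val′) m)
          forth : ∀ v → Val γ s (suc j) v → Disjunct (nodeAt s) j (pr z) → pr z ∈ N 2ω v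
          forth v val′ D = subst (λ k → pr z ∈ N 2ω k) (sym (same v val′)) (subst (λ M → Disjunct M j (pr z)) e D)
        by-cases (node η δ (BC-⋃ _ h _ _ _ _ _ ds)) e = record
          { wit⁺ = λ D → inj₂ (is1 , from zero⇔ (subst (λ M → Disjunct M j (pr z)) e D))
          ; wit⁻ = λ ¬D → inj₂ (is1 , λ w → ¬D (subst (λ M → Disjunct M j (pr z)) (sym e) (to zero⇔ w)))
          ; ⁺wit = λ { (inj₁ (is0 , _)) → Val-01 is0 is1
                     ; (inj₂ (_ , w)) → subst (λ M → Disjunct M j (pr z)) (sym e) (to zero⇔ w) }
          ; ⁻wit = λ { (inj₁ (is0 , _)) → Val-01 is0 is1
                     ; (inj₂ (_ , ¬w)) D → ¬w (from zero⇔ (subst (λ M → Disjunct M j (pr z)) e D)) } }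
          where
          at1 : code (nodeAt s) 0 ≡ 1
          at1 = trans (cong (λ M → code M 0) e) h
          is1 : Val γ s 0 1
          is1 = from (Val⇔ s) at1
          zero⇔ : wit z (child s j) ≡ 0 ⇔ (¬ pr z ∈ ρ 2ω (ds j))
          zero⇔ = Correct-0 (node _ _ (ds j)) {x = pr z} (subst (λ M → Correct M (wit z (child s j)) (pr z))
                    (trans (nodeAt-child s j) (cong (λ M → childNode M j) e)) (ih at1))

    -- Local conditions alone would admit false witnesses on an infinite branch of unions. Induction
    -- on the derivation, from the leaves upwards, makes every witness correct: this is where
    -- well-foundedness of the code is used.
    ¬Violation⇒Lifts : ∀ {z} → ¬ Violation (γ , z) → Lifts z (pr z) × ¬ Contains 0 (pr z)
    ¬Violation⇒Lifts {z} ok = (bits , correct) , to (Correct-0 root (correct 0)) root-wit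
      where
      bits : ∀ s → π₀ (z s) ≡ unbit (pr z s)
      bits s with π₀ (z s) in eq
      ... | 0           = refl
      ... | 1           = refl
      ... | suc (suc n) = contradiction (inj₁ (s , subst (1 ℕ.<_) (sym eq) (ℕ.s≤s (ℕ.s≤s ℕ.z≤n)))) ok
      root-wit : wit z 0 ≡ 0
      root-wit = dne λ ne → ok (inj₂ (inj₁ ne))
      local : ∀ s → (∀ j → WitSem {z} s j) → Correct (nodeAt s) (wit z s) (pr z)
      local s sem = by-value (wit z s) refl
        where
        by-value : ∀ v → wit z s ≡ v → Correct (nodeAt s) v (pr z)
        by-value zero    e = inj₁ (refl , λ m → let j , D = to (Disjunct-ρ (nodeAt s) (pr z)) m in
          ok (inj₂ (inj₂ (s , j , inj₁ (e , wit⁺ (sem j) D)))))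
        by-value (suc j) e = inj₂ (j , refl
          , dne (λ ¬D → ok (inj₂ (inj₂ (s , j , inj₂ (inj₁ (e , wit⁻ (sem j) ¬D))))))
          , λ k l D → ok (inj₂ (inj₂ (s , j , inj₂ (inj₂ (k , l , e , wit⁺ (sem k) D))))))
      correct′ : ∀ {η δ} (e : BC η δ) s → nodeAt s ≡ node η δ e → Correct (nodeAt s) (wit z s) (pr z)
      correct′ (BC-one _ h) s e = local s λ j → witSem s j λ e′ →
        case trans (sym (trans (cong (λ M → code M 0) e) h)) e′ of λ ()
      correct′ (BC-⋃ _ _ _ _ _ _ _ ds) s e = local s λ j → witSem s j λ _ →
        correct′ (ds j) (child s j) (trans (nodeAt-child s j) (cong (λ M → childNode M j) e))
      correct : ∀ s → Correct (nodeAt s) (wit z s) (pr z)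
      correct s = correct′ (der (nodeAt s)) s refl

    Lifts⇒¬Violation : ∀ {z} → Lifts z (pr z) → ¬ Contains 0 (pr z) → ¬ Violation (γ , z)
    Lifts⇒¬Violation {z} (b , w) ¬m = go
      where
      sem : ∀ s j → WitSem {z} s j
      sem s j = witSem s j λ _ → w (child s j)
      unbit≤1 : ∀ b → unbit b ℕ.≤ 1
      unbit≤1 false = ℕ.z≤n
      unbit≤1 true  = ℕ.s≤s ℕ.z≤n
      at : ∀ s {j} → wit z s ≡ suc j → Disjunct (nodeAt s) j (pr z) × (∀ k → k ℕ.< j → ¬ Disjunct (nodeAt s) k (pr z))
      at s e with w s
      ... | inj₁ (e′ , _) = case trans (sym e) e′ of λ ()
      ... | inj₂ (j , e′ , D , h) with trans (sym e) e′
      ...   | refl = D , h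
      go : ¬ Violation (γ , z)
      go (inj₁ (s , l)) = ℕₚ.<⇒≱ l (subst (ℕ._≤ 1) (sym (b s)) (unbit≤1 (pr z s)))
      go (inj₂ (inj₁ ne)) = ne (from (Correct-0 root (w 0)) ¬m)
      go (inj₂ (inj₂ (s , j , inj₁ (e , W)))) =
        to (Correct-0 (nodeAt s) (w s)) e (from (Disjunct-ρ (nodeAt s) (pr z)) (j , ⁺wit (sem s j) W))
      go (inj₂ (inj₂ (s , j , inj₂ (inj₁ (e , W))))) = ⁻wit (sem s j) W (proj₁ (at s e))
      go (inj₂ (inj₂ (s , j , inj₂ (inj₂ (k , l , e , W))))) = proj₂ (at s e) k l (⁺wit (sem s k) W)

  -- Soundness and completeness of certificates

  module Certificates {ξ γ} (d : BC ξ γ) where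
    open Tree d
    open Lifting d

    root-leaf : γ 0 ≡ 0 → ∀ s → nodeAt s ≡ root
    root-leaf h = tree-induction (λ s → nodeAt s ≡ root) refl λ n e →
      trans (nodeAt-suc n) (trans (cong (λ M → childNode M (π₁ n)) e) (childNode-leaf root (π₁ n) h))

    -- The root denotes the union of the complements of its children. Hence a point of B makes every
    -- literal about a node of depth 1 false, and no rank of depth 1 is ever charged.
    Contains-child : ∀ {x} → γ 0 ≡ 1 → ¬ Contains 0 x → ∀ n → π₀ n ≡ 0 → Contains (suc n) x
    Contains-child {x} h ¬m n e = subst (λ M → x ∈ ρ 2ω (der M))
      (sym (trans (nodeAt-suc n) (cong (λ s → childNode (nodeAt s) (π₁ n)) e)))
      (child-of root h (π₁ n) ¬m)
      where
      child-of : ∀ M → code M 0 ≡ 1 → ∀ j → ¬ x ∈ ρ 2ω (der M) → x ∈ ρ 2ω (der (childNode M j))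
      child-of (node _ _ (BC-one _ h′)) h j ¬m = case trans (sym h′) h of λ ()
      child-of (node _ _ (BC-⋃ _ _ _ _ _ _ _ ds)) h j ¬m = dne λ ¬m′ → ¬m (j , ¬m′)

    Disj-index : ∀ {n j ℓ} → Disj γ n j ℓ → π₀ ℓ ≡ 0 ⊎ π₀ ℓ ≢ 0 × π₁ ℓ ≢ 0 × Val γ n 0 1
    Disj-index (inj₁ (_ , _ , _ , refl)) = inj₁ (π₀-pair 0 _)
    Disj-index (inj₂ (val , inj₁ (_ , refl))) = inj₂
      ((λ e → case trans (sym (π₀-pair 1 _)) e of λ ()) , (λ e → case trans (sym (π₁-pair 1 _)) e of λ ()) , val)
    Disj-index (inj₂ (val , inj₂ (_ , refl))) = inj₂
      ((λ e → case trans (sym (π₀-pair 2 _)) e of λ ()) , (λ e → case trans (sym (π₁-pair 2 _)) e of λ ()) , val)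

    Disj-valid : ∀ {n j ℓ} → n ≢ 0 → Disj γ n j ℓ → Valid γ ℓ
    Disj-valid ne (inj₁ (_ , _ , _ , refl)) = inj₁ (π₀-pair 0 _)
    Disj-valid ne (inj₂ (_ , inj₁ (val , refl))) =
      inj₂ (inj₁ (π₀-pair 1 _ , subst (λ s → Val γ s 0 0) (sym (π₁-pair 1 _)) val))
    Disj-valid {n} {j} ne (inj₂ (_ , inj₂ (val , refl))) =
      inj₂ (inj₂ (π₀-pair 2 _ , subst (λ s → Val γ s 0 1) (sym (π₁-pair 2 _)) val
                 , pair n j , π₁-pair 2 _ , λ e → ne (trans (sym (π₀-pair n j)) e)))

    module _ {x : Pt 2ω} (¬m : ¬ Contains 0 x) where

      private
        lifted = lift-Lifts x

      lift-≡ : ∀ n v → π₀ v ≡ unbit (x n) → Correct (nodeAt n) (π₁ v) x → lift x n ≡ v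
      lift-≡ n v b w = trans (sym (pair-unpair (lift x n)))
        (trans (cong₂ pair (trans (proj₁ lifted n) (sym b)) (Correct-unique (nodeAt n) (proj₂ lifted n) w))
               (pair-unpair v))

      -- Correct witnesses are unique, so it is enough that the true literals make `π₁ v` correct: a
      -- literal gives the named disjunct, and refuters exclude the earlier ones.
      Fixes-sound : ∀ {D n v k} → (∀ ℓ → Mem ℓ D → (x , k) ∈ ⟦ ℓ ⟧) → Fixes γ D n v → lift x n ≡ v
      Fixes-sound {D} {n} {v} {k} all ((a , k′ , mem , e) , w) = lift-≡ n v bits (correct w)
        where
        bits : π₀ v ≡ unbit (x n)
        bits = trans e (trans (sym (unbit-bit (seq a n))) (cong unbit (sym
          (ball-elim (λ j → bit ∘ seq j) n a
            (out (proj₁ (unbox {2ω} {ω} {ct 2ω n a} {k′} {x} {k} (inn (from (⟦pair⟧ 0 _) (all _ mem))))))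
            n ℕₚ.≤-refl))))
        absent : ∀ t → Mem (pair (suc t) n) D → ¬ Contains n x
        absent t mem = from (⟦pair⟧ (suc t) n {x , k}) (all _ mem)
        correct : (π₁ v ≡ 0 × (n ≡ 0 ⊎ γ 0 ≡ 0 ⊎ Mem (pair 1 n) D ⊎ Mem (pair 2 n) D) ⊎
                   ∃[ j ] π₁ v ≡ suc j × (∃[ ℓ ] Mem ℓ D × Disj γ n j ℓ) ×
                     (∀ k → k ℕ.< j → ∃[ ℓ ] ∃[ ℓ′ ] Disj γ n k ℓ × Mem ℓ′ D × Refutes γ ℓ ℓ′)) →
                  Correct (nodeAt n) (π₁ v) x
        correct (inj₁ (e , inj₁ refl)) = inj₁ (e , ¬m)
        correct (inj₁ (e , inj₂ (inj₁ h))) =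
          inj₁ (e , subst (λ M → ¬ x ∈ ρ 2ω (der M)) (sym (root-leaf h n)) ¬m)
        correct (inj₁ (e , inj₂ (inj₂ (inj₁ mem)))) = inj₁ (e , absent 0 mem)
        correct (inj₁ (e , inj₂ (inj₂ (inj₂ mem)))) = inj₁ (e , absent 1 mem)
        correct (inj₂ (j , e , (ℓ , mem , D) , h)) = inj₂ (j , e , from (Disj-sem D {x , k}) (all ℓ mem) ,
          λ i i<j D′ → let ℓ₁ , ℓ′ , D₁ , mem′ , ref = h i i<j in
            refuter-excludes ℓ₁ ℓ′ ref (all ℓ′ mem′) (to (Disj-sem D₁ {x , k}) D′))

      sound : ∀ c k → Cert (γ , c) → All c (x , k) → lift x ∈ N ωω k
      sound c k (_ , _ , m , u , mem0 , (K , memK) , fixes) all =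
        subst (λ k → lift x ∈ N ωω k) (sym k≡m)
          (from (mem-correct ωω m u m (ball-intro seq m u λ n n≤m →
             Fixes-sound {π₁ c} {n} {seq u n} {k} all (fixes n (ℕ.s≤s n≤m))) ℕₚ.≤-refl) mem0)
        where
        k≡m : k ≡ m
        k≡m = sing-elim {m} (out (proj₂ (unbox {2ω} {ω} {K} {sing m} {x} {k} (inn (from (⟦pair⟧ 0 _) (all _ memK))))))

      -- Only the first alternative occurs if ξ ≤ 2.
      Origin : ℕ → Set
      Origin ℓ = π₀ ℓ ≡ 0 ⊎ ∃[ s ] s ≢ 0 × (Val γ s 0 1 ⊎ γ 0 ≡ 1 × ¬ Contains s x)

      module _ (m : ℕ) where

        Good : ℕ → Set
        Good ℓ = (x , m) ∈ ⟦ ℓ ⟧ × Valid γ ℓ × Origin ℓ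

        good-box : ∀ {K k} → x ∈ N 2ω K → m ∈ N ω k → Good (pair 0 (pair K k))
        good-box p q = to (⟦pair⟧ 0 _) (out (box {2ω} {ω} (inn p) (inn q))) , inj₁ (π₀-pair 0 _) , inj₁ (π₀-pair 0 _)

        good-Disj : ∀ {n j ℓ} → n ≢ 0 → Disj γ n j ℓ → (x , m) ∈ ⟦ ℓ ⟧ → Good ℓ
        good-Disj {n} ne D t = t , Disj-valid ne D , Sum.map₂ (λ (_ , _ , val) → n , ne , inj₁ val) (Disj-index D)

        good-Refutes : ∀ {n k ℓ ℓ′} → n ≢ 0 → Disj γ n k ℓ → Refutes γ ℓ ℓ′ → (x , m) ∈ ⟦ ℓ′ ⟧ → Good ℓ′
        good-Refutes ne D (inj₁ (_ , e , _)) t = t , inj₁ e , inj₁ e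
        good-Refutes ne D (inj₂ (t≢0 , j , D′)) t with Disj-index D
        ... | inj₁ e            = contradiction e t≢0
        ... | inj₂ (_ , ne′ , _) = good-Disj ne′ D′ t

        Evidence : ℕ → ℕ → List ℕ → Set
        Evidence n w L =
          w ≡ 0 × (n ≡ 0 ⊎ γ 0 ≡ 0 ⊎ Mem (pair 1 n) (listCode L) ⊎ Mem (pair 2 n) (listCode L)) ⊎
          ∃[ j ] w ≡ suc j × (∃[ ℓ ] Mem ℓ (listCode L) × Disj γ n j ℓ) ×
            (∀ k → k ℕ.< j → ∃[ ℓ ] ∃[ ℓ′ ] Disj γ n k ℓ × Mem ℓ′ (listCode L) × Refutes γ ℓ ℓ′)

        singleton : ∀ {ℓ} → Good ℓ → AllGood Good (ℓ ∷ [])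
        singleton g (here refl) = g

        Mem-here : ∀ {ℓ} L → Mem ℓ (listCode (ℓ ∷ L))
        Mem-here {ℓ} L = from (Mem-listCode (ℓ ∷ L)) (here refl)

        zero-evidence : ∀ n → ¬ Contains n x → ∃[ L ] AllGood Good L × Evidence n 0 L
        zero-evidence n ¬r with n ℕ.≟ 0 | head root
        ... | yes e | _      = [] , (λ ()) , inj₁ (refl , inj₁ e)
        ... | no _  | leaf h = [] , (λ ()) , inj₁ (refl , inj₂ (inj₁ h))
        zero-evidence zero ¬r | no ne | union h = contradiction refl ne
        zero-evidence (suc n) ¬r | no ne | union h with head (nodeAt (suc n))
        ... | leaf h′ = pair 1 (suc n) ∷ [] , singleton
                ( to (⟦pair⟧ 1 (suc n)) ¬r
                , inj₂ (inj₁ (π₀-pair 1 _ , subst (λ s → Val γ s 0 0) (sym (π₁-pair 1 _)) (from (Val⇔ (suc n)) h′)))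
                , inj₂ (suc n , ne , inj₂ (h , ¬r)) )
              , inj₁ (refl , inj₂ (inj₂ (inj₁ (Mem-here []))))
        -- The node is deep: at depth 1 it would contain x by `Contains-child`, against the
        -- assumption.
        ... | union h′ = pair 2 (suc n) ∷ [] , singleton
                ( to (⟦pair⟧ 2 (suc n)) ¬r
                , inj₂ (inj₂ (π₀-pair 2 _ , subst (λ s → Val γ s 0 1) (sym (π₁-pair 2 _)) (from (Val⇔ (suc n)) h′)
                             , n , π₁-pair 2 _ , λ e → ¬r (Contains-child h ¬m n e)))
                , inj₂ (suc n , ne , inj₂ (h , ¬r)) )
              , inj₁ (refl , inj₂ (inj₂ (inj₂ (Mem-here []))))

        evidence : ∀ n w → Correct (nodeAt n) w x → ∃[ L ] AllGood Good L × Evidence n w L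
        evidence n w (inj₁ (refl , ¬r)) = zero-evidence n ¬r
        evidence n w (inj₂ (j , refl , D , least)) =
          let ℓ , Dj       = Disj-total n j
              L , g , refs = gather Good RefutedAt mono j refutedAt
          in ℓ ∷ L , (λ { (here refl) → good-Disj n≢0 Dj (to (Disj-sem Dj {x , m}) D) ; (there p) → g p })
           , inj₂ (j , refl , (ℓ , Mem-here L , Dj) , λ k k<j → mono k {L} {ℓ ∷ L} there (refs k k<j))
          where
          n≢0 : n ≢ 0
          n≢0 refl = ¬m (from (Disjunct-ρ root x) (j , D))
          RefutedAt : ℕ → List ℕ → Set
          RefutedAt k L = ∃[ ℓ ] ∃[ ℓ′ ] Disj γ n k ℓ × Mem ℓ′ (listCode L) × Refutes γ ℓ ℓ′
          mono : ∀ k {L L′} → (∀ {ℓ} → ℓ List.∈ L → ℓ List.∈ L′) → RefutedAt k L → RefutedAt k L′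
          mono k {L} {L′} h (ℓ , ℓ′ , D , mem , ref) =
            ℓ , ℓ′ , D , from (Mem-listCode L′) (h (to (Mem-listCode L) mem)) , ref
          refutedAt : ∀ k → k ℕ.< j → ∃[ L ] AllGood Good L × RefutedAt k L
          refutedAt k k<j =
            let ℓ , Dk       = Disj-total n k
                -- Minimality of j keeps x out of the k-th disjunct, so one of the refuters of that
                -- disjunct is true at x.
                ℓ′ , ref , t = refuter-exists ℓ {x , m} λ t → least k k<j (from (Disj-sem Dk {x , m}) t)
            in ℓ′ ∷ [] , singleton (good-Refutes n≢0 Dk ref t) , ℓ , ℓ′ , Dk , Mem-here [] , ref

        fixing : ∀ n → ∃[ L ] AllGood Good L × Fixes γ (listCode L) n (lift x n)
        fixing n =
          let a , p       = ct-covers 2ω n x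
              L , g , ev  = evidence n (wit (lift x) n) (proj₂ lifted n)
              ℓ           = pair 0 (pair (ct 2ω n a) whole)
          in ℓ ∷ L , (λ { (here refl) → good-box p (whole-all m) ; (there q) → g q })
           , (a , whole , Mem-here L , trans (proj₁ lifted n)
                (trans (cong unbit (ball-elim (λ j → bit ∘ seq j) n a p n ℕₚ.≤-refl)) (unbit-bit (seq a n))))
           , weaken L ev
          where
          weaken : ∀ L {ℓ} → Evidence n (wit (lift x) n) L → Evidence n (wit (lift x) n) (ℓ ∷ L)
          weaken L {ℓ} = Sum.map
            (λ (e , r) → e , Sum.map₂ (Sum.map₂ (Sum.map later later)) r)
            (λ (j , e , (ℓ , mem , D) , r) → j , e , (ℓ , later mem , D) ,
              λ k l → let ℓ , ℓ′ , D , mem , ref = r k l in ℓ , ℓ′ , D , later mem , ref)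
            where
            later : ∀ {ℓ′} → Mem ℓ′ (listCode L) → Mem ℓ′ (listCode (ℓ ∷ L))
            later mem = from (Mem-listCode (ℓ ∷ L)) (there (to (Mem-listCode L) mem))

        complete : lift x ∈ N ωω m → ∃[ c ] Cert (γ , c) × All c (x , m) × (∀ ℓ → Mem ℓ (π₁ c) → Origin ℓ)
        complete inside =
          let L , g , fixes = gather Good (λ n L → Fixes γ (listCode L) n (lift x n)) mono (suc m) (λ n _ → fixing n)
          in certify L g fixes
          where
          mono : ∀ n {L L′} → (∀ {ℓ} → ℓ List.∈ L → ℓ List.∈ L′) →
                 Fixes γ (listCode L) n (lift x n) → Fixes γ (listCode L′) n (lift x n)
          mono n {L} {L′} h = Fixes-mono {γ} {listCode L} {listCode L′} {n} {lift x n} λ ℓ mem →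
            from (Mem-listCode L′) (h (to (Mem-listCode L) mem))
          K : ∃[ i ] x ∈ N 2ω (ct 2ω 0 i)
          K = ct-covers 2ω 0 x
          u : ∃[ u ] (∀ n → n ℕ.≤ m → seq u n ≡ lift x n)
          u = seq-dense (lift x) m
          certify : ∀ L → AllGood Good L → (∀ n → n ℕ.< suc m → Fixes γ (listCode L) n (lift x n)) →
                    ∃[ c ] Cert (γ , c) × All c (x , m) × (∀ ℓ → Mem ℓ (π₁ c) → Origin ℓ)
          -- Only now, with the list of literals complete, is the flag known.
          certify L g fixes = headed (em {∃[ ℓ ] Mem ℓ D × π₀ ℓ ≡ 2})
            where
            L′ = pair 0 (pair (ct 2ω 0 (proj₁ K)) (sing m)) ∷ L
            D : ℕ
            D = listCode L′
            good : ∀ {ℓ} → Mem ℓ D → Good ℓ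
            good mem with to (Mem-listCode L′) mem
            ... | here refl = good-box (proj₂ K) (sing-intro m)
            ... | there p   = g p
            body : Certifies γ D
            body = (λ i l → proj₁ (proj₂ (good (i , l , refl)))) , m , proj₁ u ,
              to (mem-correct ωω m (proj₁ u) m (ball-intro seq m (proj₁ u) λ n l → sym (proj₂ u n l)) ℕₚ.≤-refl) inside ,
              (_ , Mem-here L) ,
              λ { n (ℕ.s≤s l) → subst (Fixes γ D n) (sym (proj₂ u n l)) (mono n {L} {L′} there (fixes n (ℕ.s≤s l))) }
            finish : ∀ h → Headed h D → ∃[ c ] Cert (γ , c) × All c (x , m) × (∀ ℓ → Mem ℓ (π₁ c) → Origin ℓ)
            finish h head = pair h D , cert , all-true , origins
              where
              cert : Cert (γ , pair h D)
              cert = subst₂ (λ h D → Headed h D × Certifies γ D) (sym (π₀-pair h D)) (sym (π₁-pair h D)) (head , body)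
              all-true : All (pair h D) (x , m)
              all-true ℓ mem = proj₁ (good (subst (Mem ℓ) (π₁-pair h D) mem))
              origins : ∀ ℓ → Mem ℓ (π₁ (pair h D)) → Origin ℓ
              origins ℓ mem = proj₂ (proj₂ (good (subst (Mem ℓ) (π₁-pair h D) mem)))
            headed : Dec (∃[ ℓ ] Mem ℓ D × π₀ ℓ ≡ 2) → _
            headed (yes p) = finish 1 (inj₂ (refl , p))
            headed (no ¬p) = finish 0 (inj₁ (refl , λ i l e → ¬p (_ , (i , l , refl) , e)))

  -- Borel classes of coded sets and of their sections

  𝚺-resp : ∀ {X ξ P Q} → (∀ x → P x ⇔ Q x) → 𝚺 X ξ P → 𝚺 X ξ Q
  𝚺-resp e (𝚺-one ξ≈ (ε , ⊆ , ⊇)) =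
    𝚺-one ξ≈ (ε , (λ {x} q → ⊆ (from (e x) q)) , λ {x} m → to (e x) (⊇ m))
  𝚺-resp e (𝚺-⋃ two≤ Q η 1≤ <ξ s (⊆ , ⊇)) =
    𝚺-⋃ two≤ Q η 1≤ <ξ s ((λ {x} q → ⊆ (from (e x) q)) , λ {x} m → to (e x) (⊇ m))

  ρ-𝚺 : ∀ X {ξ γ} (d : BC ξ γ) → 𝚺 X ξ (ρ X d)
  ρ-𝚺 X (BC-one ξ≈ _)                 = 𝚺-one ξ≈ (_ , (λ p → p) , λ p → p)
  ρ-𝚺 X (BC-⋃ two≤ _ _ η _ 1≤ <ξ d) = 𝚺-⋃ two≤ _ η 1≤ <ξ (λ i → ρ-𝚺 X (d i)) ((λ p → p) , λ p → p)

  ∁ρ-𝚷 : ∀ X {ξ γ} (d : BC ξ γ) → 𝚷 X ξ (∁ (ρ X d))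
  ∁ρ-𝚷 X d = 𝚺-resp (λ x → mk⇔ (λ p ¬p → ¬p p) dne) (ρ-𝚺 X d)

  sections-Open : ∀ (δ ks : ℕ → ℕ) → Open 2ω (λ x → ∃[ i ] ∃[ j ] (x , ks i) ∈ N BX (δ j))
  sections-Open δ ks = nbhd , (λ (i , j , m , m′) → pair i j , hit m m′) , λ (n , m) → miss n m
    where
    nbhd : ℕ → ℕ
    nbhd n with N? ω (π₁ (δ (π₁ n))) (ks (π₀ n))
    ... | yes _ = π₀ (δ (π₁ n))
    ... | no  _ = 0
    hit′ : ∀ {x} n {i j} → π₀ n ≡ i → π₁ n ≡ j → x ∈ N 2ω (π₀ (δ j)) → ks i ∈ N ω (π₁ (δ j)) → x ∈ N 2ω (nbhd n)
    hit′ n refl refl m m′ with N? ω (π₁ (δ (π₁ n))) (ks (π₀ n))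
    ... | yes _ = m
    ... | no ¬m = contradiction m′ ¬m
    hit : ∀ {x i j} → x ∈ N 2ω (π₀ (δ j)) → ks i ∈ N ω (π₁ (δ j)) → x ∈ N 2ω (nbhd (pair i j))
    hit {x} {i} {j} = hit′ (pair i j) (π₀-pair i j) (π₁-pair i j)
    miss : ∀ {x} n → x ∈ N 2ω (nbhd n) → ∃[ i ] ∃[ j ] (x , ks i) ∈ N BX (δ j)
    miss n m with N? ω (π₁ (δ (π₁ n))) (ks (π₀ n))
    ... | yes m′ = π₀ n , π₁ n , m , m′
    ... | no  _  = contradiction m (N-zero 2ω)

  -- If P computes g, the preimage of an open set under g is a countable union of sections of P, so
  -- this yields measurability at the same level. The two unions merge into one indexed by pairs.
  sections-𝚺 : ∀ {ξ γ} (d : BC ξ γ) (ks : ℕ → ℕ) → 𝚺 2ω ξ (λ x → ∃[ i ] (x , ks i) ∈ ρ BX d)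
  sections-𝚺 {γ = γ} (BC-one ξ≈ _) ks = 𝚺-one ξ≈ (sections-Open (λ j → γ (suc j)) ks)
  sections-𝚺 (BC-⋃ two≤ _ _ η _ 1≤ <ξ d) ks =
    -- Complements do not commute with unions, so a sub-code is used with one section at a time; the
    -- constant sequence fits this into the induction hypothesis.
    𝚺-⋃ two≤ (λ n x → ∃[ i ] (x , ks (π₀ n)) ∈ ρ BX (d (π₁ n))) (λ n → η (π₁ n))
      (λ n → 1≤ (π₁ n)) (λ n → <ξ (π₁ n)) (λ n → sections-𝚺 (d (π₁ n)) (λ (_ : ℕ) → ks (π₀ n)))
      ( (λ { {x} (i , j , ¬m) → pair i j , λ (_ , m) → ¬m (subst (λ p → (x , ks (proj₁ p)) ∈ ρ BX (d (proj₂ p))) (unpair-pair i j) m) })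
      , λ (n , ¬m) → π₀ n , π₁ n , λ m → ¬m (0 , m) )

  -- The bijection and its inverse

  module Bijection {ξ γ} (d : BC ξ γ) where
    open Tree d
    open Lifting d
    open Certificates d

    B : Subset 2ω
    B = ∁ (ρ 2ω d)

    d₀ : BC one (F₀ γ)
    d₀ = BC-one (≤-refl , ≤-refl) refl

    C : Subset ωω
    C = ∁ (ρ ωω d₀)

    f : ωω ⇀ 2ω
    f = eval ωω 2ω prCode

    f-graph : ∀ z y → graph f z y ⇔ pr z ≗ y
    f-graph z y = mk⇔ (λ g → _⇀_.functional f {z} {pr z} {y} (prCode-spec z) g)
      (λ e → _⇀_.graph-resp f {z} {z} {pr z} {y} (λ _ → refl) e (prCode-spec z))

    C-Violation : ∀ z → z ∈ C ⇔ (¬ Violation (γ , z))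
    C-Violation z = mk⇔ (λ c v → c (to (violations-spec γ z) v)) (λ ok m → ok (from (violations-spec γ z) m))

    C-Lifts : ∀ z → z ∈ C → Lifts z (pr z) × pr z ∈ B
    C-Lifts z c = ¬Violation⇒Lifts {z} (to (C-Violation z) c)

    pr-lift : ∀ x → pr (lift x) ≗ x
    pr-lift x = Lifts-pr {lift x} {x} (lift-Lifts x)

    lift∈C : ∀ x → x ∈ B → lift x ∈ C
    lift∈C x ¬m = from (C-Violation (lift x)) (Lifts⇒¬Violation {lift x}
      (Lifts-resp {lift x} {x} {pr (lift x)} (λ n → sym (pr-lift x n)) (lift-Lifts x))
      λ m → ¬m (ρ-resp 2ω d {pr (lift x)} {x} (pr-lift x) m))

    C-unique : ∀ z z′ → z ∈ C → z′ ∈ C → pr z ≗ pr z′ → z ≗ z′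
    C-unique z z′ c c′ e = Lifts-unique {z} {z′} {pr z′}
      (Lifts-resp {z} {pr z} {pr z′} e (proj₁ (C-Lifts z c))) (proj₁ (C-Lifts z′ c′))

    preimage-Open : ∀ (ε : ℕ → ℕ) → Open ωω (λ z → ∃[ i ] pr z ∈ N 2ω (ε i))
    preimage-Open ε = nbhd , (λ {z} → hit z) , λ {z} → miss z
      where
      nbhd : ℕ → ℕ
      nbhd n = preimages (ε (π₀ n)) (π₁ n)
      hit : ∀ z → (∃[ i ] pr z ∈ N 2ω (ε i)) → ∃[ n ] z ∈ N ωω (nbhd n)
      hit z (i , m) with to (preimages-spec (ε i) z) m
      ... | j , m′ = pair i j , subst (λ k → z ∈ N ωω k) (sym at) m′
        where
        at : nbhd (pair i j) ≡ preimages (ε i) j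
        at = cong₂ (λ a b → preimages (ε a) b) (π₀-pair i j) (π₁-pair i j)
      miss : ∀ z → (∃[ n ] z ∈ N ωω (nbhd n)) → ∃[ i ] pr z ∈ N 2ω (ε i)
      miss z (n , m) = π₀ n , from (preimages-spec (ε (π₀ n)) z) (π₁ n , m)

    f-continuous : ContinuousOn f C
    f-continuous = (λ {z} _ → pr z , prCode-spec z) , λ U (ε , ⊆ , ⊇) →
      (λ z → ∃[ i ] pr z ∈ N 2ω (ε i)) , preimage-Open ε , λ z _ → mk⇔
        (λ (y , g , u) → let i , m = ⊆ u in i , N-resp 2ω (ε i) {y} {pr z} (λ n → sym (to (f-graph z y) g n)) m)
        (λ (i , m) → pr z , prCode-spec z , ⊇ (i , m))

    bijection : ContinuousBijection f C B
    bijection = record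
      { continuous = f-continuous
      ; into       = λ {z} {y} c g m → proj₂ (C-Lifts z c) (ρ-resp 2ω d {y} {pr z} (λ n → sym (to (f-graph z y) g n)) m)
      ; injective  = λ {z} {z′} {y} c c′ g g′ →
          C-unique z z′ c c′ λ n → trans (to (f-graph z y) g n) (sym (to (f-graph z′ y) g′ n))
      ; onto       = λ {y} b → lift y , lift∈C y b , from (f-graph (lift y) y) (pr-lift y)
      }

    g : 2ω ⇀ ωω
    g = record
      { graph      = λ y z → z ∈ C × graph f z y
      ; graph-resp = λ { {y} {y′} {z} {z′} e e′ (c , gr) →
          (λ m → c (ρ-resp ωω d₀ {z′} {z} (λ n → sym (e′ n)) m)) , _⇀_.graph-resp f {z} {z′} {y} {y′} e′ e gr }
      ; functional = λ {y} {z} {z′} (c , gr) (c′ , gr′) →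
          ContinuousBijection.injective bijection {z} {z′} {y} c c′ gr gr′
      }

    g-inverse : InverseOn g f C B
    g-inverse x y _ = mk⇔ (λ p → p) (λ p → p)

    -- On B the inverse takes x to `lift x`, so this is what a set has to satisfy in order to
    -- compute it.
    Decides : Subset BX → Set
    Decides P = ∀ x → x ∈ B → ∀ k → lift x ∈ N ωω k ⇔ (x , k) ∈ P

    g-computes : ∀ P → Decides P → Computes {2ω} {ωω} P g B
    g-computes P decides = (λ {x} b → lift x , g-lift x b) , λ x b k → mk⇔
      (λ (z , gr , m) → to (decides x b k)
        (N-resp ωω k {z} {lift x} (_⇀_.functional g {x} {z} {lift x} gr (g-lift x b)) m))
      (λ p → lift x , g-lift x b , from (decides x b k) p)
      where
      g-lift : ∀ x → x ∈ B → graph g x (lift x)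
      g-lift x b = lift∈C x b , from (f-graph (lift x) x) (pr-lift x)

    computed-measurable : ∀ {ℓ} (Γ : Subset 2ω → Set ℓ) P → Computes {2ω} {ωω} P g B →
                          (∀ (ks : ℕ → ℕ) → Γ (λ x → ∃[ i ] (x , ks i) ∈ P)) → MeasurableOn Γ g B
    computed-measurable Γ P (defined , computes) sections = defined , λ U (ε , ⊆ , ⊇) →
      (λ x → ∃[ i ] (x , ε i) ∈ P) , sections ε , λ x b → mk⇔
        (λ (z , gr , u) → let i , m = ⊆ u in i , to (computes x b (ε i)) (z , gr , m))
        (λ (i , p) → let z , gr , m = from (computes x b (ε i)) p in z , gr , ⊇ (i , m))

    -- A union has rank at least 2, but for ξ ≤ 2 the union nodes other than the root would have
    -- rank at most 1.
    shallow : ξ ≤ two → ∀ s → s ≢ 0 → ¬ Val γ s 0 1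
    shallow ξ≤2 s ne val = two≰one (≤-trans (union-rank (nodeAt s) (to (Val⇔ s) val))
      (rank-bound (λ η<ξ → s≤s⁻¹ (≤-trans η<ξ ξ≤2)) s ne (to (Val⇔ s) val)))

    shallow-Contains : ξ ≤ two → γ 0 ≡ 1 → ∀ {x} → x ∈ B → ∀ s → s ≢ 0 → Contains s x
    shallow-Contains ξ≤2 h {x} b = tree-induction _ (λ ne → contradiction refl ne) step
      where
      step : ∀ n → (π₀ n ≢ 0 → Contains (π₀ n) x) → suc n ≢ 0 → Contains (suc n) x
      step n ih _ with π₀ n ℕ.≟ 0
      ... | yes e = Contains-child {x} h b n e
      ... | no ne with head (nodeAt (π₀ n))
      ...   | union h′ = contradiction (from (Val⇔ (π₀ n)) h′) (shallow ξ≤2 (π₀ n) ne)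
      ...   | leaf h′  = subst (λ M → x ∈ ρ 2ω (der M))
                           (sym (trans (nodeAt-suc n) (childNode-leaf (nodeAt (π₀ n)) (π₁ n) h′))) (ih ne)

    -- `Origin` charges every literal other than a box either to a union below the root or to a node
    -- that misses x. Both are impossible for ξ ≤ 2, so the certificates provided by `complete`
    -- consist of boxes.
    open-decides : ξ ≤ two → Decides (λ y → OpenCert (γ , y))
    open-decides ξ≤2 x b k = mk⇔
      (λ m → relax (complete {x} b k m))
      λ (c , cert , boxes) → sound {x} b c k cert (closed c boxes)
      where
      tag0 : ∀ ℓ → Origin {x} b ℓ → π₀ ℓ ≡ 0
      tag0 ℓ (inj₁ e)                        = e
      tag0 ℓ (inj₂ (s , ne , inj₁ val))      = ⊥-elim (shallow ξ≤2 s ne val)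
      tag0 ℓ (inj₂ (s , ne , inj₂ (h , ¬r))) = ⊥-elim (¬r (shallow-Contains ξ≤2 h {x} b s ne))
      box-literal : ∀ ℓ → π₀ ℓ ≡ 0 → (x , k) ∈ ⟦ ℓ ⟧ → ∃[ K ] ℓ ≡ pair 0 K × (x , k) ∈ N BX K
      box-literal ℓ t m = π₁ ℓ , trans (sym (pair-unpair ℓ)) (cong (λ t → pair t (π₁ ℓ)) t)
                        , to (Den-0 {π₀ ℓ} {π₁ ℓ} {x , k} t) m
      opened : ∀ c → All c (x , k) → (∀ ℓ → Mem ℓ (π₁ c) → Origin {x} b ℓ) → ∀ i → i ℕ.< π₀ (π₁ c) →
               ∃[ K ] seq (π₁ (π₁ c)) i ≡ pair 0 K × (x , k) ∈ N BX K
      opened c all origins i l = box-literal ℓ (tag0 ℓ (origins ℓ (i , l , refl))) (all ℓ (i , l , refl))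
        where
        ℓ : ℕ
        ℓ = seq (π₁ (π₁ c)) i
      relax : (∃[ c ] Cert (γ , c) × All c (x , k) × (∀ ℓ → Mem ℓ (π₁ c) → Origin {x} b ℓ)) → OpenCert (γ , (x , k))
      relax (c , cert , all , origins) = c , cert , opened c all origins
      closed : ∀ c → (∀ i → i ℕ.< π₀ (π₁ c) → ∃[ K ] seq (π₁ (π₁ c)) i ≡ pair 0 K × (x , k) ∈ N BX K) → All c (x , k)
      closed c boxes ℓ (i , l , e) with boxes i l
      ... | K , e′ , m = subst (λ ℓ → (x , k) ∈ ⟦ ℓ ⟧) (trans (sym e′) e) (to (⟦pair⟧ 0 K) m)

    Decision : Ord → Pt ωω → Set
    Decision μ δ = Σ (BC μ δ) λ d₂ → Decides (ρ BX d₂)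

    open-decision : ∀ {μ} → μ ≈ one → ξ ≤ two → Decision μ (F₂ γ)
    open-decision μ≈1 ξ≤2 = BC-one μ≈1 refl , λ x b k → open-decides ξ≤2 x b k ⟫ openCerts-spec γ (x , k)

    -- A union code denotes a union of complements of its sub-codes, which is why the certificates
    -- enter through codes of their complements; `cert-code` keeps these below μ.
    certified-decision : ∀ {μ} → two ≤ μ → (∀ {η} → η < ξ → η ≤ μ) → Decision μ (1 ◂ certificates γ)
    certified-decision {μ} two≤μ h =
      BC-⋃ two≤μ refl _ (λ i → proj₁ (kid i)) (certificates-spec γ)
        (λ i → proj₁ (proj₂ (kid i))) (λ i → proj₁ (proj₂ (proj₂ (kid i)))) (λ i → ComplementCode.code (kid-code i)) ,
      λ x b k → mk⇔
        (λ m → listed x b k (complete {x} b k m))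
        λ (i , ¬m) → decided x b k i (dne λ ¬all → ¬m (from (kid-sem i (x , k)) ¬all))
      where
      certOf : ℕ → ℕ
      certOf i = orDummy (certs γ i)
      cases : ∀ i → certOf i ≡ single (pair 0 0) ⊎ Cert (γ , certOf i)
      cases i = Sum.map₂ (λ e → from (certs-spec γ (certOf i)) (i , e)) (orDummy-cases (certs γ i))
      kid : ∀ i → BoundedCode μ (certOf i)
      kid i = by-cases (cases i)
        where
        by-cases : ∀ {c} → c ≡ single (pair 0 0) ⊎ Cert (γ , c) → BoundedCode μ c
        by-cases (inj₁ refl)     = one , ≤-refl , two≤μ , dummy
        by-cases {c} (inj₂ cert) = cert-code two≤μ h c cert
      kid-code : ∀ i → ComplementCode (proj₁ (kid i)) (certOf i)
      kid-code i = proj₂ (proj₂ (proj₂ (kid i)))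
      kid-sem : ∀ i y → y ∈ ρ BX (ComplementCode.code (kid-code i)) ⇔ (¬ All (certOf i) y)
      kid-sem i = ComplementCode.sem (kid-code i)
      listed : ∀ x (b : x ∈ B) k → (∃[ c ] Cert (γ , c) × All c (x , k) × (∀ ℓ → Mem ℓ (π₁ c) → Origin {x} b ℓ)) →
               ∃[ i ] ¬ (x , k) ∈ ρ BX (ComplementCode.code (kid-code i))
      listed x b k (c , cert , all , _) with to (certs-spec γ c) cert
      ... | i , e = i , λ m → to (kid-sem i (x , k)) m (subst (λ n → All (orDummy n) (x , k)) (sym e) all)
      decided : ∀ x → x ∈ B → ∀ k i → All (certOf i) (x , k) → lift x ∈ N ωω k
      decided x b k i = by-cases (cases i)
        where
        by-cases : ∀ {c} → c ≡ single (pair 0 0) ⊎ Cert (γ , c) → All c (x , k) → lift x ∈ N ωω k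
        by-cases (inj₁ refl)     all = ⊥-elim (¬All-dummy all)
        by-cases {c} (inj₂ cert) all = sound {x} b c k cert all

  -- The constructor of the derivation agrees with γ(0), on which `F₂′` branches: a leaf has ξ⁻ = 1
  -- and falls under the case ξ ≤ 2, and a union has ξ⁻ ≥ 2.
  decision : ∀ {ξ γ} (d : BC ξ γ) → Bijection.Decision d (minus em ξ) (F₂′ γ)
  decision {ξ} {γ} d@(BC-one ξ≈1 h) =
    subst (Bijection.Decision d (minus em ξ)) (sym (cong (λ n → choose n (F₂ γ) (1 ◂ certificates γ)) h))
      (Bijection.open-decision d (minus-one ξ≈1) (≤-trans (proj₁ ξ≈1) ≤-suc))
  decision {ξ} {γ} d@(BC-⋃ two≤ξ h _ _ _ _ _ _) =
    subst (Bijection.Decision d (minus em ξ)) (sym (cong (λ n → choose n (F₂ γ) (1 ◂ certificates γ)) h))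
      (Bijection.certified-decision d (two≤minus two≤ξ) ≤minus)

theorem4p1 :
    (em : ExcludedMiddle 0ℓ) (𝒢 : GoodParametrization) →
    let open Codes 𝒢 in
    (∃[ F ] RecursiveOn {ωω} {ωω ⊗ ωω ⊗ ωω} F (Domain F) ×
      (∀ ξ → one ≤ ξ → ξ ≤ two → ∀ γ (d : BC ξ γ) →
        let B = ∁ (ρ 2ω d) in
        B ∈ 𝚷 2ω ξ ×
        (∃[ F₀ ] ∃[ F₁ ] ∃[ F₂ ] graph F γ (F₀ , F₁ , F₂) ×
          Σ (BC one F₀) λ d₀ →
            let C = ∁ (ρ ωω d₀)
                f = eval ωω 2ω F₁ in
            C ∈ 𝚷 ωω one ×
            ContinuousBijection f C B ×
            Σ (BC one F₂) λ d₂ →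
              ρ (2ω ⊗ ω) d₂ ∈ Open (2ω ⊗ ω) ×
              (∃[ g ] Computes {2ω} {ωω} (ρ (2ω ⊗ ω) d₂) g B ×
                ContinuousOn g B ×
                InverseOn g f C B)))) ×
    (∃[ F ] RecursiveOn {ωω} {ωω ⊗ ωω ⊗ ωω} F (Domain F) ×
      (∀ ξ → one ≤ ξ → ∀ γ (d : BC ξ γ) →
        let B = ∁ (ρ 2ω d) in
        B ∈ 𝚷 2ω ξ ×
        (∃[ F₀ ] ∃[ F₁ ] ∃[ F₂ ] graph F γ (F₀ , F₁ , F₂) ×
          Σ (BC one F₀) λ d₀ →
            let C = ∁ (ρ ωω d₀)
                f = eval ωω 2ω F₁ in
            C ∈ 𝚷 ωω one ×
            ContinuousBijection f C B ×
            Σ (BC (minus em ξ) F₂) λ d₂ →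
              ρ (2ω ⊗ ω) d₂ ∈ 𝚺 (2ω ⊗ ω) (minus em ξ) ×
              (∃[ g ] Computes {2ω} {ωω} (ρ (2ω ⊗ ω) d₂) g B ×
                MeasurableOn (𝚺 2ω (minus em ξ)) g B ×
                InverseOn g f C B))))
theorem4p1 em 𝒢 =
  (total FRF , total-recursive FRF , λ ξ _ ξ≤2 γ d → let module M = Bijection d in
    ∁ρ-𝚷 2ω d , F₀ γ , prCode , F₂ γ , Eq-refl Triple ,
    M.d₀ , ∁ρ-𝚷 ωω M.d₀ , M.bijection ,
    F₂-code γ , F₂-open γ ,
    M.g , F₂-computes ξ≤2 d , F₂-continuous ξ≤2 d , M.g-inverse) ,
  (total FRF′ , total-recursive FRF′ , λ ξ _ γ d → let module M = Bijection d in
    ∁ρ-𝚷 2ω d , F₀ γ , prCode , F₂′ γ , Eq-refl Triple ,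
    M.d₀ , ∁ρ-𝚷 ωω M.d₀ , M.bijection ,
    proj₁ (decision d) , ρ-𝚺 BX (proj₁ (decision d)) ,
    M.g , M.g-computes _ (proj₂ (decision d)) ,
    M.computed-measurable (𝚺 2ω (minus em ξ)) _ (M.g-computes _ (proj₂ (decision d))) (sections-𝚺 (proj₁ (decision d))) ,
    M.g-inverse)
  where
  open Codes 𝒢
  open Recursion 𝒢
  open Construction em 𝒢
  open Classical em using (≤-refl)
  F₂-code : ∀ γ → BC one (F₂ γ)
  F₂-code γ = BC-one (≤-refl , ≤-refl) refl
  F₂-open : ∀ γ → ρ BX (F₂-code γ) ∈ Open BX
  F₂-open γ = openCerts γ , (λ p → p) , λ p → p
  module _ {ξ γ} (ξ≤2 : ξ ≤ two) (d : BC ξ γ) where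
    open Bijection d
    F₂-computes : Computes {2ω} {ωω} (ρ BX (F₂-code γ)) g B
    F₂-computes = g-computes _ (proj₂ (open-decision (≤-refl , ≤-refl) ξ≤2))
    F₂-continuous : ContinuousOn g B
    F₂-continuous = computed-measurable (Open 2ω) _ F₂-computes (sections-Open (openCerts γ))
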